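{- Let $G$ be a dynamic unweighted, undirected (multi-)graph, and let $\lambda_t$ denote its min-cut value at time $t$. We can maintain a greedy tree-packing of size $\Theta(\lambda_t^3\log m)$ in the following manner. We maintain $\log m$ tree-packings $\mathcal T_i$ of various graphs of size $|\mathcal T_i|=\Theta(2^{3i}\log m)$, with $O(2^{5i}\log^2 m)$ worst-case recourse in tree-packing $\mathcal T_i$, using any minimum spanning tree algorithm with $O(1)$ worst-case recourse to maintain the individual trees. We then have that $\mathcal T_i$, for $i$ such that $\lambda_t\in[2^i,2^{i+1})$, is a greedy tree-packing on $G$ of the required size.
   Context: $m$ is the number of edges of $G$, which undergoes edge insertions and deletions. The min-cut value is the minimum number of edges whose deletion disconnects the graph. A tree-packing of a graph is a finite family of spanning trees of it. A tree-packing $(T_1,\dots,T_k)$ is greedy if each $T_{j+1}$ is a minimum weight spanning tree with respect to the edge weights given by the number of trees among $T_1,\dots,T_j$ containing the edge. The recourse of a tree-packing under an update is the number of changes (edges added to or removed from trees) made to the packing due to one edge update to $G$; worst-case recourse bounds this for each single update. The "various graphs" are dynamic graphs on the vertex set of $G$, chosen by the algorithm (one graph per $i$).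
   Formalization: Recourse counts changes to trees present before and after the update; whole trees appended or dropped when the rounded-down log m changes are not counted (counting them makes the claim false). The weights given to the minimum spanning tree algorithm may break ties between equally loaded edges. -}

module Defs where

open import Data.Nat.Base using (ℕ; _+_; _*_; _≤_)
open import Data.Nat.Properties using () renaming (_≟_ to _≟ℕ_)
open import Data.Nat.Logarithm using (⌊log₂_⌋)
open import Data.Integer.Base using (+_)
open import Data.Rational.Base using (ℚ; 0ℚ)
  renaming (_+_ to _+ℚ_; _≤_ to _≤ℚ_; _<_ to _<ℚ_; _/_ to _/ℚ_)
open import Data.Fin.Base using (Fin)
open import Data.Fin.Properties using () renaming (_≟_ to _≟F_)
open import Data.Product.Base using (_×_; ∃-syntax)
open import Data.Sum.Base using (_⊎_)
open import Data.Bool.Base using (if_then_else_)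
open import Data.List.Base using (List; []; _∷_; _++_; length; map; filter; foldr)
open import Data.List.Relation.Unary.All using (All)
open import Data.List.Relation.Unary.Unique.Propositional using (Unique)
open import Data.List.Relation.Binary.Permutation.Propositional using (_↭_)
open import Data.List.Relation.Binary.Subset.Propositional using (_⊆_)
open import Data.List.Membership.Propositional using (_∈_; _∉_)
import Data.List.Membership.DecPropositional as DecMembership
open import Relation.Nullary using (¬_; yes; no; does)
open import Relation.Binary.Definitions using (DecidableEquality)
open import Relation.Binary.PropositionalEquality using (_≡_; _≢_; refl; cong)

-- The label keeps parallel edges apart.  The order of the two ends is
-- irrelevant: see `Joins`.
record Edge (n : ℕ) : Set where
  constructor edge
  field
    end₁ end₂ : Fin n
    label     : ℕ

open Edge public

_≟_ : ∀ {n} → DecidableEquality (Edge n)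
edge a b k ≟ edge c d l with a ≟F c | b ≟F d | k ≟ℕ l
... | yes refl | yes refl | yes refl = yes refl
... | no a≢c   | _        | _        = no λ e → a≢c (cong end₁ e)
... | _        | no b≢d   | _        = no λ e → b≢d (cong end₂ e)
... | _        | _        | no k≢l   = no λ e → k≢l (cong label e)

-- A finite set of edges is a list without repetitions; `Unique` is
-- demanded where such a set is introduced.
EdgeSet : ℕ → Set
EdgeSet n = List (Edge n)

module _ {n : ℕ} where

  open DecMembership (_≟_ {n}) using (_∈?_; _∉?_)

  infixl 6 _∖_

  _∖_ : EdgeSet n → EdgeSet n → EdgeSet n
  E ∖ S = filter (_∉? S) E

  ∣_△_∣ : EdgeSet n → EdgeSet n → ℕ
  ∣ S △ T ∣ = length (S ∖ T) + length (T ∖ S)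

  Joins : Edge n → Fin n → Fin n → Set
  Joins e u v = (end₁ e ≡ u × end₂ e ≡ v) ⊎ (end₁ e ≡ v × end₂ e ≡ u)

  data Walk (E : EdgeSet n) : Fin n → Fin n → Set where
    []   : ∀ {u} → Walk E u u
    step : ∀ {u v w} (e : Edge n) → e ∈ E → Joins e u v →
           Walk E v w → Walk E u w

  edgesOf : ∀ {E u v} → Walk E u v → List (Edge n)
  edgesOf []             = []
  edgesOf (step e _ _ p) = e ∷ edgesOf p

  -- All vertices visited except the last one, so that on a closed walk
  -- the common end vertex is listed once.
  verticesOf : ∀ {E u v} → Walk E u v → List (Fin n)
  verticesOf []                 = []
  verticesOf (step {u} _ _ _ p) = u ∷ verticesOf p

  Connected : EdgeSet n → Set
  Connected E = ∀ u v → Walk E u v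

  -- Loops and pairs of parallel edges are cycles of length 1 and 2.
  IsCycle : ∀ {E u} → Walk E u u → Set
  IsCycle p = edgesOf p ≢ [] × Unique (edgesOf p) × Unique (verticesOf p)

  Acyclic : EdgeSet n → Set
  Acyclic E = ∀ {u} (p : Walk E u u) → ¬ IsCycle p

  record IsMinCut (G : EdgeSet n) (k : ℕ) : Set where
    field
      attained : ∃[ S ] (Unique S × S ⊆ G × ¬ Connected (G ∖ S) × length S ≡ k)
      minimal  : ∀ S → Unique S → S ⊆ G → ¬ Connected (G ∖ S) → k ≤ length S

  record IsSpanningTree (G T : EdgeSet n) : Set where
    field
      unique    : Unique T
      subgraph  : T ⊆ G
      connected : Connected T
      acyclic   : Acyclic T

  totalWeight : (Edge n → ℚ) → EdgeSet n → ℚ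
  totalWeight w = foldr (λ e s → w e +ℚ s) 0ℚ

  record IsMST (G : EdgeSet n) (w : Edge n → ℚ) (T : EdgeSet n) : Set where
    field
      spanningTree : IsSpanningTree G T
      minimal      : ∀ S → IsSpanningTree G S → totalWeight w T ≤ℚ totalWeight w S

  IsTreePacking : EdgeSet n → List (EdgeSet n) → Set
  IsTreePacking G Ts = All (IsSpanningTree G) Ts

  load : List (EdgeSet n) → Edge n → ℚ
  load Ts e = + length (filter (e ∈?_) Ts) /ℚ 1

  IsGreedy : EdgeSet n → List (EdgeSet n) → Set
  IsGreedy G Ts = ∀ before T after → Ts ≡ before ++ T ∷ after →
                  IsMST G (load before) T

data Update (n : ℕ) : Set where
  insert delete : Edge n → Update n

module _ {n : ℕ} where

  apply : Update n → EdgeSet n → EdgeSet n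
  apply (insert e) G = e ∷ G
  apply (delete e) G = G ∖ (e ∷ [])

  -- Lists of updates have the most recent update first.
  current : EdgeSet n → List (Update n) → EdgeSet n
  current G₀ []       = G₀
  current G₀ (u ∷ us) = apply u (current G₀ us)

  Applicable : Update n → EdgeSet n → Set
  Applicable (insert e) G = e ∉ G
  Applicable (delete e) G = e ∈ G

  IsDynamic : EdgeSet n → List (Update n) → Set
  IsDynamic G₀ []       = Unique G₀
  IsDynamic G₀ (u ∷ us) = Applicable u (current G₀ us) × IsDynamic G₀ us

data WUpdate (n : ℕ) : Set where
  insert : Edge n → ℚ → WUpdate n
  delete : Edge n → WUpdate n

-- The input received so far, most recent update first, by a dynamic
-- minimum spanning tree algorithm started on the edgeless graph.
Run : ℕ → Set
Run n = List (WUpdate n)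

module _ {n : ℕ} where

  forget : WUpdate n → Update n
  forget (insert e _) = insert e
  forget (delete e)   = delete e

  edges : Run n → EdgeSet n
  edges h = current [] (map forget h)

  weight : Run n → Edge n → ℚ
  weight []               e = 0ℚ
  weight (insert f w ∷ h) e = if does (e ≟ f) then w else weight h e
  weight (delete _   ∷ h) e = weight h e

  IsRun : Run n → Set
  IsRun h = IsDynamic [] (map forget h)

-- The output may depend on the whole input history.  While the current
-- graph is disconnected only the recourse bound is demanded.
record MSTAlgorithm (n r : ℕ) : Set where
  field
    tree     : Run n → EdgeSet n
    correct  : ∀ h → IsRun h → Connected (edges h) →
               IsMST (edges h) (weight h) (tree h)
    recourse : ∀ u h → IsRun (u ∷ h) → ∣ tree h △ tree (u ∷ h) ∣ ≤ r

record PackingState (n : ℕ) : Set where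
  field
    graph : EdgeSet n
    runs  : List (Run n)

open PackingState public

-- State of the i-th packing after the given updates (most recent first)
-- of the given initial graph.  It cannot depend on future updates.
Maintainer : ℕ → Set
Maintainer n = EdgeSet n → List (Update n) → ℕ → PackingState n

module _ {n r : ℕ} (A : MSTAlgorithm n r) where

  open MSTAlgorithm A

  trees : List (Run n) → List (EdgeSet n)
  trees = map tree

  packing : PackingState n → List (EdgeSet n)
  packing P = trees (runs P)

  -- The run is on the graph G.  Its weights order the edges of G as the
  -- loads `ℓ` do, except that edges of equal load may get different
  -- weights: an arbitrary algorithm could otherwise choose anew among
  -- equally light trees at every update.
  record RunsOn (G : EdgeSet n) (ℓ : Edge n → ℚ) (h : Run n) : Set where
    field
      isRun       : IsRun h
      sameEdges   : edges h ↭ G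
      refinesLoad : ∀ {e f} → e ∈ G → f ∈ G → ℓ e <ℚ ℓ f → weight h e <ℚ weight h f

  record IsMaintained (P : PackingState n) : Set where
    field
      graph-unique  : Unique (graph P)
      isTreePacking : IsTreePacking (graph P) (packing P)
      eachTreeByA   : ∀ before h after → runs P ≡ before ++ h ∷ after →
                      RunsOn (graph P) (load (trees before)) h

  -- Changes made to the tree while the updates `us` are processed one by
  -- one after the run h, including those undone later within `us`.
  changes : Run n → List (WUpdate n) → ℕ
  changes h []       = 0
  changes h (u ∷ us) = ∣ tree (us ++ h) △ tree (u ∷ us ++ h) ∣ + changes h us

  -- hs ⟶ hs′ [ c ]: each run present both before and after is continued,
  -- with c changes in total to the corresponding trees.  Whole trees
  -- appended or dropped at the end of the packing, as its prescribed size
  -- Θ(2^{3i} log m) varies with m, are not counted in c.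
  data _⟶_[_] : List (Run n) → List (Run n) → ℕ → Set where
    append   : ∀ {hs′} → [] ⟶ hs′ [ 0 ]
    drop     : ∀ {hs} → hs ⟶ [] [ 0 ]
    continue : ∀ {h hs hs′ c} us → hs ⟶ hs′ [ c ] →
               (h ∷ hs) ⟶ ((us ++ h) ∷ hs′) [ changes h us + c ]

  RecourseAtMost : ℕ → PackingState n → PackingState n → Set
  RecourseAtMost b P P′ = ∃[ c ] ((runs P ⟶ runs P′ [ c ]) × c ≤ b)

-- x = Θ(y) with constant C.
infix 4 _≍[_]_

_≍[_]_ : ℕ → ℕ → ℕ → Set
x ≍[ C ] y = x ≤ C * y × y ≤ C * x

-- Rounding the logarithm down is immaterial inside Θ and O: it is exact
-- for one edge and loses less than a factor 2 for more.
log∣_∣ : ∀ {n} → EdgeSet n → ℕ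
log∣ G ∣ = ⌊log₂ length G ⌋

{-# OPTIONS --safe #-}

-- Let K = ⌈2 ^ i / 2⌉.  Call H strong if every partition of its vertices into p classes is crossed by
-- at least K (p - 1) edges; a graph with minimum cut at least 2 ^ i is strong.  The i-th packing lives
-- on a strong graph H ⊇ G in which every edge outside G is critical, i.e. crosses a tight partition;
-- if G is strong, then H = G.  As tight partitions can be uncrossed, O(1) edges of H change per update.
--
-- With ties broken by a fixed order the greedy packing is determined by H.  Deleting an edge e from H
-- only increases the loads of the other edges, while the sum of all loads stays the same, so in each
-- of the k = Θ(2 ^ (3 i) log m) trees at most load(e) many edges have to be reweighted.  Finally
-- load(e) = O(k / K + log m): the greedy tree is also minimum for the weights 2 ^ load, and a minimum
-- spanning tree of a strong graph has at most 1 / K of the total weight, so that the potential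
-- Σ 2 ^ load grows by a factor of at most 1 + 1 / K per tree.
--
-- In fact H follows the graph kept G instead of G.  It is empty while G has less than half the edges
-- needed to be connected and is G once there are enough of them; in between it catches up at twice the
-- speed of the updates.  So log ∣ H ∣ = O(log m) whenever H changes.

module Submission where

open import Data.Nat.Base
open import Data.Nat.Properties renaming (_≟_ to _≟ℕ_)
open import Data.Nat.Logarithm using (⌊log₂_⌋; ⌊log₂⌋-mono-≤; ⌊log₂[2^n]⌋≡n)
open import Data.Nat.Tactic.RingSolver using (solve-∀)
open import Data.Integer.Base as ℤ using (+≤+; +<+) renaming (+_ to pos)
import Data.Integer.Properties as ℤ
open import Data.Rational.Base using (ℚ; 0ℚ; fromℚᵘ)
  renaming (_+_ to _+ℚ_; _≤_ to _≤ℚ_; _<_ to _<ℚ_; _/_ to _/ℚ_)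
import Data.Rational.Properties as ℚ
open import Data.Rational.Unnormalised.Base as ℚᵘ using (mkℚᵘ; *≡*; *≤*; *<*)
import Data.Rational.Unnormalised.Properties as ℚᵘ
open import Data.Fin.Base using (Fin; toℕ)
open import Data.Fin.Properties using (toℕ<n; toℕ-injective) renaming (_≟_ to _≟F_)
open import Data.Product.Base using (_×_; _,_; Σ-syntax; ∃-syntax; proj₁; proj₂)
open import Data.Sum.Base using (_⊎_; inj₁; inj₂)
open import Data.List.Base using (List; []; _∷_; _++_; length; map; filter; allFin; cartesianProductWith)
  renaming (drop to dropˡ)
open import Data.List.Properties
  using (length-++; length-map; length-drop; length-filter; length-tabulate; ++-assoc; ∷-injective;
         filter-all; filter-accept; filter-reject; filter-++)
open import Data.List.Membership.Propositional using (_∈_; _∉_; find)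
open import Data.List.Membership.Propositional.Properties
import Data.List.Membership.DecPropositional as DecMembership
open import Data.List.Relation.Unary.Any using (here; there)
import Data.List.Relation.Unary.All as All
open All using (All; []; _∷_)
import Data.List.Relation.Unary.All.Properties as All
import Data.List.Relation.Unary.AllPairs as AllPairs
open AllPairs using (AllPairs; []; _∷_)
open import Data.List.Relation.Unary.Linked.Properties using (Linked⇒AllPairs)
open import Data.List.Relation.Unary.Unique.Propositional using (Unique)
import Data.List.Relation.Unary.Unique.Propositional.Properties as Unique
open import Data.List.Relation.Binary.Subset.Propositional using (_⊆_)
import Data.List.Relation.Binary.Subset.Propositional.Properties as ⊆
open import Data.List.Relation.Binary.Permutation.Propositional
  using (_↭_; module _↭_; prep; swap; ↭-refl; ↭-sym; ↭-trans; ↭-reflexive; ↭⇒↭ₛ)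
open import Data.List.Relation.Binary.Permutation.Propositional.Properties using (↭-length; ∈-resp-↭)
import Data.List.Relation.Binary.Permutation.Setoid.Properties as ↭ₛ
import Data.List.Sort as Sort
import Relation.Binary.Construct.On as On
import Relation.Binary.Construct.Flip.EqAndOrd as Flip
open import Relation.Binary.Bundles using (DecTotalOrder)
open import Relation.Binary.Definitions using (DecidableEquality; tri<; tri≈; tri>)
open import Relation.Binary.PropositionalEquality
open import Relation.Nullary using (¬_; Dec; yes; no; contradiction)
open import Relation.Nullary.Decidable using (¬?; _×-dec_; _⊎-dec_)
open import Algebra.Bundles using (CommutativeMonoid)
open import Algebra.Properties.CommutativeSemigroup +-commutativeSemigroup
  using () renaming (interchange to +-interchange)
open import Algebra.Properties.CommutativeSemigroup *-commutativeSemigroup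
  using () renaming (interchange to *-interchange; x∙yz≈y∙xz to *-x∙yz≈y∙xz)
open import Function.Base using (_∘_; id; case_of_)
open import Defs

-- A packing on `G` itself would have no useful recourse bound: once the minimum cut of `G` falls
-- far below `2 ^ i`, some edges lie in a large share of the trees, and deleting one of them may
-- even disconnect `G`. Both halves of the estimate rest on strength: the loads of consecutive
-- graphs have equal sums because both graphs are connected, and the cap on a single load needs
-- every partition to be crossed often.
--
-- With `k = K * q` trees the cap is `2 * q + s`, where `2 ^ s` bounds the number of edges of `H`.
-- As `q` is `O(2 ^ (2 i) log m)`, the product of `k` and the cap gets the exponent `5 i` and the
-- square of `log m`.
--
-- The detour through `kept` is forced by a bound stated in the current `m`: a strong graph on `n`
-- vertices has at least `K (n - 1)` edges, and `log n` is not `O(log m)` while `G` has very few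
-- edges.

-- Finite sums and counting

module _ {A : Set} where

  ∑ : List A → (A → ℕ) → ℕ
  ∑ []       f = 0
  ∑ (x ∷ xs) f = f x + ∑ xs f

  ∑-mono : ∀ xs {f g} → (∀ {x} → x ∈ xs → f x ≤ g x) → ∑ xs f ≤ ∑ xs g
  ∑-mono []       h = z≤n
  ∑-mono (x ∷ xs) h = +-mono-≤ (h (here refl)) (∑-mono xs (h ∘ there))

  ∑-cong : ∀ xs {f g} → (∀ {x} → x ∈ xs → f x ≡ g x) → ∑ xs f ≡ ∑ xs g
  ∑-cong []       h = refl
  ∑-cong (x ∷ xs) h = cong₂ _+_ (h (here refl)) (∑-cong xs (h ∘ there))

  ∑-+ : ∀ xs f g → ∑ xs (λ x → f x + g x) ≡ ∑ xs f + ∑ xs g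
  ∑-+ []       f g = refl
  ∑-+ (x ∷ xs) f g = trans (cong (f x + g x +_) (∑-+ xs f g)) (+-interchange (f x) (g x) _ _)

  ∑-*ˡ : ∀ xs κ f → ∑ xs (λ x → κ * f x) ≡ κ * ∑ xs f
  ∑-*ˡ []       κ f = sym (*-zeroʳ κ)
  ∑-*ˡ (x ∷ xs) κ f = trans (cong (κ * f x +_) (∑-*ˡ xs κ f)) (sym (*-distribˡ-+ κ (f x) _))

  ∑-const : ∀ xs κ → ∑ xs (λ _ → κ) ≡ length xs * κ
  ∑-const []       κ = refl
  ∑-const (x ∷ xs) κ = cong (κ +_) (∑-const xs κ)

  ∑-zero : ∀ xs {f : A → ℕ} → (∀ {x} → x ∈ xs → f x ≡ 0) → ∑ xs f ≡ 0
  ∑-zero []       h = refl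
  ∑-zero (x ∷ xs) h = cong₂ _+_ (h (here refl)) (∑-zero xs (h ∘ there))

  ∑-++ : ∀ xs ys f → ∑ (xs ++ ys) f ≡ ∑ xs f + ∑ ys f
  ∑-++ []       ys f = refl
  ∑-++ (x ∷ xs) ys f = trans (cong (f x +_) (∑-++ xs ys f)) (sym (+-assoc (f x) _ _))

  ∈⇒≤∑ : ∀ {xs x} f → x ∈ xs → f x ≤ ∑ xs f
  ∈⇒≤∑ f (here refl) = m≤m+n _ _
  ∈⇒≤∑ f (there x∈)  = ≤-trans (∈⇒≤∑ f x∈) (m≤n+m _ _)

∑-swap : ∀ {A B : Set} (xs : List A) (ys : List B) (f : A → B → ℕ) →
         ∑ xs (λ x → ∑ ys (f x)) ≡ ∑ ys (λ y → ∑ xs (λ x → f x y))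
∑-swap []       ys f = sym (∑-zero ys λ _ → refl)
∑-swap (x ∷ xs) ys f = trans (cong (∑ ys (f x) +_) (∑-swap xs ys f)) (sym (∑-+ ys (f x) _))

⟦_⟧ : {P : Set} → Dec P → ℕ
⟦ yes _ ⟧ = 1
⟦ no _  ⟧ = 0

⟦⟧-mono : ∀ {P Q : Set} (p : Dec P) (q : Dec Q) → (P → Q) → ⟦ p ⟧ ≤ ⟦ q ⟧
⟦⟧-mono (yes p) (yes q) h = ≤-refl
⟦⟧-mono (yes p) (no ¬q) h = contradiction (h p) ¬q
⟦⟧-mono (no _)  q       h = z≤n

⟦⟧-cong : ∀ {P Q : Set} (p : Dec P) (q : Dec Q) → (P → Q) → (Q → P) → ⟦ p ⟧ ≡ ⟦ q ⟧
⟦⟧-cong p q f g = ≤-antisym (⟦⟧-mono p q f) (⟦⟧-mono q p g)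

module _ {P : Set} where

  ⟦⟧-yes : (p : Dec P) → P → ⟦ p ⟧ ≡ 1
  ⟦⟧-yes (yes _) p = refl
  ⟦⟧-yes (no ¬p) p = contradiction p ¬p

  ⟦⟧-no : (p : Dec P) → ¬ P → ⟦ p ⟧ ≡ 0
  ⟦⟧-no (yes p) ¬p = contradiction p ¬p
  ⟦⟧-no (no _)  ¬p = refl

  ⟦⟧≤1 : (p : Dec P) → ⟦ p ⟧ ≤ 1
  ⟦⟧≤1 (yes _) = ≤-refl
  ⟦⟧≤1 (no _)  = z≤n

module _ {A : Set} {P : A → Set} (P? : ∀ x → Dec (P x)) where

  length-filter≡∑ : ∀ xs → length (filter P? xs) ≡ ∑ xs (λ x → ⟦ P? x ⟧)
  length-filter≡∑ []       = refl
  length-filter≡∑ (x ∷ xs) with P? x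
  ... | yes _ = cong suc (length-filter≡∑ xs)
  ... | no _  = length-filter≡∑ xs

  ∑-filter : ∀ xs f → ∑ (filter P? xs) f ≡ ∑ xs (λ x → ⟦ P? x ⟧ * f x)
  ∑-filter []       f = refl
  ∑-filter (x ∷ xs) f with P? x
  ... | yes _ = cong₂ _+_ (sym (+-identityʳ (f x))) (∑-filter xs f)
  ... | no _  = ∑-filter xs f

module _ {A : Set} where

  ∑-unique-⊆ : ∀ {xs ys : List A} f → Unique xs → xs ⊆ ys → ∑ xs f ≤ ∑ ys f
  ∑-unique-⊆ {[]}     f _         _  = z≤n
  ∑-unique-⊆ {x ∷ xs} f (x∉ ∷ ux) xs⊆ with ∈-∃++ (xs⊆ (here refl))
  ... | as , bs , refl = begin
      f x + ∑ xs f              ≤⟨ +-monoʳ-≤ (f x) (∑-unique-⊆ f ux sub) ⟩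
      f x + ∑ (as ++ bs) f      ≡⟨ cong (f x +_) (∑-++ as bs f) ⟩
      f x + (∑ as f + ∑ bs f)   ≡⟨ +-assoc (f x) _ _ ⟨
      f x + ∑ as f + ∑ bs f     ≡⟨ cong (_+ ∑ bs f) (+-comm (f x) _) ⟩
      ∑ as f + f x + ∑ bs f     ≡⟨ +-assoc (∑ as f) (f x) (∑ bs f) ⟩
      ∑ as f + (f x + ∑ bs f)   ≡⟨ ∑-++ as (x ∷ bs) f ⟨
      ∑ (as ++ x ∷ bs) f        ∎
    where
    open ≤-Reasoning
    sub : xs ⊆ as ++ bs
    sub y∈ with ∈-++⁻ as (xs⊆ (there y∈))
    ... | inj₁ y∈as         = ∈-++⁺ˡ y∈as
    ... | inj₂ (here refl)  = contradiction y∈ (All.All¬⇒¬Any x∉)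
    ... | inj₂ (there y∈bs) = ∈-++⁺ʳ as y∈bs

  module _ (_≟A_ : DecidableEquality A) where

    ∑-≟ : ∀ {xs a} → Unique xs → a ∈ xs → ∑ xs (λ x → ⟦ x ≟A a ⟧) ≡ 1
    ∑-≟ {x ∷ xs} {a} (x∉ ∷ ux) (here refl) = cong₂ _+_ (⟦⟧-yes (x ≟A x) refl)
      (∑-zero xs λ {y} y∈ → ⟦⟧-no (y ≟A x) λ { refl → All.All¬⇒¬Any x∉ y∈ })
    ∑-≟ {x ∷ xs} {a} (x∉ ∷ ux) (there a∈) = cong₂ _+_
      (⟦⟧-no (x ≟A a) λ { refl → All.All¬⇒¬Any x∉ a∈ }) (∑-≟ ux a∈)

  length-map-⊆ : ∀ {B : Set} {xs : List A} {ys : List B} (f : A → B) → Unique xs →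
                 (∀ {x y} → x ∈ xs → y ∈ xs → f x ≡ f y → x ≡ y) →
                 (∀ {x} → x ∈ xs → f x ∈ ys) → length xs ≤ length ys
  length-map-⊆ {xs = []}              f _         inj into = z≤n
  length-map-⊆ {xs = x ∷ xs} {ys = ys} f (x∉ ∷ ux) inj into with ∈-∃++ (into (here refl))
  ... | as , bs , eq = begin
      suc (length xs)              ≤⟨ s≤s (length-map-⊆ f ux (λ p q → inj (there p) (there q)) into′) ⟩
      suc (length (as ++ bs))      ≡⟨ cong suc (length-++ as) ⟩
      suc (length as + length bs)  ≡⟨ +-suc (length as) (length bs) ⟨
      length as + suc (length bs)  ≡⟨ length-++ as ⟨
      length (as ++ f x ∷ bs)      ≡⟨ cong length eq ⟨
      length ys                    ∎
    where
    open ≤-Reasoning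
    into′ : ∀ {y} → y ∈ xs → f y ∈ as ++ bs
    into′ y∈ with ∈-++⁻ as (subst (_ ∈_) eq (into (there y∈)))
    ... | inj₁ y∈as         = ∈-++⁺ˡ y∈as
    ... | inj₂ (here fy≡fx) =
      contradiction (subst (_∈ xs) (inj (there y∈) (here refl) fy≡fx) y∈) (All.All¬⇒¬Any x∉)
    ... | inj₂ (there y∈bs) = ∈-++⁺ʳ as y∈bs

  length-⊆ : ∀ {xs ys : List A} → Unique xs → xs ⊆ ys → length xs ≤ length ys
  length-⊆ u xs⊆ = length-map-⊆ id u (λ _ _ eq → eq) xs⊆

∣allFin∣ : ∀ n → length (allFin n) ≡ n
∣allFin∣ n = length-tabulate {n = n} id

-- Connected components

module _ {n : ℕ} where

  open DecMembership (_≟_ {n}) using (_∈?_)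

  relabel : Fin n → Fin n → Fin n → Fin n
  relabel a b x with x ≟F a
  ... | yes _ = b
  ... | no _  = x

  relabel-≡ : ∀ a b → relabel a b a ≡ b
  relabel-≡ a b with a ≟F a
  ... | yes _  = refl
  ... | no a≢a = contradiction refl a≢a

  relabel-≢ : ∀ {a b x} → x ≢ a → relabel a b x ≡ x
  relabel-≢ {a} {b} {x} x≢a with x ≟F a
  ... | yes x≡a = contradiction x≡a x≢a
  ... | no _    = refl

  relabel-target : ∀ a b → relabel a b b ≡ b
  relabel-target a b with b ≟F a
  ... | yes _ = refl
  ... | no _  = refl

  relabel-id : ∀ a x → relabel a a x ≡ x
  relabel-id a x with x ≟F a
  ... | yes x≡a = sym x≡a
  ... | no _    = refl

  relabel-idem : ∀ a b x → relabel a b (relabel a b x) ≡ relabel a b x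
  relabel-idem a b x with x ≟F a
  ... | yes _  = relabel-target a b
  ... | no x≢a = relabel-≢ x≢a

  -- The representative of the connected component of a vertex in (Fin n, D).
  comp : EdgeSet n → Fin n → Fin n
  comp []      v = v
  comp (e ∷ D) v = relabel (comp D (end₁ e)) (comp D (end₂ e)) (comp D v)

  Conn : EdgeSet n → Edge n → Set
  Conn D e = comp D (end₁ e) ≡ comp D (end₂ e)

  conn? : ∀ D e → Dec (Conn D e)
  conn? D e = comp D (end₁ e) ≟F comp D (end₂ e)

  ∈⇒Conn : ∀ {D e} → e ∈ D → Conn D e
  ∈⇒Conn {f ∷ D} (here refl) = trans (relabel-≡ (comp D (end₁ f)) _) (sym (relabel-target _ (comp D (end₂ f))))
  ∈⇒Conn {f ∷ D} (there e∈)  = cong (relabel _ _) (∈⇒Conn {D} e∈)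

  Joins⇒comp≡ : ∀ D {e u v} → Conn D e → Joins e u v → comp D u ≡ comp D v
  Joins⇒comp≡ D e~ (inj₁ (refl , refl)) = e~
  Joins⇒comp≡ D e~ (inj₂ (refl , refl)) = sym e~

  walk⇒comp≡ : ∀ {D u v} → Walk D u v → comp D u ≡ comp D v
  walk⇒comp≡ []             = refl
  walk⇒comp≡ {D} (step e e∈ j p) = trans (Joins⇒comp≡ D {e} (∈⇒Conn e∈) j) (walk⇒comp≡ p)

  infixr 5 _+++_

  _+++_ : ∀ {D : EdgeSet n} {u v w} → Walk D u v → Walk D v w → Walk D u w
  []             +++ q = q
  step e e∈ j p +++ q = step e e∈ j (p +++ q)

  mapʷ : ∀ {D D′ : EdgeSet n} {u v} → D ⊆ D′ → Walk D u v → Walk D′ u v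
  mapʷ h []              = []
  mapʷ h (step e e∈ j p) = step e (h e∈) j (mapʷ h p)

  comp≡⇒walk : ∀ D {u v} → comp D u ≡ comp D v → Walk D u v
  comp≡⇒walk []      refl = []
  comp≡⇒walk (e ∷ D) {u} {v} eq
    with comp D u ≟F comp D (end₁ e) | comp D v ≟F comp D (end₁ e)
  ... | yes p | yes q = mapʷ there (comp≡⇒walk D (trans p (sym q)))
  ... | yes p | no  q = mapʷ there (comp≡⇒walk D p) +++
                        step e (here refl) (inj₁ (refl , refl)) (mapʷ there (comp≡⇒walk D eq))
  ... | no  p | yes q = mapʷ there (comp≡⇒walk D eq) +++
                        step e (here refl) (inj₂ (refl , refl)) (mapʷ there (comp≡⇒walk D (sym q)))
  ... | no  p | no  q = mapʷ there (comp≡⇒walk D eq)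

  comp≡-⊆ : ∀ {D D′ u v} → D ⊆ D′ → comp D u ≡ comp D v → comp D′ u ≡ comp D′ v
  comp≡-⊆ {D} D⊆ eq = walk⇒comp≡ (mapʷ D⊆ (comp≡⇒walk D eq))

  comp≡-Conn : ∀ {D D′ u v} → (∀ {e} → e ∈ D → Conn D′ e) → comp D u ≡ comp D v → comp D′ u ≡ comp D′ v
  comp≡-Conn {D} {D′} h eq = go (comp≡⇒walk D eq)
    where
    go : ∀ {u v} → Walk D u v → comp D′ u ≡ comp D′ v
    go []              = refl
    go (step e e∈ j p) = trans (Joins⇒comp≡ D′ {e} (h e∈) j) (go p)

  comp-idem : ∀ D v → comp D (comp D v) ≡ comp D v
  comp-idem []      v = refl
  comp-idem (e ∷ D) v = trans (cong (relabel a b) (fixed (comp D v) (comp-idem D v)))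
      (relabel-idem a b (comp D v))
    where
    a = comp D (end₁ e)
    b = comp D (end₂ e)
    fixed : ∀ x → comp D x ≡ x → comp D (relabel a b x) ≡ relabel a b x
    fixed x eq with x ≟F a
    ... | yes _ = comp-idem D (end₂ e)
    ... | no _  = eq

  IsRoot : EdgeSet n → Fin n → Set
  IsRoot D x = comp D x ≡ x

  root? : ∀ D x → Dec (IsRoot D x)
  root? D x = comp D x ≟F x

  roots : EdgeSet n → List (Fin n)
  roots D = filter (root? D) (allFin n)

  -- The number of connected components.
  κ : EdgeSet n → ℕ
  κ D = length (roots D)

  roots-unique : ∀ D → Unique (roots D)
  roots-unique D = Unique.filter⁺ (root? D) (Unique.allFin⁺ n)

  comp∈roots : ∀ D v → comp D v ∈ roots D
  comp∈roots D v = ∈-filter⁺ (root? D) (∈-allFin _) (comp-idem D v)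

  κ≡∑ : ∀ D → κ D ≡ ∑ (allFin n) (λ x → ⟦ root? D x ⟧)
  κ≡∑ D = length-filter≡∑ (root? D) (allFin n)

  κ-[] : κ [] ≡ n
  κ-[] = trans (cong length (filter-all (root? []) {allFin n} (All.tabulate λ _ → refl))) (∣allFin∣ n)

  κ-conn : ∀ {D e} → Conn D e → κ (e ∷ D) ≡ κ D
  κ-conn {D} {e} e~ = trans (κ≡∑ (e ∷ D)) (trans (∑-cong (allFin n) λ {x} _ →
      ⟦⟧-cong (root? (e ∷ D) x) (root? D x) (trans (sym (same x))) (trans (same x))) (sym (κ≡∑ D)))
    where
    same : ∀ x → comp (e ∷ D) x ≡ comp D x
    same x = trans (cong (λ b → relabel (comp D (end₁ e)) b (comp D x)) (sym e~)) (relabel-id _ _)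

  -- `relabel` sends the root `a` of the first end to the other root, so `a` is the only root lost,
  -- and none is gained.
  κ-¬conn : ∀ {D e} → ¬ Conn D e → κ D ≡ suc (κ (e ∷ D))
  κ-¬conn {D} {e} e≁ = begin
      κ D                                                    ≡⟨ κ≡∑ D ⟩
      ∑ (allFin n) (λ x → ⟦ root? D x ⟧)                     ≡⟨ ∑-cong (allFin n) (λ {x} _ → count x) ⟩
      ∑ (allFin n) (λ x → ⟦ x ≟F a ⟧ + ⟦ root? (e ∷ D) x ⟧)  ≡⟨ ∑-+ (allFin n) _ _ ⟩
      ∑ (allFin n) (λ x → ⟦ x ≟F a ⟧) + ∑ (allFin n) (λ x → ⟦ root? (e ∷ D) x ⟧)
        ≡⟨ cong₂ _+_ (∑-≟ _≟F_ (Unique.allFin⁺ n) (∈-allFin a)) (sym (κ≡∑ (e ∷ D))) ⟩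
      suc (κ (e ∷ D))                                        ∎
    where
    open ≡-Reasoning
    a = comp D (end₁ e)
    b = comp D (end₂ e)
    root-step : ∀ {x} → IsRoot D x → x ≢ a → IsRoot (e ∷ D) x
    root-step r x≢a = trans (cong (relabel a b) r) (relabel-≢ x≢a)
    root-back : ∀ {x} → IsRoot (e ∷ D) x → IsRoot D x
    root-back {x} r with comp D x ≟F a
    ... | yes p = trans (cong (comp D) (sym r)) (trans (comp-idem D (end₂ e)) r)
    ... | no  p = r
    ¬root-a : ¬ IsRoot (e ∷ D) a
    ¬root-a r = e≁ (trans (sym r) (trans (cong (relabel a b) (comp-idem D (end₁ e))) (relabel-≡ a b)))
    count : ∀ x → ⟦ root? D x ⟧ ≡ ⟦ x ≟F a ⟧ + ⟦ root? (e ∷ D) x ⟧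
    count x with x ≟F a
    ... | yes refl = trans (⟦⟧-yes (root? D x) (comp-idem D (end₁ e)))
                           (cong suc (sym (⟦⟧-no (root? (e ∷ D) x) ¬root-a)))
    ... | no x≢a   = ⟦⟧-cong (root? D x) (root? (e ∷ D) x) (λ r → root-step r x≢a) root-back

  κ-∷-≥ : ∀ e D → κ D ≤ suc (κ (e ∷ D))
  κ-∷-≥ e D with conn? D e
  ... | yes e~ = ≤-trans (≤-reflexive (sym (κ-conn {D} {e} e~))) (n≤1+n _)
  ... | no  e≁ = ≤-reflexive (κ-¬conn {D} {e} e≁)

  -- Distinct roots of `D′` lie in different components of `D′`, hence of `D`, so `comp D` is
  -- injective on them.
  κ-antitone-Conn : ∀ {D D′} → (∀ {e} → e ∈ D → Conn D′ e) → κ D′ ≤ κ D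
  κ-antitone-Conn {D} {D′} h = length-map-⊆ (comp D) (roots-unique D′)
      (λ x∈ y∈ eq → trans (sym (root x∈)) (trans (comp≡-Conn {D} {D′} h eq) (root y∈))) (λ _ → comp∈roots D _)
    where
    root : ∀ {x} → x ∈ roots D′ → comp D′ x ≡ x
    root x∈ = proj₂ (∈-filter⁻ (root? D′) {xs = allFin n} x∈)

  κ-antitone : ∀ {D D′} → D ⊆ D′ → κ D′ ≤ κ D
  κ-antitone {D} {D′} D⊆ = κ-antitone-Conn {D} {D′} (λ e∈ → ∈⇒Conn (D⊆ e∈))

  κ-cong : ∀ {D D′} → D ⊆ D′ → D′ ⊆ D → κ D ≡ κ D′
  κ-cong {D} {D′} p q = ≤-antisym (κ-antitone {D′} {D} q) (κ-antitone {D} {D′} p)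

  n≤κ+length : ∀ D → n ≤ κ D + length D
  n≤κ+length []      = ≤-reflexive (sym (trans (+-identityʳ _) κ-[]))
  n≤κ+length (e ∷ D) = begin
    n                          ≤⟨ n≤κ+length D ⟩
    κ D + length D             ≤⟨ +-monoˡ-≤ (length D) (κ-∷-≥ e D) ⟩
    suc (κ (e ∷ D)) + length D ≡⟨ +-suc _ _ ⟨
    κ (e ∷ D) + suc (length D) ∎
    where open ≤-Reasoning

  κ-++-≥ : ∀ Z D → κ D ≤ length Z + κ (Z ++ D)
  κ-++-≥ []      D = ≤-refl
  κ-++-≥ (e ∷ Z) D = ≤-trans (κ-++-≥ Z D)
      (≤-trans (+-monoʳ-≤ (length Z) (κ-∷-≥ e (Z ++ D))) (≤-reflexive (+-suc _ _)))

  κ≤n : ∀ D → κ D ≤ n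
  κ≤n D = ≤-trans (κ-antitone {[]} {D} λ ()) (≤-reflexive κ-[])

  -- Submodularity of the rank `n - κ` of the graphic matroid, as diminishing returns: an edge that
  -- joins two components of the larger graph also joins two components of the smaller one.
  κ-diminishing : ∀ Z {X Y} → X ⊆ Y → κ Y + κ (Z ++ X) ≤ κ X + κ (Z ++ Y)
  κ-diminishing []      {X} {Y} X⊆Y = ≤-reflexive (+-comm (κ Y) (κ X))
  κ-diminishing (z ∷ Z) {X} {Y} X⊆Y with conn? (Z ++ X) z
  ... | yes z~ rewrite κ-conn {Z ++ X} {z} z~
                     | κ-conn {Z ++ Y} {z} (comp≡-⊆ {Z ++ X} {Z ++ Y} (⊆.++⁺ʳ Z X⊆Y) z~) = κ-diminishing Z X⊆Y
  ... | no z≁ = s≤s⁻¹ (begin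
    suc (κ Y + κ (z ∷ Z ++ X))  ≡⟨ +-suc (κ Y) _ ⟨
    κ Y + suc (κ (z ∷ Z ++ X))  ≡⟨ cong (κ Y +_) (κ-¬conn {Z ++ X} {z} z≁) ⟨
    κ Y + κ (Z ++ X)            ≤⟨ κ-diminishing Z X⊆Y ⟩
    κ X + κ (Z ++ Y)            ≤⟨ +-monoʳ-≤ (κ X) (κ-∷-≥ z (Z ++ Y)) ⟩
    κ X + suc (κ (z ∷ Z ++ Y))  ≡⟨ +-suc (κ X) _ ⟩
    suc (κ X + κ (z ∷ Z ++ Y))  ∎)
    where open ≤-Reasoning

  -- Diminishing returns for adding `A` to the intersection of `A` and `B` and to `B`. The
  -- uncrossing of tight partitions rests on this.
  κ-supermodular : ∀ A B → κ A + κ B ≤ κ (A ++ B) + κ (filter (_∈? B) A)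
  κ-supermodular A B = begin
    κ A + κ B         ≡⟨ +-comm (κ A) (κ B) ⟩
    κ B + κ A         ≡⟨ cong (κ B +_)
        (κ-cong {A} {A ++ I} ∈-++⁺ˡ
        (λ x∈ → case ∈-++⁻ A x∈ of λ { (inj₁ p) → p ; (inj₂ q) → proj₁ (∈-filter⁻ (_∈? B) q) })) ⟩
    κ B + κ (A ++ I)  ≤⟨ κ-diminishing A {I} {B} (λ x∈ → proj₂ (∈-filter⁻ (_∈? B) {xs = A} x∈)) ⟩
    κ I + κ (A ++ B)  ≡⟨ +-comm (κ I) _ ⟩
    κ (A ++ B) + κ I  ∎
    where
    open ≤-Reasoning
    I = filter (_∈? B) A

  -- Not `≡ 1`, since there is no component when `n` is 0.
  connected⇒κ≤1 : ∀ {D} → Connected D → κ D ≤ 1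
  connected⇒κ≤1 {D} con with roots D in eq | roots-unique D
  ... | []         | _ = z≤n
  ... | x ∷ []     | _ = ≤-refl
  ... | x ∷ y ∷ zs | (x≢y ∷ _) ∷ _ = contradiction
      (trans (sym (root (here refl))) (trans (walk⇒comp≡ (con x y)) (root (there (here refl))))) x≢y
    where
    root : ∀ {z} → z ∈ x ∷ y ∷ zs → comp D z ≡ z
    root z∈ = proj₂ (∈-filter⁻ (root? D) {xs = allFin n} (subst (_ ∈_) (sym eq) z∈))

  κ≤1⇒comp≡ : ∀ {D} → κ D ≤ 1 → ∀ u v → comp D u ≡ comp D v
  κ≤1⇒comp≡ {D} κ≤1 u v with roots D in eq | κ≤1
  ... | []     | _ = contradiction (subst (comp D u ∈_) eq (comp∈roots D u)) λ ()
  ... | x ∷ [] | _ = trans (only (comp∈roots D u)) (sym (only (comp∈roots D v)))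
    where
    only : ∀ {z} → z ∈ roots D → z ≡ x
    only z∈ with subst (_ ∈_) eq z∈
    ... | here p = p
  ... | x ∷ y ∷ zs | s≤s ()

  κ≤1⇒connected : ∀ {D} → κ D ≤ 1 → Connected D
  κ≤1⇒connected {D} κ≤1 u v = comp≡⇒walk D (κ≤1⇒comp≡ {D} κ≤1 u v)

  vertex⇒1≤κ : Fin n → ∀ D → 1 ≤ κ D
  vertex⇒1≤κ v D = ∈⇒1≤ (comp∈roots D v)
    where
    ∈⇒1≤ : ∀ {x : Fin n} {xs} → x ∈ xs → 1 ≤ length xs
    ∈⇒1≤ (here _)  = s≤s z≤n
    ∈⇒1≤ (there _) = s≤s z≤n

  connected⇒κ-same : ∀ {D D′} → Connected D → Connected D′ → κ D ≡ κ D′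
  connected⇒κ-same {D} {D′} p q = ≤-antisym
    (κ-antitone-Conn {D′} {D} λ _ → walk⇒comp≡ (p _ _)) (κ-antitone-Conn {D} {D′} λ _ → walk⇒comp≡ (q _ _))

-- Spanning trees and the exchange property

<ℚ⇒≱ℚ : ∀ {p q} → p <ℚ q → ¬ (q ≤ℚ p)
<ℚ⇒≱ℚ p<q q≤p = ℚ.<-irrefl refl (ℚ.<-≤-trans p<q q≤p)

module _ {n : ℕ} where

  open DecMembership (_≟_ {n}) using (_∈?_; _∉?_)

  infixl 6 _-_

  _-_ : EdgeSet n → Edge n → EdgeSet n
  D - e = D ∖ (e ∷ [])

  ∈-∖⁻ : ∀ {D S : EdgeSet n} {x} → x ∈ D ∖ S → x ∈ D × x ∉ S
  ∈-∖⁻ {D} {S} = ∈-filter⁻ (_∉? S) {xs = D}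

  ∈-∖⁺ : ∀ {D S : EdgeSet n} {x} → x ∈ D → x ∉ S → x ∈ D ∖ S
  ∈-∖⁺ {D} {S} = ∈-filter⁺ (_∉? S)

  ∈--⁻ : ∀ {D : EdgeSet n} {e x} → x ∈ D - e → x ∈ D × x ≢ e
  ∈--⁻ x∈ with ∈-∖⁻ x∈
  ... | x∈D , x∉ = x∈D , λ { refl → x∉ (here refl) }

  ∈--⁺ : ∀ {D : EdgeSet n} {e x} → x ∈ D → x ≢ e → x ∈ D - e
  ∈--⁺ x∈ x≢e = ∈-∖⁺ x∈ λ { (here x≡e) → x≢e x≡e }

  e∉D-e : ∀ {D : EdgeSet n} {e} → e ∉ D - e
  e∉D-e {D} e∈ = proj₂ (∈--⁻ {D} e∈) refl

  -‿unique : ∀ {D : EdgeSet n} e → Unique D → Unique (D - e)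
  -‿unique e = Unique.filter⁺ (_∉? (e ∷ []))

  ∉⇒- : ∀ {D : EdgeSet n} {e} → e ∉ D → D - e ≡ D
  ∉⇒- {D} {e} e∉ = filter-all (_∉? (e ∷ [])) (All.tabulate λ { x∈ (here refl) → e∉ x∈ })

  ↭-∷- : ∀ {D : EdgeSet n} {e} → Unique D → e ∈ D → D ↭ e ∷ (D - e)
  ↭-∷- {x ∷ D} {e} (x∉ ∷ u) (here refl) = ↭-reflexive (cong (x ∷_) (sym (trans
    (filter-reject (_∉? (e ∷ [])) (λ e∉ → e∉ (here refl))) (∉⇒- (All.All¬⇒¬Any x∉)))))
  ↭-∷- {x ∷ D} {e} (x∉ ∷ u) (there e∈) = ↭-trans (prep x (↭-∷- u e∈)) (↭-trans (swap x e ↭-refl)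
    (↭-reflexive (cong (e ∷_) (sym (filter-accept (_∉? (e ∷ [])) λ { (here refl) → All.All¬⇒¬Any x∉ e∈ })))))

  length-- : ∀ {D : EdgeSet n} {e} → Unique D → e ∈ D → length D ≡ suc (length (D - e))
  length-- u e∈ = ↭-length (↭-∷- u e∈)

  totalWeight-↭ : ∀ (w : Edge n → ℚ) {S T} → S ↭ T → totalWeight w S ≡ totalWeight w T
  totalWeight-↭ w _↭_.refl         = refl
  totalWeight-↭ w (prep x p)   = cong (w x +ℚ_) (totalWeight-↭ w p)
  totalWeight-↭ w (swap {xs} {ys} x y p) = trans (cong (λ s → w x +ℚ (w y +ℚ s)) (totalWeight-↭ w p))
    (trans (sym (ℚ.+-assoc (w x) (w y) _))
        (trans (cong (_+ℚ totalWeight w ys) (ℚ.+-comm (w x) (w y))) (ℚ.+-assoc (w y) (w x) _)))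
  totalWeight-↭ w (_↭_.trans p q) = trans (totalWeight-↭ w p) (totalWeight-↭ w q)

  -- Unlike `verticesOf` it lists the last vertex too, so that `Unique` excludes an earlier visit to
  -- it.
  path : ∀ {D : EdgeSet n} {u v} → Walk D u v → List (Fin n)
  path ([] {u})           = u ∷ []
  path (step {u} _ _ _ p) = u ∷ path p

  verticesOf⊆path : ∀ {D : EdgeSet n} {u v} (p : Walk D u v) → verticesOf p ⊆ path p
  verticesOf⊆path (step _ _ _ p) = ⊆.∷⁺ʳ _ (verticesOf⊆path p)

  start∈path : ∀ {D : EdgeSet n} {u v} (p : Walk D u v) → u ∈ path p
  start∈path []             = here refl
  start∈path (step _ _ _ p) = here refl

  end∈path : ∀ {D : EdgeSet n} {u v} (p : Walk D u v) → v ∈ path p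
  end∈path []             = here refl
  end∈path (step _ _ _ p) = there (end∈path p)

  closing-unique : ∀ {D : EdgeSet n} {u v} (p : Walk D u v) → Unique (path p) → Unique (v ∷ verticesOf p)
  closing-unique []             _        = [] ∷ []
  closing-unique (step {u} e e∈ j p) (u∉ ∷ up) with closing-unique p up
  ... | v∉ ∷ uv = ((λ { refl → All.All¬⇒¬Any u∉ (end∈path p) }) ∷ v∉)
                ∷ All.anti-mono (verticesOf⊆path p) u∉ ∷ uv

  ends∈path : ∀ {D : EdgeSet n} {u v} (p : Walk D u v) {e} → e ∈ edgesOf p → end₁ e ∈ path p × end₂ e ∈ path p
  ends∈path (step e e∈ (inj₁ (refl , refl)) p) (here refl) = here refl , there (start∈path p)
  ends∈path (step e e∈ (inj₂ (refl , refl)) p) (here refl) = there (start∈path p) , here refl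
  ends∈path (step _ _ _ p) (there e∈) with ends∈path p e∈
  ... | a , b = there a , there b

  path-unique⇒edgesOf-unique : ∀ {D : EdgeSet n} {u v} (p : Walk D u v) → Unique (path p) → Unique (edgesOf p)
  path-unique⇒edgesOf-unique []             _ = []
  path-unique⇒edgesOf-unique (step e e∈ j p) (u∉ ∷ up) =
    All.¬Any⇒All¬ _ (λ e∈p → All.All¬⇒¬Any u∉ (u∈path j (ends∈path p e∈p))) ∷ path-unique⇒edgesOf-unique p up
    where
    u∈path : ∀ {u v} → Joins e u v → end₁ e ∈ path p × end₂ e ∈ path p → u ∈ path p
    u∈path (inj₁ (refl , _)) = proj₁
    u∈path (inj₂ (_ , refl)) = proj₂

  suffix : ∀ {D : EdgeSet n} {u v w} (p : Walk D v w) → Unique (path p) → u ∈ path p →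
           Σ[ q ∈ Walk D u w ] Unique (path q)
  suffix []               up       (here refl) = [] , up
  suffix p@(step _ _ _ _) up       (here refl) = p , up
  suffix (step _ _ _ p)   (_ ∷ up) (there u∈)  = suffix p up u∈

  toPath : ∀ {D : EdgeSet n} {u v} → Walk D u v → Σ[ q ∈ Walk D u v ] Unique (path q)
  toPath []                  = [] , [] ∷ []
  toPath (step {u} e e∈ j p) with toPath p
  ... | q , uq with DecMembership._∈?_ _≟F_ u (path q)
  ...   | yes u∈ = suffix q uq u∈
  ...   | no  u∉ = step e e∈ j q , All.¬Any⇒All¬ _ u∉ ∷ uq

  edgesOf⊆ : ∀ {D : EdgeSet n} {u v} (p : Walk D u v) → edgesOf p ⊆ D
  edgesOf⊆ (step e e∈ _ p) (here refl) = e∈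
  edgesOf⊆ (step _ _ _ p) (there x∈) = edgesOf⊆ p x∈

  edgesOf-mapʷ : ∀ {D D′ : EdgeSet n} {u v} (h : D ⊆ D′) (p : Walk D u v) → edgesOf (mapʷ h p) ≡ edgesOf p
  edgesOf-mapʷ h []              = refl
  edgesOf-mapʷ h (step e _ _ p)  = cong (e ∷_) (edgesOf-mapʷ h p)

  verticesOf-mapʷ : ∀ {D D′ : EdgeSet n} {u v} (h : D ⊆ D′) (p : Walk D u v) → verticesOf
      (mapʷ h p) ≡ verticesOf p
  verticesOf-mapʷ h []                 = refl
  verticesOf-mapʷ h (step {u} _ _ _ p) = cong (u ∷_) (verticesOf-mapʷ h p)

  restrict : ∀ {D D′ : EdgeSet n} {u v} (p : Walk D u v) → edgesOf p ⊆ D′ → Walk D′ u v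
  restrict []             h = []
  restrict (step e _ j p) h = step e (h (here refl)) j (restrict p (h ∘ there))

  Acyclic-⊆ : ∀ {D D′ : EdgeSet n} → D ⊆ D′ → Acyclic D′ → Acyclic D
  Acyclic-⊆ h ac p (ne , ue , uv) = ac (mapʷ h p)
    ( (λ eq → ne (trans (sym (edgesOf-mapʷ h p)) eq))
    , subst Unique (sym (edgesOf-mapʷ h p)) ue
    , subst Unique (sym (verticesOf-mapʷ h p)) uv)

  -- A simple path in `D` between the ends of `e` closes up with `e` to a cycle; `e ∉ D` keeps the
  -- edges distinct.
  acyclic-∷⇒¬Conn : ∀ {D : EdgeSet n} {e} → e ∉ D → Acyclic (e ∷ D) → ¬ Conn D e
  acyclic-∷⇒¬Conn {D} {e} e∉ ac e~ with toPath (comp≡⇒walk D (sym e~))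
  ... | q , uq = ac (step e (here refl) (inj₁ (refl , refl)) (mapʷ there q))
    ( (λ ())
    , subst (Unique ∘ (e ∷_)) (sym (edgesOf-mapʷ there q))
        (All.¬Any⇒All¬ _ (e∉ ∘ edgesOf⊆ q) ∷ path-unique⇒edgesOf-unique q uq)
    , subst (Unique ∘ (end₁ e ∷_)) (sym (verticesOf-mapʷ there q)) (closing-unique q uq))

  acyclic⇒κ+length : ∀ {D : EdgeSet n} → Unique D → Acyclic D → κ D + length D ≡ n
  acyclic⇒κ+length {[]}    _        _  = trans (+-identityʳ _) κ-[]
  acyclic⇒κ+length {e ∷ D} (e∉ ∷ u) ac = begin
    κ (e ∷ D) + suc (length D)  ≡⟨ +-suc _ _ ⟩
    suc (κ (e ∷ D)) + length D
        ≡⟨ cong (_+ length D) (κ-¬conn {D = D} {e} (acyclic-∷⇒¬Conn (All.All¬⇒¬Any e∉) ac)) ⟨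
    κ D + length D              ≡⟨ acyclic⇒κ+length u (Acyclic-⊆ there ac) ⟩
    n                           ∎
    where open ≡-Reasoning

  κ-∷- : ∀ {D : EdgeSet n} {e} → e ∈ D → κ (e ∷ (D - e)) ≡ κ D
  κ-∷- {D} {e} e∈ = κ-cong {D = e ∷ (D - e)} {D} (λ { (here refl) → e∈ ; (there x∈) → proj₁ (∈--⁻ x∈) }) from
    where
    from : D ⊆ e ∷ (D - e)
    from {x} x∈ with x ≟ e
    ... | yes refl = here refl
    ... | no x≢e   = there (∈--⁺ x∈ x≢e)

  -- Otherwise `D - e` would have as many components as `D` and one edge less, which `n≤κ+length`
  -- forbids.
  forest⇒¬Conn : ∀ {D : EdgeSet n} {e} → Unique D → κ D + length D ≤ n → e ∈ D → ¬ Conn (D - e) e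
  forest⇒¬Conn {D} {e} u le e∈ e~ = <-irrefl refl (begin-strict
    n                                     ≤⟨ n≤κ+length (D - e) ⟩
    κ (D - e) + length (D - e)
        ≡⟨ cong (_+ length (D - e)) (trans (sym (κ-conn {D = D - e} {e} e~)) (κ-∷- e∈)) ⟩
    κ D + length (D - e)                  <⟨ +-monoʳ-< (κ D) (≤-reflexive (sym (length-- u e∈))) ⟩
    κ D + length D                        ≤⟨ le ⟩
    n                                     ∎)
    where open ≤-Reasoning

  -- Converse of `acyclic⇒κ+length`: being a forest becomes a matter of counting, so that exchanging
  -- edges needs no surgery on cycles.
  forest⇒acyclic : ∀ {D : EdgeSet n} → Unique D → κ D + length D ≤ n → Acyclic D
  forest⇒acyclic u le []              (ne , _) = ne refl
  forest⇒acyclic {D₀} u le (step e e∈ j p) (_ , e∉ ∷ _ , _) =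
    forest⇒¬Conn u le e∈
        (Joins⇒Conn (D₀ - e) j
        (walk⇒comp≡ (restrict p λ x∈ → ∈--⁺ (edgesOf⊆ p x∈) λ { refl → All.All¬⇒¬Any e∉ x∈ })))
    where
    Joins⇒Conn : ∀ D {u v} → Joins e u v → comp D v ≡ comp D u → Conn D e
    Joins⇒Conn D (inj₁ (refl , refl)) eq = sym eq
    Joins⇒Conn D (inj₂ (refl , refl)) eq = eq

  module _ {H T : EdgeSet n} (tree : IsSpanningTree H T) where

    open IsSpanningTree tree

    spanningTree-size : κ T + length T ≡ n
    spanningTree-size = acyclic⇒κ+length unique acyclic

    swapped : ∀ {f g} → f ∈ H → g ∈ T → f ∉ T - g → Connected (f ∷ (T - g)) → IsSpanningTree H (f ∷ (T - g))
    swapped {f} {g} f∈H g∈T f∉ con = record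
      { unique    = uniq
      ; subgraph  = λ { (here refl) → f∈H ; (there x∈) → subgraph (proj₁ (∈--⁻ x∈)) }
      ; connected = con
      ; acyclic   = forest⇒acyclic uniq (≤-reflexive (trans (cong₂ _+_
                      (connected⇒κ-same {D = f ∷ (T - g)} {T} con connected) (sym (length-- unique g∈T)))
                          spanningTree-size))
      }
      where
      uniq : Unique (f ∷ (T - g))
      uniq = All.¬Any⇒All¬ _ f∉ ∷ -‿unique g unique

  module _ {H T : EdgeSet n} {w : Edge n → ℚ} (mst : IsMST H w T) where

    open IsMST mst
    open IsSpanningTree spanningTree

    exchange : ∀ {f g} → f ∈ H → g ∈ T → f ∉ T - g → Connected (f ∷ (T - g)) → w g ≤ℚ w f
    exchange {f} {g} f∈H g∈T f∉ con = ℚ.≮⇒≥ λ wf<wg → <ℚ⇒≱ℚ (ℚ.+-monoˡ-< (totalWeight w (T - g)) wf<wg)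
      (subst (_≤ℚ totalWeight w (f ∷ (T - g))) (totalWeight-↭ w (↭-∷- unique g∈T))
         (minimal _ (swapped spanningTree f∈H g∈T f∉ con)))

    -- If lighter edges connected the ends of `f`, one of them would cross the cut that opens when
    -- `f` leaves `T`, and exchanging the two would make `T` lighter.
    mst-edge⇒¬Conn-lighter : ∀ {f} L → L ⊆ H → (∀ {g} → g ∈ L → w g <ℚ w f) → f ∈ T → ¬ Conn L f
    mst-edge⇒¬Conn-lighter {f} L L⊆H light f∈T f~ with All.all? (conn? (T - f)) L
    ... | yes all = forest⇒¬Conn unique (≤-reflexive (spanningTree-size spanningTree)) f∈T
                      (comp≡-Conn {D = L} {T - f} (All.lookup all) f~)
    ... | no ¬all with find (All.¬All⇒Any¬ (conn? (T - f)) L ¬all)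
    ...   | g , g∈L , g≁ = <ℚ⇒≱ℚ (light g∈L)
              (exchange (L⊆H g∈L) f∈T (λ g∈ → g≁ (∈⇒Conn g∈))
                  (κ≤1⇒connected {D = g ∷ (T - f)} (≤-trans (≤-reflexive same) (connected⇒κ≤1 connected))))
      where
      same : κ (g ∷ (T - f)) ≡ κ T
      same = suc-injective (trans (sym (κ-¬conn {D = T - f} {g} g≁))
               (trans (κ-¬conn {D = T - f} {f}
                   (forest⇒¬Conn unique (≤-reflexive (spanningTree-size spanningTree)) f∈T))
                      (cong suc (κ-∷- f∈T))))

    -- The path of `T` between the ends of `f` contains an edge not lighter than `f`; being
    -- exchangeable for `f` it is not heavier either, hence it is `f`. Together with
    -- `mst-edge⇒¬Conn-lighter` this determines the tree, so the output of any correct algorithm is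
    -- predictable.
    ¬Conn-lighter⇒mst-edge : ∀ {f} L → (∀ {g} → g ∈ H → w g <ℚ w f → g ∈ L) →
        (∀ {g} → g ∈ H → w g ≡ w f → g ≡ f) →
                             f ∈ H → ¬ Conn L f → f ∈ T
    ¬Conn-lighter⇒mst-edge {f} L light inj f∈H f≁ with f ∈? T
    ... | yes f∈T = f∈T
    ... | no  f∉T with toPath (connected (end₁ f) (end₂ f))
    ...   | p , up with All.all? (λ g → w g ℚ.<? w f) (edgesOf p)
    ...     | yes all = contradiction
        (walk⇒comp≡ (restrict p λ g∈ → light (subgraph (edgesOf⊆ p g∈)) (All.lookup all g∈))) f≁
    ...     | no ¬all with find (All.¬All⇒Any¬ (λ g → w g ℚ.<? w f) (edgesOf p) ¬all)
    ...       | g , g∈p , g≮f = contradiction (subst (_∈ T) (inj (subgraph g∈T) (ℚ.≤-antisym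
                  (exchange f∈H g∈T (f∉T ∘ proj₁ ∘ ∈--⁻ {T}) con) (ℚ.≮⇒≥ g≮f))) g∈T) f∉T
      where
      g∈T = edgesOf⊆ p g∈p
      D = f ∷ (T - g)
      -- Without `g` the path falls into two pieces that lie in `D`, and `f` joins their far ends;
      -- so the ends of `g` stay connected in `D`.
      bypass : ∀ {u v} (q : Walk T u v) → Unique (edgesOf q) → g ∈ edgesOf q → comp D u ≡ comp D v → Conn D g
      others : ∀ {u v} (q : Walk T u v) → g ∉ edgesOf q → comp D u ≡ comp D v
      others q g∉ = walk⇒comp≡
          (restrict q λ {x} x∈ → there {x = f} (∈--⁺ {T} {g} {x} (edgesOf⊆ q x∈) λ { refl → g∉ x∈ }))
      bypass (step e e∈ j q) (e∉ ∷ uq) (here refl) eq with j | trans eq (sym (others q (All.All¬⇒¬Any e∉)))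
      ... | inj₁ (refl , refl) | eq′ = eq′
      ... | inj₂ (refl , refl) | eq′ = sym eq′
      bypass (step e e∈ j q) (e∉ ∷ uq) (there g∈) eq = bypass q uq g∈
        (trans (sym (Joins⇒comp≡ D {e}
            (∈⇒Conn (there {x = f} (∈--⁺ {T} {g} {e} e∈ λ { refl → All.All¬⇒¬Any e∉ g∈ }))) j)) eq)
      g~ : Conn D g
      g~ = bypass p (path-unique⇒edgesOf-unique p up) g∈p (∈⇒Conn {D = D} (here refl))
      con : Connected D
      con u v = comp≡⇒walk D (comp≡-Conn {D = T} {D} edge~ (walk⇒comp≡ (connected u v)))
        where
        edge~ : ∀ {e} → e ∈ T → Conn D e
        edge~ {e} e∈ with e ≟ g
        ... | yes refl = g~
        ... | no e≢g   = ∈⇒Conn (there {x = f} (∈--⁺ {T} {g} {e} e∈ e≢g))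

-- Injective weights refining integral loads

fromℚᵘ-mono-≤ : ∀ {p q} → p ℚᵘ.≤ q → fromℚᵘ p ≤ℚ fromℚᵘ q
fromℚᵘ-mono-≤ {p} {q} p≤q = ℚ.toℚᵘ-cancel-≤
  (ℚᵘ.≤-respˡ-≃ (ℚᵘ.≃-sym (ℚ.toℚᵘ-fromℚᵘ p)) (ℚᵘ.≤-respʳ-≃ (ℚᵘ.≃-sym (ℚ.toℚᵘ-fromℚᵘ q)) p≤q))

fromℚᵘ-mono-< : ∀ {p q} → p ℚᵘ.< q → fromℚᵘ p <ℚ fromℚᵘ q
fromℚᵘ-mono-< {p} {q} p<q = ℚ.toℚᵘ-cancel-<
  (ℚᵘ.<-respˡ-≃ (ℚᵘ.≃-sym (ℚ.toℚᵘ-fromℚᵘ p)) (ℚᵘ.<-respʳ-≃ (ℚᵘ.≃-sym (ℚ.toℚᵘ-fromℚᵘ q)) p<q))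

fromℚᵘ-homo-+ : ∀ p q → fromℚᵘ p +ℚ fromℚᵘ q ≡ fromℚᵘ (p ℚᵘ.+ q)
fromℚᵘ-homo-+ p q = ℚ.toℚᵘ-injective (ℚᵘ.≃-trans (ℚ.toℚᵘ-homo-+ (fromℚᵘ p) (fromℚᵘ q))
  (ℚᵘ.≃-trans (ℚᵘ.+-cong (ℚ.toℚᵘ-fromℚᵘ p) (ℚ.toℚᵘ-fromℚᵘ q)) (ℚᵘ.≃-sym (ℚ.toℚᵘ-fromℚᵘ (p ℚᵘ.+ q)))))

fromℕ : ℕ → ℚ
fromℕ k = pos k /ℚ 1

fromℕ-mono-≤ : ∀ {k l} → k ≤ l → fromℕ k ≤ℚ fromℕ l
fromℕ-mono-≤ {k} {l} k≤l = fromℚᵘ-mono-≤ {mkℚᵘ (pos k) 0} {mkℚᵘ (pos l) 0}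
    (*≤* (ℤ.*-monoʳ-≤-nonNeg (pos 1) (+≤+ k≤l)))

fromℕ-cancel-< : ∀ {k l} → fromℕ k <ℚ fromℕ l → k < l
fromℕ-cancel-< {k} {l} p with k <? l
... | yes k<l = k<l
... | no  k≮l = contradiction (fromℕ-mono-≤ (≮⇒≥ k≮l)) (<ℚ⇒≱ℚ p)

fromℕ-homo-+ : ∀ k l → fromℕ k +ℚ fromℕ l ≡ fromℕ (k + l)
fromℕ-homo-+ k l = trans (fromℚᵘ-homo-+ (mkℚᵘ (pos k) 0) (mkℚᵘ (pos l) 0))
  (ℚ.fromℚᵘ-cong {mkℚᵘ (pos k) 0 ℚᵘ.+ mkℚᵘ (pos l) 0} {mkℚᵘ (pos (k + l)) 0}
    (*≡* (cong (ℤ._* pos 1)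
        (trans (cong₂ ℤ._+_ (ℤ.*-identityʳ (pos k)) (ℤ.*-identityʳ (pos l))) (sym (ℤ.pos-+ k l))))))

over : ℕ → ℕ → ℚ
over k d = pos k /ℚ suc d

over-+ : ∀ k l d → over k d +ℚ over l d ≡ over (k + l) d
over-+ k l d = trans (fromℚᵘ-homo-+ (mkℚᵘ (pos k) d) (mkℚᵘ (pos l) d))
  (ℚ.fromℚᵘ-cong {mkℚᵘ (pos k) d ℚᵘ.+ mkℚᵘ (pos l) d} {mkℚᵘ (pos (k + l)) d} (*≡* (begin
    (pos k ℤ.* pos (suc d) ℤ.+ pos l ℤ.* pos (suc d)) ℤ.* pos (suc d)
        ≡⟨ cong (ℤ._* pos (suc d)) (ℤ.*-distribʳ-+ (pos (suc d)) (pos k) (pos l)) ⟨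
    (pos k ℤ.+ pos l) ℤ.* pos (suc d) ℤ.* pos (suc d)
        ≡⟨ ℤ.*-assoc (pos k ℤ.+ pos l) (pos (suc d)) (pos (suc d)) ⟩
    (pos k ℤ.+ pos l) ℤ.* (pos (suc d) ℤ.* pos (suc d))
        ≡⟨ cong₂ ℤ._*_ (sym (ℤ.pos-+ k l)) (sym (ℤ.pos-* (suc d) (suc d))) ⟩
    pos (k + l) ℤ.* pos (suc d * suc d)                    ∎)))
  where open ≡-Reasoning

over-< : ∀ {k l d} → k < l → over k d <ℚ over l d
over-< {k} {l} {d} k<l = fromℚᵘ-mono-< {mkℚᵘ (pos k) d} {mkℚᵘ (pos l) d}
    (*<* (ℤ.*-monoʳ-<-pos (pos (suc d)) (+<+ k<l)))

over-antitone : ∀ {d d′} → d ≤ d′ → over 1 d′ ≤ℚ over 1 d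
over-antitone {d} {d′} d≤ = fromℚᵘ-mono-≤ {mkℚᵘ (pos 1) d′} {mkℚᵘ (pos 1) d}
    (*≤* (ℤ.*-monoˡ-≤-nonNeg (pos 1) (+≤+ (s≤s d≤))))

over-injective : ∀ {d d′} → over 1 d ≡ over 1 d′ → d ≡ d′
over-injective {d} {d′} eq with ℚ.fromℚᵘ-injective {mkℚᵘ (pos 1) d} {mkℚᵘ (pos 1) d′} eq
... | *≡* eq′ = suc-injective
    (ℤ.+-injective (trans (sym (ℤ.*-identityˡ (pos (suc d)))) (trans (sym eq′) (ℤ.*-identityˡ (pos (suc d′))))))

over-self : ∀ d → over (suc d) d ≡ fromℕ 1
over-self d = ℚ.fromℚᵘ-cong {mkℚᵘ (pos (suc d)) d} {mkℚᵘ (pos 1) 0} (*≡* (ℤ.*-comm (pos (suc d)) (pos 1)))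

over-zero : ∀ d → over 0 d ≡ 0ℚ
over-zero d = ℚ.fromℚᵘ-cong {mkℚᵘ (pos 0) d} {mkℚᵘ (pos 0) 0} (*≡* refl)

digits-injective : ∀ {n x y k l} → x < n → y < n → x + n * k ≡ y + n * l → x ≡ y × k ≡ l
digits-injective {n} {x} {y} {k} {l} x<n y<n eq with <-cmp k l
... | tri≈ _ refl _ = +-cancelʳ-≡ (n * k) x y eq , refl
... | tri< k<l _ _ = contradiction eq (<⇒≢ (begin-strict
    x + n * k    <⟨ +-monoˡ-< (n * k) x<n ⟩
    n + n * k    ≡⟨ *-suc n k ⟨
    n * suc k    ≤⟨ *-monoʳ-≤ n k<l ⟩
    n * l        ≤⟨ m≤n+m _ y ⟩
    y + n * l    ∎))
  where open ≤-Reasoning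
... | tri> _ _ l<k = contradiction (sym eq) (<⇒≢ (begin-strict
    y + n * l    <⟨ +-monoˡ-< (n * l) y<n ⟩
    n + n * l    ≡⟨ *-suc n l ⟨
    n * suc l    ≤⟨ *-monoʳ-≤ n l<k ⟩
    n * k        ≤⟨ m≤n+m _ x ⟩
    x + n * k    ∎))
  where open ≤-Reasoning

module _ {n : ℕ} where

  code : Edge n → ℕ
  code (edge a b k) = toℕ a + n * (toℕ b + n * k)

  code-injective : ∀ {e f} → code e ≡ code f → e ≡ f
  code-injective {edge a b k} {edge a′ b′ k′} eq with digits-injective (toℕ<n a) (toℕ<n a′) eq
  ... | a≡ , eq′ with digits-injective (toℕ<n b) (toℕ<n b′) eq′
  ... | b≡ , refl with toℕ-injective a≡ | toℕ-injective b≡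
  ... | refl | refl = refl

  -- Distinct tie-breaking terms, so small that those of fewer than n + 1 edges add up to less than 1:
  -- a minimum spanning tree for W is one for the integral loads.
  tie : Edge n → ℚ
  tie e = over 1 (n + code e)

  abstract

    W : ℕ → Edge n → ℚ
    W k e = fromℕ k +ℚ tie e

    tie>0 : ∀ e → 0ℚ <ℚ tie e
    tie>0 e = subst (_<ℚ tie e) (over-zero (n + code e)) (over-< {0} {1} {n + code e} (s≤s z≤n))

    tie≤ : ∀ e → tie e ≤ℚ over 1 n
    tie≤ e = over-antitone (m≤m+n n (code e))

    -- A tie-breaking term is positive and at most 1, so it never outweighs a difference of one in
    -- the load; strictness comes from the term of `f`.
    W-< : ∀ {k l} e f → k < l → W k e <ℚ W l f
    W-< {k} {l} e f k<l = begin-strict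
      fromℕ k +ℚ tie e    ≤⟨ ℚ.+-monoʳ-≤ (fromℕ k) (ℚ.≤-trans (tie≤ e) (over-antitone {0} {n} z≤n)) ⟩
      fromℕ k +ℚ fromℕ 1  ≡⟨ fromℕ-homo-+ k 1 ⟩
      fromℕ (k + 1)       ≤⟨ fromℕ-mono-≤ (≤-trans (≤-reflexive (+-comm k 1)) k<l) ⟩
      fromℕ l             ≡⟨ ℚ.+-identityʳ (fromℕ l) ⟨
      fromℕ l +ℚ 0ℚ       <⟨ ℚ.+-monoʳ-< (fromℕ l) (tie>0 f) ⟩
      fromℕ l +ℚ tie f    ∎
      where open ℚ.≤-Reasoning

    W-injectiveʳ : ∀ k {e f} → W k e ≡ W k f → e ≡ f
    W-injectiveʳ k {e} {f} eq = code-injective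
        (+-cancelˡ-≡ n _ _ (over-injective (ℚ.≤-antisym (cancel eq) (cancel (sym eq)))))
      where
      cancel : ∀ {e f} → W k e ≡ W k f → tie e ≤ℚ tie f
      cancel eq = ℚ.≮⇒≥ λ lt → ℚ.<-irrefl (sym eq) (ℚ.+-monoʳ-< (fromℕ k) lt)

    W-lower : ∀ k e → fromℕ k ≤ℚ W k e
    W-lower k e = subst (_≤ℚ W k e) (ℚ.+-identityʳ (fromℕ k)) (ℚ.+-monoʳ-≤ (fromℕ k) (ℚ.<⇒≤ (tie>0 e)))

    W-upper : ∀ k e → W k e ≤ℚ fromℕ k +ℚ over 1 n
    W-upper k e = ℚ.+-monoʳ-≤ (fromℕ k) (tie≤ e)

  W-monoˡ-≤ : ∀ {k l} e → k ≤ l → W k e ≤ℚ W l e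
  W-monoˡ-≤ {k} {l} e k≤l with m≤n⇒m<n∨m≡n k≤l
  ... | inj₁ k<l  = ℚ.<⇒≤ (W-< e e k<l)
  ... | inj₂ refl = ℚ.≤-refl

  W-cancel-≤ : ∀ {k l e f} → W k e ≤ℚ W l f → k ≤ l
  W-cancel-≤ {k} {l} {e} {f} p with k ≤? l
  ... | yes k≤l = k≤l
  ... | no  k≰l = contradiction p (<ℚ⇒≱ℚ (W-< f e (≰⇒> k≰l)))

  W-injective : ∀ {k l e f} → W k e ≡ W l f → e ≡ f
  W-injective {k} {l} {e} {f} eq
    with ≤-antisym (W-cancel-≤ {k} {l} {e} {f} (ℚ.≤-reflexive eq))
        (W-cancel-≤ {l} {k} {f} {e} (ℚ.≤-reflexive (sym eq)))
  ... | refl = W-injectiveʳ k eq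

  totalWeight-W-lower : ∀ (ℓ : Edge n → ℕ) S → fromℕ (∑ S ℓ) ≤ℚ totalWeight (λ e → W (ℓ e) e) S
  totalWeight-W-lower ℓ []      = ℚ.≤-refl
  totalWeight-W-lower ℓ (e ∷ S) = ℚ.≤-trans (ℚ.≤-reflexive (sym (fromℕ-homo-+ (ℓ e) (∑ S ℓ))))
    (ℚ.+-mono-≤ (W-lower (ℓ e) e) (totalWeight-W-lower ℓ S))

  totalWeight-W-upper : ∀ (ℓ : Edge n → ℕ) S → totalWeight (λ e → W (ℓ e) e) S ≤ℚ fromℕ (∑ S ℓ) +ℚ
      over (length S) n
  totalWeight-W-upper ℓ []      = ℚ.≤-reflexive (sym (trans (cong (fromℕ 0 +ℚ_) (over-zero n)) refl))
  totalWeight-W-upper ℓ (e ∷ S) = begin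
    W (ℓ e) e +ℚ totalWeight (λ e → W (ℓ e) e) S
      ≤⟨ ℚ.+-mono-≤ (W-upper (ℓ e) e) (totalWeight-W-upper ℓ S) ⟩
    (fromℕ (ℓ e) +ℚ over 1 n) +ℚ (fromℕ (∑ S ℓ) +ℚ over (length S) n)
      ≡⟨ interchange (fromℕ (ℓ e)) (over 1 n) (fromℕ (∑ S ℓ)) (over (length S) n) ⟩
    (fromℕ (ℓ e) +ℚ fromℕ (∑ S ℓ)) +ℚ (over 1 n +ℚ over (length S) n)
      ≡⟨ cong₂ _+ℚ_ (fromℕ-homo-+ (ℓ e) (∑ S ℓ)) (over-+ 1 (length S) n) ⟩
    fromℕ (∑ (e ∷ S) ℓ) +ℚ over (suc (length S)) n ∎
    where
    open ℚ.≤-Reasoning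
    open import Algebra.Properties.CommutativeSemigroup
        (CommutativeMonoid.commutativeSemigroup ℚ.+-0-commutativeMonoid) using (interchange)

  totalWeight-W-reflects-≤ : ∀ (ℓ : Edge n → ℕ) {S T} → length S ≤ n →
    totalWeight (λ e → W (ℓ e) e) T ≤ℚ totalWeight (λ e → W (ℓ e) e) S → ∑ T ℓ ≤ ∑ S ℓ
  totalWeight-W-reflects-≤ ℓ {S} {T} S≤n le = s≤s⁻¹ (fromℕ-cancel-< (begin-strict
    fromℕ (∑ T ℓ)                           ≤⟨ totalWeight-W-lower ℓ T ⟩
    totalWeight (λ e → W (ℓ e) e) T         ≤⟨ le ⟩
    totalWeight (λ e → W (ℓ e) e) S         ≤⟨ totalWeight-W-upper ℓ S ⟩
    fromℕ (∑ S ℓ) +ℚ over (length S) n      <⟨ ℚ.+-monoʳ-< (fromℕ (∑ S ℓ)) (over-< (s≤s S≤n)) ⟩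
    fromℕ (∑ S ℓ) +ℚ over (suc n) n         ≡⟨ cong (fromℕ (∑ S ℓ) +ℚ_) (over-self n) ⟩
    fromℕ (∑ S ℓ) +ℚ fromℕ 1                ≡⟨ fromℕ-homo-+ (∑ S ℓ) 1 ⟩
    fromℕ (∑ S ℓ + 1)                       ≡⟨ cong fromℕ (+-comm (∑ S ℓ) 1) ⟩
    fromℕ (suc (∑ S ℓ))                     ∎))
    where open ℚ.≤-Reasoning

-- Kruskal's criterion and greedy loads

Unique-resp-↭ : ∀ {A : Set} {xs ys : List A} → xs ↭ ys → Unique xs → Unique ys
Unique-resp-↭ {A} p = ↭ₛ.Unique-resp-↭ (setoid A) (↭⇒↭ₛ p)

∑-cong-set : ∀ {A : Set} {xs ys : List A} f → Unique xs → Unique ys → xs ⊆ ys → ys ⊆ xs → ∑ xs f ≡ ∑ ys f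
∑-cong-set f ux uy p q = ≤-antisym (∑-unique-⊆ f ux p) (∑-unique-⊆ f uy q)

module _ {n : ℕ} where

  module Kruskal (w : Edge n → ℚ) where

    lighter : EdgeSet n → Edge n → EdgeSet n
    lighter H f = filter (λ g → w g ℚ.<? w f) H

    -- For injective w, the edges accepted are those of the minimum spanning tree.
    kruskal? : ∀ H f → Dec (¬ Conn (lighter H f) f)
    kruskal? H f = ¬? (conn? (lighter H f) f)

    ∈-lighter⁻ : ∀ {H f g} → g ∈ lighter H f → g ∈ H × w g <ℚ w f
    ∈-lighter⁻ {H} {f} = ∈-filter⁻ (λ g → w g ℚ.<? w f) {xs = H}

    ∈-lighter⁺ : ∀ {H f g} → g ∈ H → w g <ℚ w f → g ∈ lighter H f
    ∈-lighter⁺ {H} {f} = ∈-filter⁺ (λ g → w g ℚ.<? w f)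

    -- With the heaviest edge first, the edges lighter than the head are exactly the tail. The
    -- induction is thus a run of Kruskal's algorithm, in which every accepted edge costs one
    -- component.
    count-sorted : ∀ {L} → AllPairs (λ x y → w y <ℚ w x) L → ∑ L (λ f → ⟦ kruskal? L f ⟧) + κ L ≡ n
    count-sorted []                  = κ-[]
    count-sorted {e ∷ D} (D<e ∷ srt) = begin
        ⟦ kruskal? (e ∷ D) e ⟧ + ∑ D (λ f → ⟦ kruskal? (e ∷ D) f ⟧) + κ (e ∷ D)
          ≡⟨ cong (λ s → ⟦ kruskal? (e ∷ D) e ⟧ + s + κ (e ∷ D))
              (∑-cong D λ {f} f∈ → cong (λ L → ⟦ ¬? (conn? L f) ⟧) (tail-lighter f∈)) ⟩
        ⟦ kruskal? (e ∷ D) e ⟧ + S + κ (e ∷ D)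
          ≡⟨ cong (λ L → ⟦ ¬? (conn? L e) ⟧ + S + κ (e ∷ D)) head-lighter ⟩
        ⟦ ¬? (conn? D e) ⟧ + S + κ (e ∷ D)
          ≡⟨ last-step ⟩
        S + κ D
          ≡⟨ count-sorted srt ⟩
        n ∎
      where
      open ≡-Reasoning
      S = ∑ D (λ f → ⟦ kruskal? D f ⟧)
      tail-lighter : ∀ {f} → f ∈ D → lighter (e ∷ D) f ≡ lighter D f
      tail-lighter {f} f∈ = filter-reject (λ g → w g ℚ.<? w f) (ℚ.<-asym (All.lookup D<e f∈))
      head-lighter : lighter (e ∷ D) e ≡ D
      head-lighter = trans (filter-reject (λ g → w g ℚ.<? w e) (ℚ.<-irrefl refl))
          (filter-all (λ g → w g ℚ.<? w e) D<e)
      last-step : ⟦ ¬? (conn? D e) ⟧ + S + κ (e ∷ D) ≡ S + κ D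
      last-step with conn? D e
      ... | yes e~ = cong (λ k → S + k) (κ-conn {D = D} {e} e~)
      ... | no  e≁ = trans (sym (+-suc S _)) (cong (λ k → S + k) (sym (κ-¬conn {D = D} {e} e≁)))

    module _ (w-injective : ∀ {e f} → w e ≡ w f → e ≡ f) where

      descending : DecTotalOrder _ _ _
      descending = On.decTotalOrder (Flip.decTotalOrder ℚ.≤-decTotalOrder) w

      count-kruskal : ∀ {H} → Unique H → ∑ H (λ f → ⟦ kruskal? H f ⟧) + κ H ≡ n
      count-kruskal {H} uH = begin
          ∑ H (λ f → ⟦ kruskal? H f ⟧) + κ H
              ≡⟨ cong₂ _+_ (trans (∑-cong-set _ uH uL H⊆L L⊆H) (∑-cong L λ {f} _ →
              ⟦⟧-cong (kruskal? H f) (kruskal? L f)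
                  (λ ¬~ ~ → ¬~ (comp≡-⊆ {D = lighter L f} {lighter H f} (lighter-⊆ L⊆H) ~))
                                                 (λ ¬~ ~ → ¬~ (comp≡-⊆ {D = lighter H f} {lighter L f}
                                                     (lighter-⊆ H⊆L) ~))))
              (κ-cong {D = H} {L} H⊆L L⊆H) ⟩
          ∑ L (λ f → ⟦ kruskal? L f ⟧) + κ L ≡⟨ count-sorted strict ⟩
          n                                  ∎
        where
        open ≡-Reasoning
        open Sort descending using (sort; sort-↭; sort-↗)
        L   = sort H
        L⊆H : L ⊆ H
        L⊆H = ∈-resp-↭ (sort-↭ H)
        H⊆L : H ⊆ L
        H⊆L = ∈-resp-↭ (↭-sym (sort-↭ H))
        uL : Unique L
        uL = Unique-resp-↭ (↭-sym (sort-↭ H)) uH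
        lighter-⊆ : ∀ {A B f} → A ⊆ B → lighter A f ⊆ lighter B f
        lighter-⊆ {A} A⊆B x∈ with ∈-lighter⁻ {A} x∈
        ... | x∈A , lt = ∈-lighter⁺ (A⊆B x∈A) lt
        strict : AllPairs (λ x y → w y <ℚ w x) L
        strict = AllPairs.zipWith (λ { (le , x≢y) → ℚ.≰⇒> λ ge → x≢y (w-injective (ℚ.≤-antisym ge le)) })
                   (Linked⇒AllPairs (λ p q → ℚ.≤-trans q p) (sort-↗ H) , uL)

      -- `P` holds on an initial segment of the weight order, where Kruskal's algorithm decides as
      -- it does on all of `H`; the two counts differ by the edges accepted later.
      count-kruskal-above : ∀ {H} → Unique H → {P : Edge n → Set} (P? : ∀ e → Dec (P e)) →
        (∀ {e f} → w e <ℚ w f → P f → P e) →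
        κ (filter P? H) ≡ κ H + ∑ H (λ f → ⟦ ¬? (P? f) ⟧ * ⟦ kruskal? H f ⟧)
      count-kruskal-above {H} uH {P} P? down = +-cancelˡ-≡ (∑ H (λ f → ⟦ P? f ⟧ * k f)) _ _ (begin
          ∑ H (λ f → ⟦ P? f ⟧ * k f) + κ D
              ≡⟨ cong (_+ κ D) (trans (sym (∑-filter P? H k)) (∑-cong D same)) ⟩
          ∑ D (λ f → ⟦ kruskal? D f ⟧) + κ D                    ≡⟨ count-kruskal (Unique.filter⁺ P? uH) ⟩
          n                                                     ≡⟨ count-kruskal uH ⟨
          ∑ H k + κ H                                           ≡⟨ cong (_+ κ H)
              (trans (∑-cong H λ {f} _ → split f) (∑-+ H _ _)) ⟩
          ∑ H (λ f → ⟦ P? f ⟧ * k f) + ∑ H (λ f → ⟦ ¬? (P? f) ⟧ * k f) + κ H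
            ≡⟨ trans (+-assoc (∑ H (λ f → ⟦ P? f ⟧ * k f)) _ _)
                (cong (∑ H (λ f → ⟦ P? f ⟧ * k f) +_) (+-comm _ (κ H))) ⟩
          ∑ H (λ f → ⟦ P? f ⟧ * k f) + (κ H + ∑ H (λ f → ⟦ ¬? (P? f) ⟧ * k f)) ∎)
        where
        open ≡-Reasoning
        D = filter P? H
        k : Edge n → ℕ
        k f = ⟦ kruskal? H f ⟧
        same : ∀ {f} → f ∈ D → k f ≡ ⟦ kruskal? D f ⟧
        same {f} f∈ = ⟦⟧-cong (kruskal? H f) (kruskal? D f)
            (λ ¬~ ~ → ¬~ (comp≡-⊆ {D = lighter D f} {lighter H f}
                (λ x∈ → case ∈-lighter⁻ {D} x∈ of
                λ { (x∈D , lt) → ∈-lighter⁺ (proj₁ (∈-filter⁻ P? {xs = H} x∈D)) lt }) ~))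
            (λ ¬~ ~ → ¬~ (comp≡-⊆ {D = lighter H f} {lighter D f}
                (λ x∈ → case ∈-lighter⁻ {H} x∈ of λ { (x∈H , lt) →
                ∈-lighter⁺ (∈-filter⁺ P? x∈H (down lt (proj₂ (∈-filter⁻ P? {xs = H} f∈)))) lt }) ~))
        split : ∀ f → k f ≡ ⟦ P? f ⟧ * k f + ⟦ ¬? (P? f) ⟧ * k f
        split f with P? f
        ... | yes _ = sym (trans (+-identityʳ _) (+-identityʳ _))
        ... | no  _ = sym (+-identityʳ _)

  open Kruskal

  -- The number of trees containing an edge after j greedy steps, with ties broken by tie: a function
  -- of the graph only, so that consecutive graphs can be compared.
  greedyLoad : EdgeSet n → ℕ → Edge n → ℕ
  greedyLoad H zero    e = 0
  greedyLoad H (suc j) e = greedyLoad H j e + ⟦ kruskal? (λ f → W (greedyLoad H j f) f) H e ⟧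

  greedyWeight : EdgeSet n → ℕ → Edge n → ℚ
  greedyWeight H j e = W (greedyLoad H j e) e

  greedyTree? : ∀ H j f → Dec (¬ Conn (lighter (greedyWeight H j) H f) f)
  greedyTree? H j = kruskal? (greedyWeight H j) H

  greedyWeight-injective : ∀ H j {e f} → greedyWeight H j e ≡ greedyWeight H j f → e ≡ f
  greedyWeight-injective H j = W-injective

  greedyLoad≤ : ∀ H j f → greedyLoad H j f ≤ j
  greedyLoad≤ H zero    f = z≤n
  greedyLoad≤ H (suc j) f = ≤-trans (+-mono-≤ (greedyLoad≤ H j f) (⟦⟧≤1 (greedyTree? H j f)))
      (≤-reflexive (+-comm j 1))

  greedyLoad-mono : ∀ H {j k} f → j ≤ k → greedyLoad H j f ≤ greedyLoad H k f
  greedyLoad-mono H f j≤k = go (≤⇒≤′ j≤k)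
    where
    go : ∀ {j k} → j ≤′ k → greedyLoad H j f ≤ greedyLoad H k f
    go ≤′-refl       = ≤-refl
    go (≤′-step j≤k) = ≤-trans (go j≤k) (m≤m+n _ _)

  -- A strict inequality survives one step, as loads grow by at most 1. At equality `f` has the same
  -- weight in both graphs, and the edges lighter than `f` in `H` stay lighter in `H′`; so if the
  -- tree for `H′` takes `f`, the tree for `H` does too.
  greedyLoad-antitone : ∀ {H H′} → H ⊆ H′ → ∀ j {f} → f ∈ H → greedyLoad H′ j f ≤ greedyLoad H j f
  greedyLoad-antitone H⊆ zero    f∈ = z≤n
  greedyLoad-antitone {H} {H′} H⊆ (suc j) {f} f∈ with m≤n⇒m<n∨m≡n (greedyLoad-antitone H⊆ j f∈)
  ... | inj₁ lt = ≤-trans (+-monoʳ-≤ (greedyLoad H′ j f) (⟦⟧≤1 (greedyTree? H′ j f)))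
                    (≤-trans (≤-reflexive (+-comm _ 1)) (≤-trans lt (m≤m+n _ _)))
  ... | inj₂ eq = +-mono-≤ (≤-reflexive eq) (⟦⟧-mono (greedyTree? H′ j f) (greedyTree? H j f)
        λ ¬~ ~ → ¬~ (comp≡-⊆ {D = lighter (greedyWeight H j) H f} {lighter (greedyWeight H′ j) H′ f} sub ~))
    where
    sub : lighter (greedyWeight H j) H f ⊆ lighter (greedyWeight H′ j) H′ f
    sub {g} g∈ with ∈-lighter⁻ (greedyWeight H j) {H} g∈
    ... | g∈H , lt = ∈-lighter⁺ (greedyWeight H′ j) (H⊆ g∈H)
          (ℚ.≤-<-trans (W-monoˡ-≤ g (greedyLoad-antitone H⊆ j g∈H))
              (subst (λ k → greedyWeight H j g <ℚ W k f) (sym eq) lt))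

  ∑-greedyLoad : ∀ {H} → Unique H → ∀ j → ∑ H (greedyLoad H j) + j * κ H ≡ j * n
  ∑-greedyLoad {H} uH zero    = trans (+-identityʳ _) (∑-zero H λ _ → refl)
  ∑-greedyLoad {H} uH (suc j) = begin
    ∑ H (greedyLoad H (suc j)) + (κ H + j * κ H)  ≡⟨ cong₂ _+_ (∑-+ H _ _) (+-comm (κ H) _) ⟩
    ∑ H (greedyLoad H j) + T + (j * κ H + κ H)    ≡⟨ +-interchange (∑ H (greedyLoad H j)) T (j * κ H) (κ H) ⟩
    ∑ H (greedyLoad H j) + j * κ H + (T + κ H)
        ≡⟨ cong₂ _+_ (∑-greedyLoad uH j) (count-kruskal (greedyWeight H j) (greedyWeight-injective H j) uH) ⟩
    j * n + n                                     ≡⟨ +-comm (j * n) n ⟩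
    suc j * n                                     ∎
    where
    open ≡-Reasoning
    T = ∑ H (λ f → ⟦ greedyTree? H j f ⟧)

  -- By greedyLoad-antitone every change is an increase, and the loads have the same sum in H and in
  -- H - e: so at most as many loads change as there were trees through e.
  changed-greedyLoad : ∀ {H} → Unique H → ∀ {e} → e ∈ H → Connected H → Connected (H - e) → ∀ j →
    ∑ (H - e) (λ f → ⟦ ¬? (greedyLoad (H - e) j f ≟ℕ greedyLoad H j f) ⟧) ≤ greedyLoad H j e
  changed-greedyLoad {H} uH {e} e∈ conH conH′ j = +-cancelˡ-≤ (∑ H′ (greedyLoad H j)) _ _ (begin
      ∑ H′ (greedyLoad H j) + ∑ H′ changed           ≡⟨ ∑-+ H′ _ _ ⟨
      ∑ H′ (λ f → greedyLoad H j f + changed f)      ≤⟨ ∑-mono H′ rise ⟩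
      ∑ H′ (greedyLoad H′ j)
          ≡⟨ +-cancelʳ-≡ (j * κ H) _ _
          (trans (cong (λ k → ∑ H′ (greedyLoad H′ j) + j * k) (connected⇒κ-same {D = H} {H′} conH conH′))
                                                          (trans (∑-greedyLoad (-‿unique e uH) j)
                                                              (sym (∑-greedyLoad uH j)))) ⟩
      ∑ H (greedyLoad H j)
          ≡⟨ ∑-cong-set (greedyLoad H j) uH (Unique-resp-↭ (↭-∷- uH e∈) uH) (∈-resp-↭ (↭-∷- uH e∈))
          (∈-resp-↭ (↭-sym (↭-∷- uH e∈))) ⟩
      greedyLoad H j e + ∑ H′ (greedyLoad H j)       ≡⟨ +-comm (greedyLoad H j e) _ ⟩
      ∑ H′ (greedyLoad H j) + greedyLoad H j e       ∎)
    where
    open ≤-Reasoning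
    H′ = H - e
    changed : Edge n → ℕ
    changed f = ⟦ ¬? (greedyLoad H′ j f ≟ℕ greedyLoad H j f) ⟧
    rise : ∀ {f} → f ∈ H′ → greedyLoad H j f + changed f ≤ greedyLoad H′ j f
    rise {f} f∈ with greedyLoad H′ j f ≟ℕ greedyLoad H j f | greedyLoad-antitone {H′} {H}
        (proj₁ ∘ ∈--⁻ {D = H}) j f∈
    ... | yes eq | _  = ≤-reflexive (trans (+-identityʳ _) (sym eq))
    ... | no neq | le = ≤-trans (≤-reflexive (+-comm _ 1)) (≤∧≢⇒< le (neq ∘ sym))

-- The load bound

^-distribʳ-* : ∀ a b q → (a * b) ^ q ≡ a ^ q * b ^ q
^-distribʳ-* a b zero    = refl
^-distribʳ-* a b (suc q) = trans (cong (a * b *_) (^-distribʳ-* a b q)) (*-interchange a b (a ^ q) (b ^ q))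

-- Bernoulli's inequality `(1 - 1 / (a + 1)) ^ m ≥ 1 - m / (a + 1)` without denominators, where
-- `r = a + 1 - m`.
bernoulli : ∀ {a} m {r} → suc a ≡ m + r → suc a ^ m * r ≤ a ^ m * suc a
bernoulli         zero    refl = ≤-refl
bernoulli {a} (suc m) {r} eq   = begin
  suc a * suc a ^ m * r        ≡⟨ cong (_* r) (*-comm (suc a) (suc a ^ m)) ⟩
  suc a ^ m * suc a * r        ≡⟨ *-assoc (suc a ^ m) (suc a) r ⟩
  suc a ^ m * (suc a * r)
      ≤⟨ *-monoʳ-≤ (suc a ^ m) (≤-trans (+-monoˡ-≤ (a * r) r≤a) (≤-reflexive (sym (*-suc a r)))) ⟩
  suc a ^ m * (a * suc r)      ≡⟨ *-x∙yz≈y∙xz (suc a ^ m) a (suc r) ⟩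
  a * (suc a ^ m * suc r)      ≤⟨ *-monoʳ-≤ a (bernoulli {a} m (trans eq (sym (+-suc m r)))) ⟩
  a * (a ^ m * suc a)          ≡⟨ *-assoc a (a ^ m) (suc a) ⟨
  a * a ^ m * suc a            ∎
  where
  open ≤-Reasoning
  r≤a : r ≤ a
  r≤a = ≤-trans (m≤n+m r m) (≤-reflexive (sym (suc-injective eq)))

[2m+1]^m≤2[2m]^m : ∀ m → suc (m + m) ^ m ≤ 2 * (m + m) ^ m
[2m+1]^m≤2[2m]^m m = *-cancelʳ-≤ _ _ (suc m) (begin
  suc (m + m) ^ m * suc m          ≤⟨ bernoulli m (sym (+-suc m m)) ⟩
  (m + m) ^ m * suc (m + m)
      ≤⟨ *-monoʳ-≤ ((m + m) ^ m)
      (≤-trans (n≤1+n _)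
      (≤-reflexive (cong suc (trans (sym (+-suc m m)) (cong (m +_) (sym (+-identityʳ (suc m)))))))) ⟩
  (m + m) ^ m * (2 * suc m)        ≡⟨ *-assoc ((m + m) ^ m) 2 (suc m) ⟨
  (m + m) ^ m * 2 * suc m          ≡⟨ cong (_* suc m) (*-comm ((m + m) ^ m) 2) ⟩
  2 * (m + m) ^ m * suc m          ∎)
  where open ≤-Reasoning

-- ⌈2 ^ i / 2⌉: a graph with minimum cut 2 ^ i is this strong in the sense of Strong below.
strength : ℕ → ℕ
strength zero    = 1
strength (suc i) = 2 ^ i

1≤strength : ∀ i → 1 ≤ strength i
1≤strength zero    = ≤-refl
1≤strength (suc i) = m^n>0 2 i

-- `(1 + 1 / K) ^ K ≤ 4` replaces the bound by Euler's number; as 4 is `2 ^ 2`, it becomes a load of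
-- 2 per `K` trees. The first two strengths are 1; all others are even, and squaring
-- `[2m+1]^m≤2[2m]^m` applies.
[1+strength]^strength : ∀ i → suc (strength i) ^ strength i ≤ 4 * strength i ^ strength i
[1+strength]^strength zero          = m≤m+n 2 2
[1+strength]^strength (suc zero)    = m≤m+n 2 2
[1+strength]^strength (suc (suc i)) = subst (λ K → suc K ^ K ≤ 4 * K ^ K)
    (cong (2 ^ i +_) (sym (+-identityʳ (2 ^ i)))) (begin
  suc (m + m) ^ (m + m)                     ≡⟨ ^-distribˡ-+-* (suc (m + m)) m m ⟩
  suc (m + m) ^ m * suc (m + m) ^ m         ≤⟨ *-mono-≤ ([2m+1]^m≤2[2m]^m m) ([2m+1]^m≤2[2m]^m m) ⟩
  2 * (m + m) ^ m * (2 * (m + m) ^ m)       ≡⟨ *-interchange 2 ((m + m) ^ m) 2 ((m + m) ^ m) ⟩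
  4 * ((m + m) ^ m * (m + m) ^ m)           ≡⟨ cong (4 *_) (^-distribˡ-+-* (m + m) m m) ⟨
  4 * (m + m) ^ (m + m)                     ∎)
  where
  m = 2 ^ i
  open ≤-Reasoning

-- One layer in the decomposition of `2 ^ m` by thresholds: reaching `t + 1` adds `2 ^ t`.
2^[m⊓1+t] : ∀ m t → 2 ^ (m ⊓ suc t) ≡ 2 ^ (m ⊓ t) + ⟦ ¬? (m <? suc t) ⟧ * 2 ^ t
2^[m⊓1+t] m t with m <? suc t
... | yes m≤t rewrite m≤n⇒m⊓n≡m (<⇒≤ m≤t) | m≤n⇒m⊓n≡m (s≤s⁻¹ m≤t) = sym (+-identityʳ (2 ^ m))
... | no  m≰t rewrite m≥n⇒m⊓n≡n (≮⇒≥ m≰t) | m≥n⇒m⊓n≡n (<⇒≤ (≮⇒≥ m≰t)) = refl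

module _ {n : ℕ} where

  open DecMembership (_≟_ {n}) using (_∈?_; _∉?_)

  -- Every partition of the vertices into p classes has at least K (p - 1) edges of H between the
  -- classes; the partition is given by the components of an arbitrary D.
  Strong : ℕ → EdgeSet n → Set
  Strong K H = ∀ D → K * κ D ≤ K + length (H ∖ D)

  ∣∖∣≡∑ : ∀ H D → length (H ∖ D) ≡ ∑ H (λ e → ⟦ e ∉? D ⟧)
  ∣∖∣≡∑ H D = length-filter≡∑ (_∉? D) H

  ∑-empty : ∀ {H : EdgeSet n} {f} → H ≡ [] → ∑ H f ≡ 0
  ∑-empty refl = refl

  vertexOf : ∀ (H : EdgeSet n) → H ≡ [] ⊎ Fin n
  vertexOf []      = inj₁ refl
  vertexOf (e ∷ _) = inj₂ (end₁ e)

  -- Strength is tested on the partition into the components of `H` itself, which no edge crosses.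
  strong⇒connected : ∀ {K H} → 1 ≤ K → Strong K H → Connected H
  strong⇒connected {suc K} {H} _ strong = κ≤1⇒connected {D = H} (*-cancelˡ-≤ (suc K) (begin
    suc K * κ H             ≤⟨ strong H ⟩
    suc K + length (H ∖ H)
        ≡⟨ cong (suc K +_) (trans (∣∖∣≡∑ H H) (∑-zero H λ {x} x∈ → ⟦⟧-no (x ∉? H) λ x∉ → x∉ x∈)) ⟩
    suc K + 0               ≡⟨ trans (+-identityʳ _) (sym (*-identityʳ (suc K))) ⟩
    suc K * 1               ∎))
    where open ≤-Reasoning

  module _ {K : ℕ} {H : EdgeSet n} (unique : Unique H) (strong : Strong K H) where

    -- Loads below `t` form an initial segment `D` of the weight order. Hence the tree has
    -- `κ D - κ H` edges of load at least `t`, while strength supplies at least `K (κ D - 1)` such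
    -- edges in `H`.
    greedyTree-above : ∀ j t → K * ∑ H (λ f → ⟦ ¬? (greedyLoad H j f <? t) ⟧ * ⟦ greedyTree? H j f ⟧)
                                 ≤ ∑ H (λ f → ⟦ ¬? (greedyLoad H j f <? t) ⟧)
    greedyTree-above j t with vertexOf H
    -- Without edges there may be no vertex, and then `1 ≤ κ H` fails.
    ... | inj₁ empty = ≤-trans (≤-reflexive (trans (cong (K *_) (∑-empty empty)) (*-zeroʳ K))) z≤n
    ... | inj₂ v     = +-cancelˡ-≤ K _ _ (begin
        K + K * N                              ≤⟨ +-monoˡ-≤ (K * N)
            (≤-trans (≤-reflexive (sym (*-identityʳ K))) (*-monoʳ-≤ K (vertex⇒1≤κ v H))) ⟩
        K * κ H + K * N                        ≡⟨ *-distribˡ-+ K (κ H) N ⟨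
        K * (κ H + N)
            ≡⟨ cong (K *_)
            (Kruskal.count-kruskal-above (greedyWeight H j) (greedyWeight-injective H j) unique low?
                                                    λ lt → ≤-<-trans (W-cancel-≤ (ℚ.<⇒≤ lt))) ⟨
        K * κ D                                ≤⟨ strong D ⟩
        K + length (H ∖ D)                     ≡⟨ cong (K +_) (∣∖∣≡∑ H D) ⟩
        K + ∑ H (λ f → ⟦ f ∉? D ⟧)
            ≡⟨ cong (K +_) (∑-cong H λ {f} f∈ → ⟦⟧-cong (f ∉? D) (¬? (low? f))
                                                    (λ f∉ low → f∉ (∈-filter⁺ low? f∈ low))
                                                        (λ ¬low f∈D → ¬low
                                                        (proj₂ (∈-filter⁻ low? {xs = H} f∈D)))) ⟩
        K + ∑ H (λ f → ⟦ ¬? (low? f) ⟧)        ∎)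
      where
      open ≤-Reasoning
      low? : ∀ f → Dec (greedyLoad H j f < t)
      low? f = greedyLoad H j f <? t
      D = filter low? H
      N = ∑ H (λ f → ⟦ ¬? (low? f) ⟧ * ⟦ greedyTree? H j f ⟧)

    -- The potential of the multiplicative weights method: greedy trees are minimum spanning trees
    -- for the weights 2 ^ load as well.
    potential : ℕ → ℕ
    potential j = ∑ H (λ f → 2 ^ greedyLoad H j f)

    -- `greedyTree-above` for all thresholds up to `t`, weighted by the layers of `2 ^ load`. The
    -- truncation serves the induction: at `t = j` it has no effect, as loads are at most `j`.
    greedyTree-truncated : ∀ j t → K * ∑ H (λ f → ⟦ greedyTree? H j f ⟧ * 2 ^ (greedyLoad H j f ⊓ t))
                                     ≤ ∑ H (λ f → 2 ^ (greedyLoad H j f ⊓ t))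
    greedyTree-truncated j zero = subst₂ _≤_
      (cong (K *_) (∑-cong H λ {f} _ → trans (cong (_* ⟦ greedyTree? H j f ⟧) (one f))
          (trans (+-identityʳ _)
          (sym (trans (cong (λ k → ⟦ greedyTree? H j f ⟧ * 2 ^ k) (⊓-zeroʳ (greedyLoad H j f)))
          (*-identityʳ _))))))
      (∑-cong H λ {f} _ → trans (one f) (cong (2 ^_) (sym (⊓-zeroʳ (greedyLoad H j f)))))
      (greedyTree-above j 0)
      where
      one : ∀ f → ⟦ ¬? (greedyLoad H j f <? 0) ⟧ ≡ 1
      one f = ⟦⟧-yes (¬? (greedyLoad H j f <? 0)) λ ()
    greedyTree-truncated j (suc t) = begin
        K * ∑ H (λ f → b f * 2 ^ (ℓ f ⊓ suc t))
          ≡⟨ cong (K *_)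
              (trans (∑-cong H λ {f} _ → pointwise f)
              (trans (∑-+ H _ _) (cong (∑ H (λ f → b f * 2 ^ (ℓ f ⊓ t)) +_) (∑-*ˡ H (2 ^ t) _)))) ⟩
        K * (∑ H (λ f → b f * 2 ^ (ℓ f ⊓ t)) + 2 ^ t * A)
          ≡⟨ trans (*-distribˡ-+ K (∑ H (λ f → b f * 2 ^ (ℓ f ⊓ t))) _)
              (cong (K * ∑ H (λ f → b f * 2 ^ (ℓ f ⊓ t)) +_) (*-x∙yz≈y∙xz K (2 ^ t) A)) ⟩
        K * ∑ H (λ f → b f * 2 ^ (ℓ f ⊓ t)) + 2 ^ t * (K * A)
          ≤⟨ +-mono-≤ (greedyTree-truncated j t) (*-monoʳ-≤ (2 ^ t) (greedyTree-above j (suc t))) ⟩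
        ∑ H (λ f → 2 ^ (ℓ f ⊓ t)) + 2 ^ t * ∑ H high
          ≡⟨ cong (∑ H (λ f → 2 ^ (ℓ f ⊓ t)) +_) (∑-*ˡ H (2 ^ t) high) ⟨
        ∑ H (λ f → 2 ^ (ℓ f ⊓ t)) + ∑ H (λ f → 2 ^ t * high f)
          ≡⟨ ∑-+ H _ _ ⟨
        ∑ H (λ f → 2 ^ (ℓ f ⊓ t) + 2 ^ t * high f)
          ≡⟨ ∑-cong H (λ {f} _ → trans (cong (2 ^ (ℓ f ⊓ t) +_) (*-comm (2 ^ t) (high f)))
              (sym (2^[m⊓1+t] (ℓ f) t))) ⟩
        ∑ H (λ f → 2 ^ (ℓ f ⊓ suc t)) ∎
      where
      open ≤-Reasoning
      ℓ b high : Edge n → ℕ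
      ℓ = greedyLoad H j
      b f = ⟦ greedyTree? H j f ⟧
      high f = ⟦ ¬? (ℓ f <? suc t) ⟧
      A = ∑ H (λ f → high f * b f)
      pointwise : ∀ f → b f * 2 ^ (ℓ f ⊓ suc t) ≡ b f * 2 ^ (ℓ f ⊓ t) + 2 ^ t * (high f * b f)
      pointwise f = trans (cong (b f *_) (2^[m⊓1+t] (ℓ f) t)) (trans (*-distribˡ-+ (b f) (2 ^ (ℓ f ⊓ t)) _)
        (cong (b f * 2 ^ (ℓ f ⊓ t) +_)
            (trans (*-comm (b f) _)
            (trans (cong (_* b f) (*-comm (high f) (2 ^ t))) (*-assoc (2 ^ t) (high f) (b f))))))

    potential-step : ∀ j → K * potential (suc j) ≤ suc K * potential j
    potential-step j = begin
        K * potential (suc j)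
            ≡⟨ cong (K *_) (trans (∑-cong H λ {f} _ → grow (ℓ f) (greedyTree? H j f)) (∑-+ H _ _)) ⟩
        K * (potential j + ∑ H (λ f → b f * 2 ^ ℓ f))            ≡⟨ *-distribˡ-+ K (potential j) _ ⟩
        K * potential j + K * ∑ H (λ f → b f * 2 ^ ℓ f)          ≤⟨ +-monoʳ-≤ (K * potential j) (subst₂ _≤_
             (cong (K *_) (∑-cong H λ {f} _ → cong (λ k → b f * 2 ^ k) (m≤n⇒m⊓n≡m (greedyLoad≤ H j f))))
             (∑-cong H λ {f} _ → cong (2 ^_) (m≤n⇒m⊓n≡m (greedyLoad≤ H j f)))
             (greedyTree-truncated j j)) ⟩
        K * potential j + potential j                            ≡⟨ +-comm _ (potential j) ⟩
        suc K * potential j                                      ∎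
      where
      open ≤-Reasoning
      ℓ b : Edge n → ℕ
      ℓ = greedyLoad H j
      b f = ⟦ greedyTree? H j f ⟧
      grow : ∀ {P : Set} k (d : Dec P) → 2 ^ (k + ⟦ d ⟧) ≡ 2 ^ k + ⟦ d ⟧ * 2 ^ k
      grow k (yes _) = cong (2 ^_) (+-comm k 1)
      grow k (no _)  = trans (cong (2 ^_) (+-identityʳ k)) (sym (+-identityʳ (2 ^ k)))

    potential-bound : ∀ j → K ^ j * potential j ≤ suc K ^ j * length H
    potential-bound zero    = +-monoˡ-≤ 0 (≤-reflexive (trans (∑-const H 1) (*-identityʳ (length H))))
    potential-bound (suc j) = begin
        K * K ^ j * potential (suc j)
            ≡⟨ trans (cong (_* potential (suc j)) (*-comm K (K ^ j))) (*-assoc (K ^ j) K (potential (suc j))) ⟩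
        K ^ j * (K * potential (suc j))    ≤⟨ *-monoʳ-≤ (K ^ j) (potential-step j) ⟩
        K ^ j * (suc K * potential j)      ≡⟨ *-x∙yz≈y∙xz (K ^ j) (suc K) (potential j) ⟩
        suc K * (K ^ j * potential j)      ≤⟨ *-monoʳ-≤ (suc K) (potential-bound j) ⟩
        suc K * (suc K ^ j * length H)     ≡⟨ *-assoc (suc K) (suc K ^ j) (length H) ⟨
        suc K * suc K ^ j * length H       ∎
      where
      open ≤-Reasoning

    -- The single term `2 ^ load` is at most the potential, which after `K * q` steps is at most `(1
    -- + 1 / K) ^ (K * q) * length H ≤ 4 ^ q * 2 ^ s`.
    greedyLoad-bound : 1 ≤ K → suc K ^ K ≤ 4 * K ^ K → ∀ q {s} → length H ≤ 2 ^ s →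
                       ∀ {f} → f ∈ H → greedyLoad H (K * q) f ≤ 2 * q + s
    greedyLoad-bound 1≤K hK q {s} H≤ {f} f∈ = 2^-cancel-≤
        (*-cancelˡ-≤ (K ^ (K * q)) {{>-nonZero (m^n>0 K {{>-nonZero 1≤K}} (K * q))}} (begin
        K ^ (K * q) * 2 ^ greedyLoad H (K * q) f
            ≤⟨ *-monoʳ-≤ (K ^ (K * q)) (∈⇒≤∑ (λ f → 2 ^ greedyLoad H (K * q) f) f∈) ⟩
        K ^ (K * q) * potential (K * q)            ≤⟨ potential-bound (K * q) ⟩
        suc K ^ (K * q) * length H                 ≡⟨ cong (_* length H) (^-*-assoc (suc K) K q) ⟨
        (suc K ^ K) ^ q * length H                 ≤⟨ *-mono-≤ (^-monoˡ-≤ q hK) H≤ ⟩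
        (4 * K ^ K) ^ q * 2 ^ s
            ≡⟨ cong (_* 2 ^ s)
            (trans (^-distribʳ-* 4 (K ^ K) q) (cong₂ _*_ (^-*-assoc 2 2 q) (^-*-assoc K K q))) ⟩
        2 ^ (2 * q) * K ^ (K * q) * 2 ^ s
            ≡⟨ trans (cong (_* 2 ^ s) (*-comm (2 ^ (2 * q)) (K ^ (K * q))))
            (*-assoc (K ^ (K * q)) (2 ^ (2 * q)) (2 ^ s)) ⟩
        K ^ (K * q) * (2 ^ (2 * q) * 2 ^ s)        ≡⟨ cong (K ^ (K * q) *_) (^-distribˡ-+-* 2 (2 * q) s) ⟨
        K ^ (K * q) * 2 ^ (2 * q + s)              ∎))
      where
      open ≤-Reasoning
      2^-cancel-≤ : ∀ {a b} → 2 ^ a ≤ 2 ^ b → a ≤ b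
      2^-cancel-≤ {a} {b} p with a ≤? b
      ... | yes a≤b = a≤b
      ... | no  a≰b = contradiction p (<⇒≱ (^-monoʳ-< 2 (s≤s (s≤s z≤n)) (≰⇒> a≰b)))

  minCut⇒connected : ∀ {G k} → IsMinCut G k → 1 ≤ k → Connected G
  minCut⇒connected {G} {k} cut 1≤k with κ G ≤? 1
  ... | yes κ≤1 = κ≤1⇒connected {D = G} κ≤1
  ... | no  κ≰1 = contradiction (IsMinCut.minimal cut [] [] (λ ()) (λ con → κ≰1 (connected⇒κ≤1 {D = G}
          (subst Connected (filter-all (_∉? []) (All.tabulate λ _ ())) con)))) (<⇒≱ 1≤k)

  -- If there are several classes, each has a boundary of at least `k` edges, and an edge lies on at
  -- most two boundaries: hence the half in the strength. For `i = 0`, where the half is rounded up,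
  -- connectedness is used instead.
  minCut⇒strong : ∀ {G k} i → Unique G → IsMinCut G k → 2 ^ i ≤ k → Strong (strength i) G
  minCut⇒strong {G} {k} zero uG cut 1≤k D = begin
    1 * κ D                            ≡⟨ *-identityˡ (κ D) ⟩
    κ D                                ≤⟨ κ-++-≥ (G ∖ D) D ⟩
    length (G ∖ D) + κ ((G ∖ D) ++ D)
        ≤⟨ +-monoʳ-≤ _
        (≤-trans (κ-antitone {D = G} {(G ∖ D) ++ D} sub) (connected⇒κ≤1 {D = G} (minCut⇒connected cut 1≤k))) ⟩
    length (G ∖ D) + 1                 ≡⟨ +-comm _ 1 ⟩
    1 + length (G ∖ D)                 ∎
    where
    open ≤-Reasoning
    sub : G ⊆ (G ∖ D) ++ D
    sub {x} x∈ with x ∈? D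
    ... | yes x∈D = ∈-++⁺ʳ (G ∖ D) x∈D
    ... | no  x∉D = ∈-++⁺ˡ (∈-∖⁺ x∈ x∉D)
  minCut⇒strong {G} {k} (suc i) uG cut 2^i≤k D with κ D ≤? 1
  ... | yes κ≤1 = ≤-trans (≤-trans (*-monoʳ-≤ (2 ^ i) κ≤1) (≤-reflexive (*-identityʳ (2 ^ i))))
      (m≤m+n (2 ^ i) _)
  ... | no  κ≰1 = ≤-trans (*-cancelˡ-≤ 2 (begin
      2 * (2 ^ i * κ D)
          ≡⟨ trans (sym (*-assoc 2 (2 ^ i) (κ D))) (*-comm (2 ^ suc i) (κ D)) ⟩
      κ D * 2 ^ suc i                                           ≤⟨ *-monoʳ-≤ (κ D) 2^i≤k ⟩
      κ D * k                                                   ≡⟨ ∑-const (roots D) k ⟨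
      ∑ (roots D) (λ _ → k)
          ≤⟨ ∑-mono (roots D) (λ {x} x∈ → boundary-≥ x (root x∈)) ⟩
      ∑ (roots D) (λ x → ∑ G (λ e → ⟦ cut? x e ⟧))              ≡⟨ ∑-swap (roots D) G _ ⟩
      ∑ G (λ e → ∑ (roots D) (λ x → ⟦ cut? x e ⟧))              ≤⟨ ∑-mono G (λ {e} _ → twice e) ⟩
      ∑ G (λ e → 2 * ⟦ e ∉? D ⟧)                                ≡⟨ ∑-*ˡ G 2 _ ⟩
      2 * ∑ G (λ e → ⟦ e ∉? D ⟧)                                ≡⟨ cong (2 *_) (∣∖∣≡∑ G D) ⟨
      2 * length (G ∖ D)                                        ∎)) (m≤n+m (length (G ∖ D)) (2 ^ i))
    where
    open ≤-Reasoning
    root : ∀ {x} → x ∈ roots D → comp D x ≡ x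
    root x∈ = proj₂ (∈-filter⁻ (root? D) {xs = allFin n} x∈)
    Cut : Fin n → Edge n → Set
    Cut x e = (comp D (end₁ e) ≡ x × comp D (end₂ e) ≢ x) ⊎ (comp D (end₂ e) ≡ x × comp D (end₁ e) ≢ x)
    cut? : ∀ x e → Dec (Cut x e)
    cut? x e = ((comp D (end₁ e) ≟F x) ×-dec ¬? (comp D (end₂ e) ≟F x)) ⊎-dec
        ((comp D (end₂ e) ≟F x) ×-dec ¬? (comp D (end₁ e) ≟F x))
    trapped : ∀ {x u v} → comp D u ≡ x → Walk (G ∖ filter (cut? x) G) u v → comp D v ≡ x
    trapped         u~ []               = u~
    trapped {x} {u} u~ (step {v = v} e e∈ j p) with comp D v ≟F x | ∈-∖⁻ {D = G} e∈
    ... | yes v~ | _        = trapped v~ p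
    ... | no  v≁ | e∈G , e∉ = contradiction (∈-filter⁺ (cut? x) e∈G (crossing j)) e∉
      where
      crossing : Joins e u v → Cut x e
      crossing (inj₁ (refl , refl)) = inj₁ (u~ , v≁)
      crossing (inj₂ (refl , refl)) = inj₂ (u~ , v≁)
    -- With two or more classes the boundary of one of them is a cut: by `trapped` no walk leaves
    -- the class without it.
    boundary-≥ : ∀ x → comp D x ≡ x → k ≤ ∑ G (λ e → ⟦ cut? x e ⟧)
    boundary-≥ x x-root with k ≤? length (filter (cut? x) G)
    ... | yes k≤ = ≤-trans k≤ (≤-reflexive (length-filter≡∑ (cut? x) G))
    ... | no  k≰ with κ (G ∖ filter (cut? x) G) ≤? 1
    ...   | yes κ≤1 = contradiction (length-⊆ (roots-unique D) λ {y} y∈ →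
              here {xs = []}
                  (trans (sym (root y∈))
                  (trapped x-root (κ≤1⇒connected {D = G ∖ filter (cut? x) G} κ≤1 x y)))) κ≰1
    ...   | no  ≰1  = contradiction (IsMinCut.minimal cut _ (Unique.filter⁺ (cut? x) uG) (⊆.filter-⊆ (cut? x) G)
              (λ con → ≰1 (connected⇒κ≤1 {D = G ∖ filter (cut? x) G} con))) k≰
    twice : ∀ e → ∑ (roots D) (λ x → ⟦ cut? x e ⟧) ≤ 2 * ⟦ e ∉? D ⟧
    twice e with e ∈? D
    ... | yes e∈ = ≤-reflexive (∑-zero (roots D) λ {x} _ → ⟦⟧-no (cut? x e) λ
            { (inj₁ (p , q)) → q (trans (sym (∈⇒Conn {D = D} e∈)) p) ; (inj₂ (p , q)) → q
                (trans (∈⇒Conn {D = D} e∈) p) })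
    ... | no  e∉ = ≤-trans (≤-reflexive (sym (length-filter≡∑ (λ x → cut? x e) (roots D))))
            (length-⊆ {ys = comp D (end₁ e) ∷ comp D (end₂ e) ∷ []}
                (Unique.filter⁺ (λ x → cut? x e) (roots-unique D)) λ {x} x∈ →
              case proj₂ (∈-filter⁻ (λ x → cut? x e) {xs = roots D} x∈) of
                  λ { (inj₁ (p , _)) → here (sym p) ; (inj₂ (p , _)) → there (here (sym p)) })

-- Keeping a dynamic graph strong with virtual edges

sublists : ∀ {A : Set} → List A → List (List A)
sublists []       = [] ∷ []
sublists (x ∷ xs) = sublists xs ++ map (x ∷_) (sublists xs)

sublists-⊆ : ∀ {A : Set} {xs ys : List A} → ys ∈ sublists xs → ys ⊆ xs
sublists-⊆ {xs = []}     (here refl) ()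
sublists-⊆ {xs = x ∷ xs} ys∈ z∈ with ∈-++⁻ (sublists xs) ys∈
... | inj₁ ys∈ˡ = there (sublists-⊆ ys∈ˡ z∈)
... | inj₂ ys∈ʳ with ∈-map⁻ (x ∷_) ys∈ʳ
...   | zs , zs∈ , refl with z∈
...     | here refl = here refl
...     | there z∈zs = there (sublists-⊆ zs∈ z∈zs)

filter-∈-sublists : ∀ {A : Set} {P : A → Set} (P? : ∀ x → Dec (P x)) xs → filter P? xs ∈ sublists xs
filter-∈-sublists P? []       = here refl
filter-∈-sublists P? (x ∷ xs) with P? x
... | yes _ = ∈-++⁺ʳ (sublists xs) (∈-map⁺ (x ∷_) (filter-∈-sublists P? xs))
... | no  _ = ∈-++⁺ˡ (filter-∈-sublists P? xs)

module _ {n : ℕ} where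

  open DecMembership (_≟_ {n}) using (_∈?_; _∉?_)

  top : List (EdgeSet n) → EdgeSet n
  top []      = []
  top (H ∷ _) = H

  ∣∖∣-antitone : ∀ H {D D′} → (∀ {x} → x ∈ H → x ∈ D → x ∈ D′) → length (H ∖ D′) ≤ length (H ∖ D)
  ∣∖∣-antitone H {D} {D′} h = subst₂ _≤_ (sym (∣∖∣≡∑ H D′)) (sym (∣∖∣≡∑ H D))
    (∑-mono H λ {x} x∈ → ⟦⟧-mono (x ∉? D′) (x ∉? D) (_∘ h x∈))

  ∣∖∣-mono : ∀ (H H′ D : EdgeSet n) → Unique H → H ⊆ H′ → length (H ∖ D) ≤ length (H′ ∖ D)
  ∣∖∣-mono H H′ D u H⊆ = subst₂ _≤_ (sym (∣∖∣≡∑ H D)) (sym (∣∖∣≡∑ H′ D)) (∑-unique-⊆ _ u H⊆)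

  ∣∖∣-- : ∀ (H : EdgeSet n) {e} D → Unique H → e ∈ H → e ∉ D → length (H ∖ D) ≡ suc (length ((H - e) ∖ D))
  ∣∖∣-- H {e} D u e∈ e∉ = begin
      length (H ∖ D)                                              ≡⟨ ∣∖∣≡∑ H D ⟩
      ∑ H (λ x → ⟦ x ∉? D ⟧)
          ≡⟨ ∑-cong-set _ u (Unique-resp-↭ p u) (∈-resp-↭ p) (∈-resp-↭ (↭-sym p)) ⟩
      ⟦ e ∉? D ⟧ + ∑ (H - e) (λ x → ⟦ x ∉? D ⟧)
          ≡⟨ cong₂ _+_ (⟦⟧-yes (e ∉? D) e∉) (sym (∣∖∣≡∑ (H - e) D)) ⟩
      suc (length ((H - e) ∖ D))                                  ∎
    where
    open ≡-Reasoning
    p = ↭-∷- u e∈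

  ∣∖∣-∷ : ∀ e H D → length ((e ∷ H) ∖ D) ≤ suc (length (H ∖ D))
  ∣∖∣-∷ e H D = subst₂ (λ a b → a ≤ suc b) (sym (∣∖∣≡∑ (e ∷ H) D)) (sym (∣∖∣≡∑ H D))
      (+-monoˡ-≤ _ (⟦⟧≤1 (e ∉? D)))

  strong-mono : ∀ {K H H′} → Unique H → H ⊆ H′ → Strong K H → Strong K H′
  strong-mono {K} {H} {H′} u H⊆ strong D = ≤-trans (strong D) (+-monoʳ-≤ K (∣∖∣-mono H H′ D u H⊆))

  layer : ℕ → EdgeSet n
  layer l = cartesianProductWith (λ a b → edge a b l) (allFin n) (allFin n)

  completeGraph : ℕ → EdgeSet n
  completeGraph zero    = []
  completeGraph (suc l) = layer l ++ completeGraph l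

  layer-connected : ∀ l → Connected (layer l)
  layer-connected l u v = step (edge u v l)
      (∈-cartesianProductWith⁺ (λ a b → edge a b l) (∈-allFin u) (∈-allFin v))
                            (inj₁ (refl , refl)) []

  completeGraph-unique : ∀ K → Unique (completeGraph K)
  completeGraph-unique zero    = []
  completeGraph-unique (suc l) = Unique.++⁺
      (Unique.cartesianProductWith⁺ (λ a b → edge a b l) (λ { refl → refl , refl }) (Unique.allFin⁺ n)
          (Unique.allFin⁺ n))
      (completeGraph-unique l)
      λ { (p , q) → <-irrefl (in-layer p) (below l q) }
    where
    in-layer : ∀ {l e} → e ∈ layer l → label e ≡ l
    in-layer {l} e∈ with ∈-cartesianProductWith⁻ (λ a b → edge a b l) (allFin n) (allFin n) e∈
    ... | _ , _ , _ , _ , refl = refl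
    below : ∀ K {e} → e ∈ completeGraph K → label e < K
    below (suc l) e∈ with ∈-++⁻ (layer l) e∈
    ... | inj₁ p = s≤s (≤-reflexive (in-layer p))
    ... | inj₂ q = m≤n⇒m≤1+n (below l q)

  -- Each of the `K` disjoint layers is connected and so has at least `κ D - 1` edges outside `D`:
  -- the easy half of the theorem of Nash-Williams and Tutte.
  completeGraph-strong : ∀ K → Strong K (completeGraph K)
  completeGraph-strong zero    D = z≤n
  completeGraph-strong (suc l) D = begin
      κ D + l * κ D
          ≤⟨ +-mono-≤ one (completeGraph-strong l D) ⟩
      suc (length (layer l ∖ D)) + (l + length (completeGraph l ∖ D))
          ≡⟨ +-interchange 1 (length (layer l ∖ D)) l (length (completeGraph l ∖ D)) ⟩
      suc l + (length (layer l ∖ D) + length (completeGraph l ∖ D))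
          ≡⟨ cong (suc l +_) (length-++ (layer l ∖ D)) ⟨
      suc l + length ((layer l ∖ D) ++ (completeGraph l ∖ D))
          ≡⟨ cong (λ xs → suc l + length xs) (filter-++ (_∉? D) (layer l) (completeGraph l)) ⟨
      suc l + length (completeGraph (suc l) ∖ D)                            ∎
    where
    open ≤-Reasoning
    L = layer l ∖ D
    sub : layer l ⊆ L ++ D
    sub {x} x∈ with x ∈? D
    ... | yes x∈D = ∈-++⁺ʳ L x∈D
    ... | no  x∉D = ∈-++⁺ˡ (∈-∖⁺ x∈ x∉D)
    one : κ D ≤ suc (length L)
    one = ≤-trans (κ-++-≥ L D) (≤-trans (+-monoʳ-≤ (length L) (≤-trans (κ-antitone {D = layer l} {L ++ D} sub)
            (connected⇒κ≤1 {D = layer l} (layer-connected l)))) (≤-reflexive (+-comm (length L) 1)))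

  module _ (K : ℕ) where

    Tight : EdgeSet n → EdgeSet n → Set
    Tight H D = K + length (H ∖ D) ≤ K * κ D

    -- `e ∉ D` suffices for crossing: in a strong `H` containing `e`, a tight `D` that connected the
    -- ends of `e` would violate strength once `e` is added to it.
    Critical : EdgeSet n → Edge n → Set
    Critical H e = ∃[ D ] (e ∉ D × Tight H D)

    -- Strength quantifies over all `D`, but intersecting `D` with `H` leaves the edges outside it
    -- unchanged and can only increase `κ`; so finitely many sublists remain to be tested.
    strong? : ∀ H → Strong K H ⊎ ∃[ D ] (D ⊆ H × K + length (H ∖ D) < K * κ D)
    strong? H with All.all? (λ D → K * κ D ≤? K + length (H ∖ D)) (sublists H)
    ... | yes all = inj₁ λ D → begin
          K * κ D                                ≤⟨ *-monoʳ-≤ K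
              (κ-antitone {D = filter (_∈? D) H} {D} (λ x∈ → proj₂ (∈-filter⁻ (_∈? D) {xs = H} x∈))) ⟩
          K * κ (filter (_∈? D) H)               ≤⟨ All.lookup all (filter-∈-sublists (_∈? D) H) ⟩
          K + length (H ∖ filter (_∈? D) H)
              ≤⟨ +-monoʳ-≤ K (∣∖∣-antitone H {D} {filter (_∈? D) H} (∈-filter⁺ (_∈? D))) ⟩
          K + length (H ∖ D)                     ∎
        where open ≤-Reasoning
    ... | no ¬all with find (All.¬All⇒Any¬ (λ D → K * κ D ≤? K + length (H ∖ D)) (sublists H) ¬all)
    ...   | D , D∈ , ≰ = inj₂ (D , sublists-⊆ D∈ , ≰⇒> ≰)

    -- Restoring `e` adds a single crossing edge to a partition that was short of at least one.
    violated⇒critical : ∀ {H e} → Unique H → e ∈ H → ∃[ D ]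
        (D ⊆ H - e × K + length ((H - e) ∖ D) < K * κ D) → Critical H e
    violated⇒critical {H} {e} u e∈ (D , D⊆ , lt) = D , e∉ , (begin
        K + length (H ∖ D)               ≡⟨ cong (K +_) (∣∖∣-- H D u e∈ e∉) ⟩
        K + suc (length ((H - e) ∖ D))   ≡⟨ +-suc K _ ⟩
        suc (K + length ((H - e) ∖ D))   ≤⟨ lt ⟩
        K * κ D                          ∎)
      where
      open ≤-Reasoning
      e∉ : e ∉ D
      e∉ e∈D = e∉D-e {D = H} (D⊆ e∈D)

    -- Uncrossing: tight partitions have a tight common refinement, so that all critical edges cross
    -- a single tight partition (common-tight).
    tight-∩ : ∀ H A B → Strong K H → Tight H A → Tight H B → Tight H (filter (_∈? B) A)
    tight-∩ H A B strong tA tB = +-cancelˡ-≤ (K * κ (A ++ B)) _ _ (begin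
        K * κ (A ++ B) + (K + length (H ∖ I))                          ≤⟨ +-monoˡ-≤ _ (strong (A ++ B)) ⟩
        K + length (H ∖ (A ++ B)) + (K + length (H ∖ I))               ≡⟨ +-interchange K _ K _ ⟩
        K + K + (length (H ∖ (A ++ B)) + length (H ∖ I))               ≡⟨ cong (K + K +_) modular ⟨
        K + K + (length (H ∖ A) + length (H ∖ B))                      ≡⟨ +-interchange K K _ _ ⟩
        K + length (H ∖ A) + (K + length (H ∖ B))                      ≤⟨ +-mono-≤ tA tB ⟩
        K * κ A + K * κ B                                              ≡⟨ *-distribˡ-+ K (κ A) (κ B) ⟨
        K * (κ A + κ B)                                                ≤⟨ *-monoʳ-≤ K (κ-supermodular A B) ⟩
        K * (κ (A ++ B) + κ I)                                         ≡⟨ *-distribˡ-+ K (κ (A ++ B)) (κ I) ⟩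
        K * κ (A ++ B) + K * κ I                                       ∎)
      where
      open ≤-Reasoning
      I = filter (_∈? B) A
      pointwise : ∀ x → ⟦ x ∉? A ⟧ + ⟦ x ∉? B ⟧ ≡ ⟦ x ∉? (A ++ B) ⟧ + ⟦ x ∉? I ⟧
      pointwise x with x ∈? A | x ∈? B
      ... | yes a | yes b = sym
          (cong₂ _+_ (⟦⟧-no (x ∉? (A ++ B)) λ h → h (∈-++⁺ˡ a))
          (⟦⟧-no (x ∉? I) λ h → h (∈-filter⁺ (_∈? B) a b)))
      ... | yes a | no  b = sym
          (cong₂ _+_ (⟦⟧-no (x ∉? (A ++ B)) λ h → h (∈-++⁺ˡ a))
          (⟦⟧-yes (x ∉? I) λ h → b (proj₂ (∈-filter⁻ (_∈? B) {xs = A} h))))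
      ... | no  a | yes b = sym
          (cong₂ _+_ (⟦⟧-no (x ∉? (A ++ B)) λ h → h (∈-++⁺ʳ A b))
          (⟦⟧-yes (x ∉? I) λ h → a (proj₁ (∈-filter⁻ (_∈? B) h))))
      ... | no  a | no  b = sym
          (cong₂ _+_ (⟦⟧-yes (x ∉? (A ++ B)) λ h → case ∈-++⁻ A h of λ { (inj₁ p) → a p ; (inj₂ q) → b q })
          (⟦⟧-yes (x ∉? I) λ h → a (proj₁ (∈-filter⁻ (_∈? B) h))))
      modular : length (H ∖ A) + length (H ∖ B) ≡ length (H ∖ (A ++ B)) + length (H ∖ I)
      modular = trans (cong₂ _+_ (∣∖∣≡∑ H A) (∣∖∣≡∑ H B))
          (trans (sym (∑-+ H _ _)) (trans (∑-cong H λ {x} _ → pointwise x)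
                  (trans (∑-+ H _ _) (sym (cong₂ _+_ (∣∖∣≡∑ H (A ++ B)) (∣∖∣≡∑ H I))))))

    common-tight : ∀ H → Strong K H → ∀ v vs → (∀ {x} → x ∈ v ∷ vs → Critical H x) →
                   ∃[ D ] (Tight H D × (∀ {x} → x ∈ v ∷ vs → x ∉ D))
    common-tight H strong v []       crit with crit (here refl)
    ... | D , v∉ , t = D , t , λ { (here refl) → v∉ }
    common-tight H strong v (w ∷ vs) crit with crit (here refl) | common-tight H strong w vs (crit ∘ there)
    ... | A , v∉ , tA | B , tB , ∉B = filter (_∈? B) A , tight-∩ H A B strong tA tB , λ
          { (here refl) x∈ → v∉ (proj₁ (∈-filter⁻ (_∈? B) x∈))
          ; (there x∈′) x∈ → ∉B x∈′ (proj₂ (∈-filter⁻ (_∈? B) {xs = A} x∈)) }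

    -- H is G together with virtual edges, none of which can be spared.  Hence H = G once G is strong.
    record Reinforced (G H : EdgeSet n) : Set where
      field
        unique   : Unique H
        covers   : G ⊆ H
        strong   : Strong K H
        critical : ∀ {v} → v ∈ H → v ∉ G → Critical H v

    open Reinforced

    reinforced-resp : ∀ {G G′ H} → G ⊆ G′ → G′ ⊆ G → Reinforced G H → Reinforced G′ H
    reinforced-resp p q R = record
      { unique = unique R ; covers = covers R ∘ q ; strong = strong R ; critical = λ v∈ v∉ →
          critical R v∈ (v∉ ∘ p) }

    -- All virtual edges cross one common tight partition, and tightness leaves it at most `K * n`
    -- crossing edges.
    reinforced-size : ∀ {G H} → Reinforced G H → length H ≤ length G + K * n
    reinforced-size {G} {H} R = begin
        length H                       ≤⟨ length-⊆ (unique R) sub ⟩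
        length (G ++ (H ∖ G))          ≡⟨ length-++ G ⟩
        length G + length (H ∖ G)
            ≤⟨ +-monoʳ-≤ (length G) (virtual (H ∖ G) (Unique.filter⁺ (_∉? G) (unique R)) (∈-∖⁻ {D = H})) ⟩
        length G + K * n               ∎
      where
      open ≤-Reasoning
      sub : H ⊆ G ++ (H ∖ G)
      sub {x} x∈ with x ∈? G
      ... | yes x∈G = ∈-++⁺ˡ x∈G
      ... | no  x∉G = ∈-++⁺ʳ G (∈-∖⁺ x∈ x∉G)
      virtual : ∀ vs → Unique vs → (∀ {x} → x ∈ vs → x ∈ H × x ∉ G) → length vs ≤ K * n
      virtual []       _ _ = z≤n
      virtual (v ∷ vs) u h with common-tight H (strong R) v vs (λ x∈ → critical R (proj₁ (h x∈)) (proj₂ (h x∈)))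
      ... | D , t , avoid = begin
        length (v ∷ vs)     ≤⟨ length-⊆ u (λ x∈ → ∈-∖⁺ (proj₁ (h x∈)) (avoid x∈)) ⟩
        length (H ∖ D)      ≤⟨ m≤n+m _ K ⟩
        K + length (H ∖ D)  ≤⟨ t ⟩
        K * κ D             ≤⟨ *-monoʳ-≤ K (κ≤n D) ⟩
        K * n               ∎

    -- A virtual edge would cross a tight partition of `H`; lacking that edge, `G` would have fewer
    -- crossing edges than its strength demands.
    strong⇒reinforced-⊆ : ∀ {G H} → Reinforced G H → Unique G → Strong K G → H ⊆ G
    strong⇒reinforced-⊆ {G} {H} R uG strongG {v} v∈ with v ∈? G
    ... | yes v∈G = v∈G
    ... | no  v∉G with critical R v∈ v∉G
    ...   | D , v∉D , t = contradiction (strongG D) (<⇒≱ (begin-strict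
              K + length (G ∖ D)
                  ≤⟨ +-monoʳ-≤ K (∣∖∣-mono G (H - v) D uG (λ x∈ → ∈--⁺ (covers R x∈) λ { refl → v∉G x∈ })) ⟩
              K + length ((H - v) ∖ D)  <⟨ +-monoʳ-< K ≤-refl ⟩
              K + suc (length ((H - v) ∖ D)) ≡⟨ cong (K +_) (∣∖∣-- H D (unique R) v∈ v∉D) ⟨
              K + length (H ∖ D)        ≤⟨ t ⟩
              K * κ D                   ∎))
            where open ≤-Reasoning

    -- The pair is described by its larger graph and the extra edge, whichever graph comes first: an
    -- insertion is a deletion read backwards, so `changed-greedyLoad` covers both.
    record Adjacent (b : ℕ) (H H′ : EdgeSet n) : Set where
      field
        bigger  : EdgeSet n
        extra   : Edge n
        extra∈  : extra ∈ bigger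
        uniqueᵇ : Unique bigger
        strongᵇ : Strong K bigger
        strongˢ : Strong K (bigger - extra)
        size    : length bigger ≤ b
        sides   : (H ≡ bigger × H′ ≡ bigger - extra) ⊎ (H ≡ bigger - extra × H′ ≡ bigger)

    -- The index `m` is only an upper bound for the number of new graphs, as `stay` allows any `m`.
    data Grows (b : ℕ) : ℕ → List (EdgeSet n) → List (EdgeSet n) → Set where
      stay : ∀ {m hs} → Grows b m hs hs
      grow : ∀ {m hs hs′ H} → Grows b m hs hs′ → Adjacent b (top hs′) H → Grows b (suc m) hs (H ∷ hs′)

    grows-weaken : ∀ {b m hs hs′} k → Grows b m hs hs′ → Grows b (k + m) hs hs′
    grows-weaken k stay = stay
    grows-weaken {b} k (grow {m} {hs} {hs′} {H} g a) = subst (λ m → Grows b m hs (H ∷ hs′)) (sym (+-suc k m))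
        (grow (grows-weaken k g) a)

    grows-trans : ∀ {b m m′ hs hs′ hs″} → Grows b m hs hs′ → Grows b m′ hs′ hs″ → Grows b (m′ + m) hs hs″
    grows-trans {m′ = m′} g stay    = grows-weaken m′ g
    grows-trans g (grow g′ a) = grow (grows-trans g g′) a

    removeEdge : Edge n → List (EdgeSet n) → List (EdgeSet n)
    removeEdge e hs with strong? (top hs - e)
    ... | inj₁ _ = (top hs - e) ∷ hs
    ... | inj₂ _ = hs

    -- Removing one redundant virtual edge after an insertion is enough: a partition that was tight
    -- before and is crossed by all virtual edges has then become tight again.
    relieve : EdgeSet n → List (EdgeSet n) → List (EdgeSet n)
    relieve []       hs = hs
    relieve (v ∷ vs) hs with strong? (top hs - v)
    ... | inj₁ _ = (top hs - v) ∷ hs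
    ... | inj₂ _ = relieve vs hs

    addEdge : EdgeSet n → Edge n → List (EdgeSet n) → List (EdgeSet n)
    addEdge G e hs with e ∈? top hs
    ... | yes _ = hs
    ... | no  _ = relieve (top hs ∖ (e ∷ G)) ((e ∷ top hs) ∷ hs)

    relieve-cases : ∀ vs hs → Unique (top hs) → vs ⊆ top hs →
      (∃[ v ] (v ∈ vs × Strong K (top hs - v) × relieve vs hs ≡ (top hs - v) ∷ hs)) ⊎
      ((∀ {v} → v ∈ vs → Critical (top hs) v) × relieve vs hs ≡ hs)
    relieve-cases []       hs u sub = inj₂ ((λ ()) , refl)
    relieve-cases (v ∷ vs) hs u sub with strong? (top hs - v)
    ... | inj₁ str = inj₁ (v , here refl , str , refl)
    ... | inj₂ viol with relieve-cases vs hs u (sub ∘ there)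
    ...   | inj₁ (x , x∈ , str , eq) = inj₁ (x , there x∈ , str , eq)
    ...   | inj₂ (crit , eq) = inj₂
        ((λ { (here refl) → violated⇒critical u (sub (here refl)) viol ; (there x∈) → crit x∈ }) , eq)

    -- Shrinking `H` never increases the number of crossing edges, so critical edges stay critical.
    -- If `e` cannot be spared it becomes virtual, and the partition violated without it shows that
    -- it is critical.
    removeEdge-reinforced : ∀ {G e b} hs → Reinforced G (top hs) → e ∈ G → length G + K * n ≤ b →
      Grows b 1 hs (removeEdge e hs) × Reinforced (G - e) (top (removeEdge e hs))
    removeEdge-reinforced {G} {e} {b} hs R e∈ G≤ with strong? (top hs - e)
    ... | inj₁ str = grow stay record
            { bigger = top hs ; extra = e ; extra∈ = covers R e∈ ; uniqueᵇ = unique R ; strongᵇ = strong R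
            ; strongˢ = str ; size = ≤-trans (reinforced-size R) G≤ ; sides = inj₁ (refl , refl) }
          , record
            { unique   = -‿unique e (unique R)
            ; covers   = λ x∈ → case ∈--⁻ {D = G} x∈ of λ { (x∈G , x≢e) → ∈--⁺ (covers R x∈G) x≢e }
            ; strong   = str
            ; critical = λ v∈ v∉ → case ∈--⁻ {D = top hs} v∈ of λ { (v∈H , v≢e) →
                case critical R v∈H (λ v∈G → v∉ (∈--⁺ v∈G v≢e)) of λ { (D , v∉D , t) →
                  D , v∉D , ≤-trans
                      (+-monoʳ-≤ K (∣∖∣-mono (top hs - e) (top hs) D (-‿unique e (unique R))
                      (proj₁ ∘ ∈--⁻ {D = top hs}))) t } }
            }
    ... | inj₂ viol = stay , record
            { unique   = unique R
            ; covers   = covers R ∘ proj₁ ∘ ∈--⁻ {D = G}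
            ; strong   = strong R
            ; critical = λ {v} v∈ v∉ → case v ≟ e of λ
                { (yes refl) → violated⇒critical (unique R) v∈ viol
                ; (no v≢e)   → critical R v∈ λ v∈G → v∉ (∈--⁺ v∈G v≢e) }
            }

    addEdge-reinforced : ∀ {G e b} hs → Reinforced G (top hs) → e ∉ G → suc (length G) + K * n ≤ b →
      Grows b 2 hs (addEdge G e hs) × Reinforced (e ∷ G) (top (addEdge G e hs))
    addEdge-reinforced {G} {e} {b} hs R e∉G G≤ with e ∈? top hs
    -- A virtual edge turns real without any change to `H`.
    ... | yes e∈ = stay , record
            { unique = unique R ; strong = strong R
            ; covers = λ { (here refl) → e∈ ; (there x∈) → covers R x∈ }
            ; critical = λ v∈ v∉ → critical R v∈ (v∉ ∘ there) }
    ... | no e∉ with relieve-cases vs (H′ ∷ hs) uH′ vs⊆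
      where
      H  = top hs
      H′ = e ∷ H
      vs = H ∖ (e ∷ G)
      uH′ : Unique H′
      uH′ = All.¬Any⇒All¬ _ e∉ ∷ unique R
      vs⊆ : vs ⊆ H′
      vs⊆ = there ∘ proj₁ ∘ ∈-∖⁻ {D = H}
    ...   | result = finish result
      where
      H  = top hs
      H′ = e ∷ H
      vs = H ∖ (e ∷ G)
      uH′ : Unique H′
      uH′ = All.¬Any⇒All¬ _ e∉ ∷ unique R
      strongH′ : Strong K H′
      strongH′ = strong-mono {H = H} {H′} (unique R) there (strong R)
      H′-e : H′ - e ≡ H
      H′-e = trans (filter-reject (_∉? (e ∷ [])) (λ h → h (here refl))) (∉⇒- e∉)
      H′≤ : length H′ ≤ b
      H′≤ = ≤-trans (s≤s (reinforced-size R)) G≤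
      ∈vs : ∀ {x} → x ∈ H′ → x ∉ e ∷ G → x ∈ vs
      ∈vs (here refl) x∉ = contradiction (here refl) x∉
      ∈vs (there x∈)  x∉ = ∈-∖⁺ x∈ x∉
      adjacent : Adjacent b H H′
      adjacent = record { bigger = H′ ; extra = e ; extra∈ = here refl ; uniqueᵇ = uH′ ; strongᵇ = strongH′
        ; strongˢ = subst (Strong K) (sym H′-e) (strong R) ; size = H′≤ ; sides = inj₂ (sym H′-e , refl) }
      covers′ : e ∷ G ⊆ H′
      covers′ (here refl) = here refl
      covers′ (there x∈)  = there (covers R x∈)
      critical-vs : ∀ {x} → x ∈ vs → Critical H x
      critical-vs x∈ with ∈-∖⁻ {D = H} x∈
      ... | x∈H , x∉ = critical R x∈H (x∉ ∘ there)
      -- For the common tight partition, `e` adds at most one crossing edge and `v` takes one away.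
      after-removal : ∀ {v} ws → v ∈ ws → ws ⊆ vs → (∀ {x} → x ∈ vs → x ∈ ws) → ∃[ D ]
          (Tight (H′ - v) D × (∀ {x} → x ∈ vs → x ∉ D))
      after-removal {v} (w ∷ ws) v∈ sub sup with common-tight H (strong R) w ws (critical-vs ∘ sub)
      ... | D , t , avoid = D , (begin
            K + length ((H′ - v) ∖ D)
                ≤⟨ +-monoʳ-≤ K
                (s≤s⁻¹ (≤-trans
                (≤-reflexive (sym (∣∖∣-- H′ D uH′ (there {x = e} (proj₁ (∈-∖⁻ {D = H} (sub v∈)))) (avoid v∈))))
                (∣∖∣-∷ e H D))) ⟩
            K + length (H ∖ D)         ≤⟨ t ⟩
            K * κ D                    ∎) , avoid ∘ sup
        where open ≤-Reasoning
      finish : (∃[ v ] (v ∈ vs × Strong K (H′ - v) × relieve vs (H′ ∷ hs) ≡ (H′ - v) ∷ H′ ∷ hs)) ⊎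
               ((∀ {v} → v ∈ vs → Critical H′ v) × relieve vs (H′ ∷ hs) ≡ H′ ∷ hs) →
               Grows b 2 hs (relieve vs (H′ ∷ hs)) × Reinforced (e ∷ G) (top (relieve vs (H′ ∷ hs)))
      finish (inj₂ (crit , eq)) rewrite eq = grow stay adjacent , record
        { unique   = uH′
        ; covers   = covers′
        ; strong   = strongH′
        ; critical = λ v∈ v∉ → crit (∈vs v∈ v∉) }
      finish (inj₁ (v , v∈ , str , eq)) rewrite eq with after-removal vs v∈ id id | ∈-∖⁻ {D = H} v∈
      ... | D , t , avoid | v∈H , v∉G =
        grow (grow stay adjacent) record
          { bigger = H′ ; extra = v ; extra∈ = there v∈H ; uniqueᵇ = uH′ ; strongᵇ = strongH′ ; strongˢ = str
          ; size = H′≤ ; sides = inj₁ (refl , refl) }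
        , record
          { unique   = -‿unique v uH′
          ; covers   = λ {x} x∈ → ∈--⁺ {D = H′} {v} {x} (covers′ x∈) λ { refl → v∉G x∈ }
          ; strong   = str
          ; critical = λ x∈ x∉ → D , avoid (∈vs (proj₁ (∈--⁻ {D = H′} x∈)) x∉) , t }

-- The kept graph and the history of the packed graphs

module _ {A : Set} where

  drop-⊆ : ∀ k (xs : List A) → dropˡ k xs ⊆ xs
  drop-⊆ zero    xs       = id
  drop-⊆ (suc k) (x ∷ xs) = there ∘ drop-⊆ k xs

  drop-antitone : ∀ {k l} (xs : List A) → k ≤ l → dropˡ l xs ⊆ dropˡ k xs
  drop-antitone {l = l} xs       z≤n     = drop-⊆ l xs
  drop-antitone         (x ∷ xs) (s≤s p) = drop-antitone xs p

  drop-filter-⊆ : ∀ {P : A → Set} (P? : ∀ x → Dec (P x)) k xs → dropˡ k (filter P? xs) ⊆ dropˡ k xs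
  drop-filter-⊆ P? zero    xs       = ⊆.filter-⊆ P? xs
  drop-filter-⊆ P? (suc k) (x ∷ xs) with P? x
  ... | yes _ = drop-filter-⊆ P? k xs
  ... | no  _ = drop-filter-⊆ P? k xs ∘ drop-antitone (filter P? xs) (n≤1+n k)

module _ {n : ℕ} where

  open DecMembership (_≟_ {n}) using (_∈?_; _∉?_)

  ∖-empty : ∀ {A B : EdgeSet n} → A ⊆ B → length (A ∖ B) ≡ 0
  ∖-empty {A} {B} A⊆ = trans (∣∖∣≡∑ A B) (∑-zero A λ {x} x∈ → ⟦⟧-no (x ∉? B) λ x∉ → x∉ (A⊆ x∈))

  length-nested : ∀ {A B : EdgeSet n} → Unique A → Unique B → A ⊆ B → length (B ∖ A) + length A ≤ length B
  length-nested {A} {B} uA uB A⊆ = ≤-trans (≤-reflexive (sym (length-++ (B ∖ A))))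
    (length-⊆ (Unique.++⁺ (Unique.filter⁺ (_∉? A) uB) uA λ { (p , q) → proj₂ (∈-∖⁻ {D = B} p) q })
      λ x∈ → case ∈-++⁻ (B ∖ A) x∈ of λ { (inj₁ p) → proj₁ (∈-∖⁻ {D = B} p) ; (inj₂ q) → A⊆ q })

  apply-unique : ∀ {u} {G : EdgeSet n} → Applicable u G → Unique G → Unique (apply u G)
  apply-unique {insert e} e∉ uG = All.¬Any⇒All¬ _ e∉ ∷ uG
  apply-unique {delete e} e∈ uG = -‿unique e uG

  current-unique : ∀ {G₀ : EdgeSet n} us → IsDynamic G₀ us → Unique (current G₀ us)
  current-unique []       dyn         = dyn
  current-unique (u ∷ us) (app , dyn) = apply-unique {u} app (current-unique us dyn)

  -- Equal to G as soon as G has enough edges to be connected, and empty, hence unaffected by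
  -- updates, while G has less than half as many edges.
  kept : EdgeSet n → EdgeSet n
  kept G = dropˡ ((n ∸ 1) ∸ length G) G

  kept-unique : ∀ {G} → Unique G → Unique (kept G)
  kept-unique {G} = Unique.drop⁺ ((n ∸ 1) ∸ length G)

  length-kept : ∀ G → length (kept G) ≡ length G ∸ ((n ∸ 1) ∸ length G)
  length-kept G = length-drop ((n ∸ 1) ∸ length G) G

  length-kept≤ : ∀ G → length (kept G) ≤ length G
  length-kept≤ G = ≤-trans (≤-reflexive (length-kept G)) (m∸n≤m (length G) ((n ∸ 1) ∸ length G))

  connected⇒kept≡ : ∀ {G} → Connected G → kept G ≡ G
  connected⇒kept≡ {G} con = cong (λ k → dropˡ k G)
      (m≤n⇒m∸n≡0 (∸-monoˡ-≤ 1 (≤-trans (n≤κ+length G) (+-monoˡ-≤ (length G) (connected⇒κ≤1 {D = G} con)))))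

  kept-nonempty⇒n≤ : ∀ {G} → 1 ≤ length (kept G) → n ≤ length G + length G
  kept-nonempty⇒n≤ {G} 1≤ with n ≤? length G + length G
  ... | yes n≤ = n≤
  ... | no  n≰ = contradiction 1≤ (<⇒≱ (s≤s (≤-reflexive (trans (length-kept G) (m≤n⇒m∸n≡0 (begin
      length G                           ≡⟨ m+n∸n≡m (length G) (length G) ⟨
      length G + length G ∸ length G     ≤⟨ ∸-monoˡ-≤ (length G) (∸-monoˡ-≤ 1 (≰⇒> n≰)) ⟩
      n ∸ 1 ∸ length G                   ∎))))))
    where open ≤-Reasoning

  -- `m ∸ (N ∸ m)` is `2 m - N` cut off to the range from 0 to `m`, and with `N = n - 1` the size of
  -- the kept graph; the 2 is the double speed of catching up.
  size-step : ∀ m N → suc m ∸ (N ∸ suc m) ≤ 2 + (m ∸ (N ∸ m))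
  size-step m N = begin
      suc m ∸ (N ∸ suc m)            ≤⟨ shift₂ m (N ∸ suc m) ⟩
      2 + (m ∸ suc (N ∸ suc m))      ≤⟨ +-monoʳ-≤ 2 (∸-monoʳ-≤ m (gap N m)) ⟩
      2 + (m ∸ (N ∸ m))              ∎
    where
    open ≤-Reasoning
    shift₂ : ∀ m x → suc m ∸ x ≤ 2 + (m ∸ suc x)
    shift₂ m       zero    = ≤-trans (s≤s (m≤n+m∸n m 1)) ≤-refl
    shift₂ zero    (suc x) = ≤-trans (≤-reflexive (0∸n≡0 x)) z≤n
    shift₂ (suc m) (suc x) = shift₂ m x
    gap : ∀ N m → N ∸ m ≤ suc (N ∸ suc m)
    gap zero    m       = ≤-trans (≤-reflexive (0∸n≡0 m)) z≤n
    gap (suc N) zero    = ≤-refl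
    gap (suc N) (suc m) = gap N m

  kept-nested : ∀ {A B : EdgeSet n} → Unique A → Unique B → kept A ⊆ kept B → length B ≡ suc (length A) →
                length (kept B ∖ kept A) ≤ 2 × length (kept A ∖ kept B) ≡ 0
  kept-nested {A} {B} uA uB sub eq = +-cancelʳ-≤ (length (kept A)) _ _ (begin
      length (kept B ∖ kept A) + length (kept A)   ≤⟨ length-nested (kept-unique uA) (kept-unique uB) sub ⟩
      length (kept B)
          ≡⟨ trans (length-kept B) (cong (λ m → m ∸ ((n ∸ 1) ∸ m)) eq) ⟩
      suc (length A) ∸ ((n ∸ 1) ∸ suc (length A))  ≤⟨ size-step (length A) (n ∸ 1) ⟩
      2 + (length A ∸ ((n ∸ 1) ∸ length A))        ≡⟨ cong (2 +_) (length-kept A) ⟨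
      2 + length (kept A)                          ∎) , ∖-empty sub
    where open ≤-Reasoning

  kept-∷-⊆ : ∀ e G → kept G ⊆ kept (e ∷ G)
  kept-∷-⊆ e G = drop-antitone {k = (n ∸ 1) ∸ suc (length G)} {l = suc ((n ∸ 1) ∸ length G)} (e ∷ G)
    (≤-trans (∸-monoʳ-≤ (n ∸ 1) (n≤1+n (length G))) (n≤1+n _))

  kept---⊆ : ∀ e G → kept (G - e) ⊆ kept G
  kept---⊆ e G = drop-filter-⊆ (_∉? (e ∷ [])) ((n ∸ 1) ∸ length G) G ∘
    drop-antitone (G - e) (∸-monoʳ-≤ (n ∸ 1) (length-filter (_∉? (e ∷ [])) G))

  kept-step : ∀ {u G} → Unique G → Applicable u G →
              length (kept (apply u G) ∖ kept G) ≤ 2 × length (kept G ∖ kept (apply u G)) ≤ 2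
            × length G ≤ suc (length (apply u G))
  kept-step {insert e} {G} uG e∉ with kept-nested uG (apply-unique {insert e} e∉ uG) (kept-∷-⊆ e G) refl
  ... | p , q = p , ≤-trans (≤-reflexive q) z≤n , ≤-trans (n≤1+n _) (n≤1+n _)
  kept-step {delete e} {G} uG e∈ with kept-nested (-‿unique e uG) uG (kept---⊆ e G) (length-- uG e∈)
  ... | p , q = ≤-trans (≤-reflexive q) z≤n , p , ≤-reflexive (length-- uG e∈)

  module _ (K : ℕ) where

    removeAll : EdgeSet n → List (EdgeSet n) → List (EdgeSet n)
    removeAll []       hs = hs
    removeAll (e ∷ es) hs = removeAll es (removeEdge K e hs)

    addAll : EdgeSet n → EdgeSet n → List (EdgeSet n) → List (EdgeSet n)
    addAll G []       hs = hs
    addAll G (e ∷ es) hs = addAll (e ∷ G) es (addEdge K G e hs)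

    sync : EdgeSet n → EdgeSet n → List (EdgeSet n) → List (EdgeSet n)
    sync G G′ hs = addAll (G ∖ (G ∖ G′)) (G′ ∖ G) (removeAll (G ∖ G′) hs)

    removeAll-reinforced : ∀ {G b} es hs → Unique es → es ⊆ G → Reinforced K G (top hs) → length G + K * n ≤ b →
      Grows K b (length es) hs (removeAll es hs) × Reinforced K (G ∖ es) (top (removeAll es hs))
    removeAll-reinforced {G} []       hs _        _  R G≤ = stay , reinforced-resp K (λ x∈ → ∈-∖⁺ x∈ λ ())
        (proj₁ ∘ ∈-∖⁻ {D = G}) R
    removeAll-reinforced {G} {b} (e ∷ es) hs (e∉ ∷ u) sub R G≤ with removeEdge-reinforced K hs R
        (sub (here refl)) G≤
    ... | g , R′ with removeAll-reinforced es (removeEdge K e hs) u es⊆ R′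
        (≤-trans (+-monoˡ-≤ (K * n) (length-filter (_∉? (e ∷ [])) G)) G≤)
      where
      es⊆ : es ⊆ G - e
      es⊆ x∈ = ∈--⁺ (sub (there x∈)) λ { refl → All.All¬⇒¬Any e∉ x∈ }
    ...   | g′ , R″ = subst (λ m → Grows K b m hs (removeAll es (removeEdge K e hs))) (+-comm (length es) 1)
        (grows-trans K g g′)
                    , reinforced-resp K to from R″
      where
      to : (G - e) ∖ es ⊆ G ∖ (e ∷ es)
      to x∈ with ∈-∖⁻ {D = G - e} x∈
      ... | x∈- , x∉ with ∈--⁻ {D = G} x∈-
      ...   | x∈G , x≢e = ∈-∖⁺ x∈G λ { (here x≡e) → x≢e x≡e ; (there p) → x∉ p }
      from : G ∖ (e ∷ es) ⊆ (G - e) ∖ es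
      from x∈ with ∈-∖⁻ {D = G} x∈
      ... | x∈G , x∉ = ∈-∖⁺ (∈--⁺ x∈G (x∉ ∘ here)) (x∉ ∘ there)

    addAll-reinforced : ∀ {G b} es hs → Unique es → (∀ {x} → x ∈ es → x ∉ G) → Reinforced K G (top hs) →
      length es + length G + K * n ≤ b →
      Grows K b (length es * 2) hs (addAll G es hs) × Reinforced K (es ++ G) (top (addAll G es hs))
    addAll-reinforced     []       hs _        _   R _  = stay , R
    addAll-reinforced {G} {b} (e ∷ es) hs (e∉ ∷ u) new R le
      with addEdge-reinforced K hs R (new (here refl))
          (≤-trans (+-monoˡ-≤ (K * n) (s≤s (m≤n+m (length G) (length es)))) le)
    ... | g , R′ with addAll-reinforced {e ∷ G} es (addEdge K G e hs) u
                        (λ { x∈ (here refl) → All.All¬⇒¬Any e∉ x∈ ; x∈ (there x∈G) → new (there x∈) x∈G }) R′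
                        (≤-trans (≤-reflexive (cong (_+ K * n) (+-suc (length es) (length G)))) le)
    ...   | g′ , R″ = subst (λ m → Grows K b m hs (addAll (e ∷ G) es (addEdge K G e hs)))
        (+-comm (length es * 2) 2) (grows-trans K g g′)
                    , reinforced-resp K
                        (λ x∈ → case ∈-++⁻ es x∈ of
                            λ { (inj₁ p) → there (∈-++⁺ˡ p) ; (inj₂ (here refl)) → here refl ; (inj₂ (there q))
                            → there (∈-++⁺ʳ es q) })
                        (λ { (here refl) → ∈-++⁺ʳ es (here refl) ; (there x∈) → case ∈-++⁻ es x∈ of
                            λ { (inj₁ p) → ∈-++⁺ˡ p ; (inj₂ q) → ∈-++⁺ʳ es (there q) } })
                        R″

    -- A removal costs at most one new graph, an insertion at most two, because a virtual edge may
    -- be relieved as well.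
    sync-reinforced : ∀ {G G′ b} hs → Unique G → Unique G′ → Reinforced K G (top hs) → length G + length
        G′ + K * n ≤ b →
      Grows K b (length (G′ ∖ G) * 2 + length (G ∖ G′)) hs (sync G G′ hs) × Reinforced K G′ (top (sync G G′ hs))
    sync-reinforced {G} {G′} {b} hs uG uG′ R le
      with removeAll-reinforced (G ∖ G′) hs (Unique.filter⁺ (_∉? G′) uG) (proj₁ ∘ ∈-∖⁻ {D = G}) R
             (≤-trans (+-monoˡ-≤ (K * n) (m≤m+n (length G) (length G′))) le)
    ... | g , R′ with addAll-reinforced (G′ ∖ G) (removeAll (G ∖ G′) hs) (Unique.filter⁺ (_∉? G) uG′)
                        (λ x∈ x∈′ → proj₂ (∈-∖⁻ {D = G′} x∈) (proj₁ (∈-∖⁻ {D = G} x∈′))) R′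
                        (≤-trans (+-monoˡ-≤ (K * n)
                            (≤-trans (+-mono-≤ (length-filter (_∉? G) G′) (length-filter (_∉? (G ∖ G′)) G))
                            (≤-reflexive (+-comm (length G′) (length G))))) le)
    ...   | g′ , R″ = grows-trans K g g′ , reinforced-resp K to from R″
      where
      to : (G′ ∖ G) ++ (G ∖ (G ∖ G′)) ⊆ G′
      to {x} x∈ with ∈-++⁻ (G′ ∖ G) x∈
      ... | inj₁ p = proj₁ (∈-∖⁻ {D = G′} p)
      ... | inj₂ q with x ∈? G′ | ∈-∖⁻ {D = G} q
      ...   | yes x∈G′ | _ = x∈G′
      ...   | no  x∉G′ | x∈G , x∉ = contradiction (∈-∖⁺ x∈G x∉G′) x∉
      from : G′ ⊆ (G′ ∖ G) ++ (G ∖ (G ∖ G′))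
      from {x} x∈ with x ∈? G
      ... | yes x∈G = ∈-++⁺ʳ (G′ ∖ G) (∈-∖⁺ x∈G λ p → proj₂ (∈-∖⁻ {D = G} p) x∈)
      ... | no  x∉G = ∈-++⁺ˡ (∈-∖⁺ x∈ x∉G)

    -- A strong starting point that is reinforced because it has no virtual edges. `sync` then
    -- deletes everything outside the kept graph, which turns into virtual edges those that strength
    -- cannot spare.
    initialGraph : EdgeSet n → EdgeSet n
    initialGraph G = completeGraph K ++ (G ∖ completeGraph K)

    sync-empty : ∀ G G′ {hs} → length G + length G′ ≡ 0 → sync G G′ hs ≡ hs
    sync-empty [] [] _ = refl

    -- All graphs the packing has been on, most recent first.
    history : EdgeSet n → List (Update n) → List (EdgeSet n)
    history G₀ []       = sync (initialGraph (kept G₀)) (kept G₀) (initialGraph (kept G₀) ∷ [])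
    history G₀ (u ∷ us) = sync (kept (current G₀ us)) (kept (current G₀ (u ∷ us))) (history G₀ us)

    initialGraph-unique : ∀ {G} → Unique G → Unique (initialGraph G)
    initialGraph-unique {G} uG = Unique.++⁺ (completeGraph-unique K) (Unique.filter⁺ (_∉? completeGraph K) uG)
      λ { (p , q) → proj₂ (∈-∖⁻ {D = G} q) p }

    initialGraph-reinforced : ∀ {G} → Unique G → Reinforced K (initialGraph G) (initialGraph G)
    initialGraph-reinforced {G} uG = record
      { unique = initialGraph-unique uG ; covers = id
      ; strong = strong-mono {H = completeGraph K} {initialGraph G} (completeGraph-unique K) ∈-++⁺ˡ
          (completeGraph-strong K)
      ; critical = λ v∈ v∉ → contradiction v∈ v∉ }

    history-reinforced : ∀ {G₀} us → IsDynamic G₀ us → Reinforced K (kept (current G₀ us)) (top (history G₀ us))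
    history-reinforced {G₀} [] dyn = proj₂
        (sync-reinforced (initialGraph (kept G₀) ∷ []) (initialGraph-unique uG) uG
        (initialGraph-reinforced uG) ≤-refl)
      where
      uG : Unique (kept G₀)
      uG = kept-unique dyn
    history-reinforced (u ∷ us) (app , dyn) = proj₂
        (sync-reinforced (history _ us) (kept-unique (current-unique us dyn))
      (kept-unique (apply-unique {u} app (current-unique us dyn))) (history-reinforced us dyn) ≤-refl)

    -- The size bound is demanded only for `n ≤ 2 * suc m`: otherwise both kept graphs are empty and
    -- the history stays as it is. The 6 is `2 * 2 + 2`, for at most two insertions and at most two
    -- deletions in the kept graph.
    history-grows : ∀ {G₀ b} u us → IsDynamic G₀ (u ∷ us) →
      let m = length (current G₀ (u ∷ us)) in
      (n ≤ 2 * suc m → suc m + m + K * n ≤ b) →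
      Grows K b 6 (history G₀ us) (history G₀ (u ∷ us))
    history-grows {G₀} {b} u us (app , dyn) b≥ with 1 ≤? length (kept G) + length (kept G′)
      where
      G  = current G₀ us
      G′ = current G₀ (u ∷ us)
    ... | no  ≰1 = subst (Grows K b 6 (history G₀ us))
        (sym (sync-empty (kept (current G₀ us)) (kept (current G₀ (u ∷ us))) (n<1⇒n≡0 (≰⇒> ≰1)))) stay
    ... | yes 1≤ = subst (λ m → Grows K b m (history G₀ us) (history G₀ (u ∷ us))) (m∸n+n≡m changes≤6)
                     (grows-weaken K (6 ∸ (length (kept G′ ∖ kept G) * 2 + length (kept G ∖ kept G′)))
                       (proj₁ (sync-reinforced (history G₀ us) (kept-unique uG) (kept-unique uG′)
                           (history-reinforced us dyn)
                         (≤-trans (+-monoˡ-≤ (K * n)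
                             (+-mono-≤ (≤-trans (length-kept≤ G) G≤) (length-kept≤ G′))) (b≥ n≤)))))
      where
      G  = current G₀ us
      G′ = current G₀ (u ∷ us)
      uG : Unique G
      uG = current-unique us dyn
      uG′ : Unique G′
      uG′ = apply-unique {u} app uG
      G≤ : length G ≤ suc (length G′)
      G≤ = proj₂ (proj₂ (kept-step {u} uG app))
      changes≤6 : length (kept G′ ∖ kept G) * 2 + length (kept G ∖ kept G′) ≤ 6
      changes≤6 = +-mono-≤ (*-monoˡ-≤ 2 (proj₁ (kept-step {u} uG app))) (proj₁ (proj₂ (kept-step {u} uG app)))
      n≤ : n ≤ 2 * suc (length G′)
      n≤ with 1 ≤? length (kept G)
      ... | yes 1≤G = ≤-trans (kept-nonempty⇒n≤ {G} 1≤G)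
          (+-mono-≤ G≤ (≤-trans G≤ (≤-reflexive (sym (+-identityʳ _)))))
      ... | no  1≰G = ≤-trans
          (kept-nonempty⇒n≤ {G′} (subst (λ m → 1 ≤ m + length (kept G′)) (n<1⇒n≡0 (≰⇒> 1≰G)) 1≤))
                        (+-mono-≤ (n≤1+n _) (≤-trans (n≤1+n _) (≤-reflexive (sym (+-identityʳ _)))))

-- Runs of the spanning tree algorithm

module _ {n : ℕ} where

  open DecMembership (_≟_ {n}) using (_∈?_; _∉?_)

  ↭-unique : ∀ {A B : EdgeSet n} → Unique A → Unique B → A ⊆ B → B ⊆ A → A ↭ B
  ↭-unique {[]} {[]}    _ _ _ _ = ↭-refl
  ↭-unique {[]} {_ ∷ _} _ _ _ q = contradiction (q (here refl)) λ ()
  ↭-unique {x ∷ A} {B} (x∉ ∷ uA) uB p q = ↭-trans (prep x (↭-unique uA (-‿unique x uB) p′ q′))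
      (↭-sym (↭-∷- uB (p (here refl))))
    where
    p′ : A ⊆ B - x
    p′ y∈ = ∈--⁺ (p (there y∈)) λ { refl → All.All¬⇒¬Any x∉ y∈ }
    q′ : B - x ⊆ A
    q′ y∈ with ∈--⁻ {D = B} y∈
    ... | y∈B , y≢x with q y∈B
    ...   | here y≡x  = contradiction y≡x y≢x
    ...   | there y∈A = y∈A

  edges-unique : ∀ (h : Run n) → IsRun h → Unique (edges h)
  edges-unique h = current-unique (map forget h)

  deletes : EdgeSet n → Run n
  deletes = map WUpdate.delete

  inserts : (Edge n → ℚ) → EdgeSet n → Run n
  inserts w = map λ e → insert e (w e)

  weight-deletes : ∀ D (h : Run n) e → weight (deletes D ++ h) e ≡ weight h e
  weight-deletes []      h e = refl
  weight-deletes (_ ∷ D) h e = weight-deletes D h e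

  ∈-edges-deletes⁻ : ∀ D {h : Run n} {e} → e ∈ edges (deletes D ++ h) → e ∈ edges h × e ∉ D
  ∈-edges-deletes⁻ []      e∈ = e∈ , λ ()
  ∈-edges-deletes⁻ (d ∷ D) {h} e∈ with ∈--⁻ {D = edges (deletes D ++ h)} e∈
  ... | e∈′ , e≢d with ∈-edges-deletes⁻ D {h} e∈′
  ...   | e∈h , e∉D = e∈h , λ { (here e≡d) → e≢d e≡d ; (there e∈D) → e∉D e∈D }

  ∈-edges-deletes⁺ : ∀ D {h : Run n} {e} → e ∈ edges h → e ∉ D → e ∈ edges (deletes D ++ h)
  ∈-edges-deletes⁺ []      e∈ _  = e∈
  ∈-edges-deletes⁺ (d ∷ D) e∈ e∉ = ∈--⁺ (∈-edges-deletes⁺ D e∈ (e∉ ∘ there)) λ { refl → e∉ (here refl) }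

  isRun-deletes : ∀ {D} (h : Run n) → Unique D → D ⊆ edges h → IsRun h → IsRun (deletes D ++ h)
  isRun-deletes {[]}    h _        _   run = run
  isRun-deletes {d ∷ D} h (d∉ ∷ u) sub run = ∈-edges-deletes⁺ D {h} (sub (here refl)) (All.All¬⇒¬Any d∉) ,
      isRun-deletes h u (sub ∘ there) run

  edges-inserts : ∀ w I (h : Run n) → edges (inserts w I ++ h) ≡ I ++ edges h
  edges-inserts w []      h = refl
  edges-inserts w (e ∷ I) h = cong (e ∷_) (edges-inserts w I h)

  isRun-inserts : ∀ w {I} (h : Run n) → Unique I → (∀ {e} → e ∈ I → e ∉ edges h) → IsRun h → IsRun
      (inserts w I ++ h)
  isRun-inserts w {[]}    h _        _   run = run
  isRun-inserts w {e ∷ I} h (e∉ ∷ u) new run =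
      (λ e∈ → case ∈-++⁻ I (subst (e ∈_) (edges-inserts w I h) e∈) of
          λ { (inj₁ p) → All.All¬⇒¬Any e∉ p ; (inj₂ q) → new (here refl) q })
    , isRun-inserts w h u (new ∘ there) run

  weight-inserts : ∀ w I (h : Run n) {e} → e ∈ I ⊎ weight h e ≡ w e → weight (inserts w I ++ h) e ≡ w e
  weight-inserts w []      h (inj₂ eq) = eq
  weight-inserts w (f ∷ I) h {e} e∈ with e ≟ f | e∈
  ... | yes refl | _                 = refl
  ... | no  e≢f  | inj₁ (here e≡f)   = contradiction e≡f e≢f
  ... | no  e≢f  | inj₁ (there e∈I)  = weight-inserts w I h (inj₁ e∈I)
  ... | no  e≢f  | inj₂ eq           = weight-inserts w I h (inj₂ eq)

  record RunFor (H : EdgeSet n) (w : Edge n → ℚ) (h : Run n) : Set where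
    field
      isRun     : IsRun h
      sameEdges : edges h ↭ H
      weights   : ∀ {e} → e ∈ H → weight h e ≡ w e

  module _ (H : EdgeSet n) (w : Edge n → ℚ) (h : Run n) where

    upToDate? : ∀ e → Dec (e ∈ H × weight h e ≡ w e)
    upToDate? e = (e ∈? H) ×-dec (weight h e ℚ.≟ w e)

    -- Reweighting means deleting and reinserting, so a reweighted edge is both stale and fresh.
    -- `fresh` also tests presence, because `weight` remembers the weights of deleted edges.
    stale fresh : EdgeSet n
    stale = filter (¬? ∘ upToDate?) (edges h)
    fresh = filter (λ e → ¬? ((e ∈? edges h) ×-dec upToDate? e)) H

    -- As runs have the most recent update first, the deletions are processed before the insertions.
    updatesTo : Run n
    updatesTo = inserts w fresh ++ deletes stale

    ∈-stale⁻ : ∀ {e} → e ∈ stale → e ∈ edges h × ¬ (e ∈ H × weight h e ≡ w e)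
    ∈-stale⁻ = ∈-filter⁻ (¬? ∘ upToDate?) {xs = edges h}

    ∈-fresh⁻ : ∀ {e} → e ∈ fresh → e ∈ H × ¬ (e ∈ edges h × e ∈ H × weight h e ≡ w e)
    ∈-fresh⁻ = ∈-filter⁻ (λ e → ¬? ((e ∈? edges h) ×-dec upToDate? e)) {xs = H}

    updatesTo-correct : Unique H → IsRun h → RunFor H w (updatesTo ++ h)
    updatesTo-correct uH run = record
        { isRun     = run-all
        ; sameEdges = ↭-unique (edges-unique (updatesTo ++ h) run-all) uH to from
        ; weights   = λ {e} e∈ → trans (cong (λ h → weight h e) assoc)
            (weight-inserts w fresh (deletes stale ++ h) (updated e∈))
        }
      where
      assoc : updatesTo ++ h ≡ inserts w fresh ++ (deletes stale ++ h)
      assoc = ++-assoc (inserts w fresh) (deletes stale) h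
      remaining : ∀ {e} → e ∈ edges (deletes stale ++ h) → e ∈ edges h × e ∈ H × weight h e ≡ w e
      remaining {e} e∈ with ∈-edges-deletes⁻ stale {h} e∈
      ... | e∈h , e∉ with upToDate? e
      ...   | yes ok = e∈h , ok
      ...   | no ¬ok = contradiction (∈-filter⁺ (¬? ∘ upToDate?) e∈h ¬ok) e∉
      run-all : IsRun (updatesTo ++ h)
      run-all = subst IsRun (sym assoc) (isRun-inserts w (deletes stale ++ h) (Unique.filter⁺ _ uH)
        (λ e∈ e∈′ → proj₂ (∈-fresh⁻ e∈) (remaining e∈′))
        (isRun-deletes h (Unique.filter⁺ (¬? ∘ upToDate?) (edges-unique h run)) (proj₁ ∘ ∈-stale⁻) run))
      edges-all : edges (updatesTo ++ h) ≡ fresh ++ edges (deletes stale ++ h)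
      edges-all = trans (cong edges assoc) (edges-inserts w fresh (deletes stale ++ h))
      to : edges (updatesTo ++ h) ⊆ H
      to {e} e∈ with ∈-++⁻ fresh (subst (e ∈_) edges-all e∈)
      ... | inj₁ p = proj₁ (∈-fresh⁻ p)
      ... | inj₂ q = proj₁ (proj₂ (remaining q))
      from : H ⊆ edges (updatesTo ++ h)
      from {e} e∈ with (e ∈? edges h) ×-dec upToDate? e
      ... | yes (e∈h , ok) = subst (e ∈_) (sym edges-all)
          (∈-++⁺ʳ fresh (∈-edges-deletes⁺ stale {h} e∈h λ e∈s → proj₂ (∈-stale⁻ e∈s) ok))
      ... | no ¬ok         = subst (e ∈_) (sym edges-all)
          (∈-++⁺ˡ (∈-filter⁺ (λ e → ¬? ((e ∈? edges h) ×-dec upToDate? e)) e∈ ¬ok))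
      updated : ∀ {e} → e ∈ H → e ∈ fresh ⊎ weight (deletes stale ++ h) e ≡ w e
      updated {e} e∈ with (e ∈? edges h) ×-dec upToDate? e
      ... | yes (_ , _ , eq) = inj₂ (trans (weight-deletes stale h e) eq)
      ... | no ¬ok           = inj₁ (∈-filter⁺ (λ e → ¬? ((e ∈? edges h) ×-dec upToDate? e)) e∈ ¬ok)

    length-updatesTo : length updatesTo ≡ length fresh + length stale
    length-updatesTo = trans (length-++ (inserts w fresh)) (cong₂ _+_ (length-map _ fresh) (length-map _ stale))

  -- The input for tree `j`, written down without looking at any output: `greedyLoad` predicts the
  -- trees. It does not depend on the size of the packing, so a change of size only appends or drops
  -- runs at the end.
  run : List (EdgeSet n) → ℕ → Run n
  run []       j = []
  run (H ∷ Hs) j = updatesTo H (greedyWeight H j) (run Hs j) ++ run Hs j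

  run-for : ∀ hs j → All Unique hs → RunFor (top hs) (greedyWeight (top hs) j) (run hs j)
  run-for []       j _        = record { isRun = [] ; sameEdges = ↭-refl ; weights = λ () }
  run-for (H ∷ Hs) j (u ∷ us) = updatesTo-correct H (greedyWeight H j) (run Hs j) u
      (RunFor.isRun (run-for Hs j us))

  module _ {K : ℕ} (1≤K : 1 ≤ K) where

    adjacent-unique : ∀ {b} {H H′ : EdgeSet n} → Adjacent K b H H′ → Unique H′
    adjacent-unique record { extra = e ; uniqueᵇ = uB ; sides = inj₁ (_ , refl) } = -‿unique e uB
    adjacent-unique record { uniqueᵇ = uB ; sides = inj₂ (_ , refl) }             = uB

    -- The extra edge accounts for one update and each edge of changed load for a deletion and an
    -- insertion; `changed-greedyLoad` counts the latter edges.
    adjacent-cost : ∀ {b} {H H′ : EdgeSet n} {j h} → Adjacent K b H H′ → RunFor H (greedyWeight H j) h →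
      ∃[ B ] ∃[ e ] (Unique B × Strong K B × length B ≤ b × e ∈ B ×
        length (updatesTo H′ (greedyWeight H′ j) h) ≤ 1 + 2 * greedyLoad B j e)
    adjacent-cost {b} {H} {H′} {j} {h} adj@record
        { bigger = B ; extra = e ; extra∈ = e∈ ; uniqueᵇ = uB ; strongᵇ = strongᵇ ; strongˢ = strongˢ ; size =
        size ; sides = sides } rf =
      B , e , uB , strongᵇ , size , e∈ , (begin
        length (updatesTo H′ w′ h)                        ≡⟨ length-updatesTo H′ w′ h ⟩
        length (fresh H′ w′ h) + length (stale H′ w′ h)   ≤⟨ total sides ⟩
        1 + 2 * length changed                            ≤⟨ s≤s (*-monoʳ-≤ 2 changed≤) ⟩
        1 + 2 * greedyLoad B j e                          ∎)
      where
      open ≤-Reasoning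
      open RunFor rf
      w′ = greedyWeight H′ j
      differs? : ∀ f → Dec (¬ greedyLoad (B - e) j f ≡ greedyLoad B j f)
      differs? f = ¬? (greedyLoad (B - e) j f ≟ℕ greedyLoad B j f)
      changed = filter differs? (B - e)
      changed≤ : length changed ≤ greedyLoad B j e
      changed≤ = ≤-trans (≤-reflexive (length-filter≡∑ differs? (B - e))) (changed-greedyLoad uB e∈
        (strong⇒connected {H = B} 1≤K strongᵇ) (strong⇒connected {H = B - e} 1≤K strongˢ) j)
      uFresh : Unique (fresh H′ w′ h)
      uFresh = Unique.filter⁺ _ (adjacent-unique adj)
      uStale : Unique (stale H′ w′ h)
      uStale = Unique.filter⁺ _ (edges-unique h isRun)
      total : (H ≡ B × H′ ≡ B - e) ⊎ (H ≡ B - e × H′ ≡ B) →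
              length (fresh H′ w′ h) + length (stale H′ w′ h) ≤ 1 + 2 * length changed
      total (inj₁ (refl , refl)) = ≤-trans
          (+-mono-≤ (length-⊆ uFresh fresh⊆) (length-⊆ {ys = e ∷ changed} uStale stale⊆))
          (≤-reflexive (trans (+-suc _ _) (cong (λ m → suc (length changed + m)) (sym (+-identityʳ _)))))
        where
        same : ∀ {f} → f ∈ B → greedyLoad (B - e) j f ≡ greedyLoad B j f → weight h f ≡ w′ f
        same {f} f∈ eq = trans (weights f∈) (cong (λ k → W k f) (sym eq))
        fresh⊆ : fresh H′ w′ h ⊆ changed
        fresh⊆ f∈ with ∈-fresh⁻ H′ w′ h f∈
        ... | f∈H′ , ¬ok = ∈-filter⁺ differs? f∈H′ λ eq → ¬ok
            (∈-resp-↭ (↭-sym sameEdges) (proj₁ (∈--⁻ {D = B} f∈H′)) , f∈H′ , same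
            (proj₁ (∈--⁻ {D = B} f∈H′)) eq)
        stale⊆ : stale H′ w′ h ⊆ e ∷ changed
        stale⊆ {f} f∈ with ∈-stale⁻ H′ w′ h f∈ | f ≟ e
        ... | _          , _   | yes refl = here refl
        ... | f∈h , ¬ok | no f≢e = there (∈-filter⁺ differs? f∈′ λ eq → ¬ok (f∈′ , same f∈B eq))
          where
          f∈B = ∈-resp-↭ sameEdges f∈h
          f∈′ = ∈--⁺ f∈B f≢e
      total (inj₂ (refl , refl)) = ≤-trans
          (+-mono-≤ (length-⊆ {ys = e ∷ changed} uFresh fresh⊆) (length-⊆ uStale stale⊆))
          (≤-reflexive (cong (λ m → suc (length changed + m)) (sym (+-identityʳ _))))
        where
        same : ∀ {f} → f ∈ B - e → greedyLoad (B - e) j f ≡ greedyLoad B j f → weight h f ≡ w′ f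
        same {f} f∈ eq = trans (weights f∈) (cong (λ k → W k f) eq)
        fresh⊆ : fresh H′ w′ h ⊆ e ∷ changed
        fresh⊆ {f} f∈ with ∈-fresh⁻ H′ w′ h f∈ | f ≟ e
        ... | _         | yes refl = here refl
        ... | f∈B , ¬ok | no f≢e = there
            (∈-filter⁺ differs? f∈′ λ eq → ¬ok (∈-resp-↭ (↭-sym sameEdges) f∈′ , f∈B , same f∈′ eq))
          where
          f∈′ = ∈--⁺ f∈B f≢e
        stale⊆ : stale H′ w′ h ⊆ changed
        stale⊆ f∈ with ∈-stale⁻ H′ w′ h f∈
        ... | f∈h , ¬ok = ∈-filter⁺ differs? f∈′ λ eq → ¬ok (proj₁ (∈--⁻ {D = B} f∈′) , same f∈′ eq)
          where
          f∈′ = ∈-resp-↭ sameEdges f∈h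

    grows-unique : ∀ {b m} {hs hs′ : List (EdgeSet n)} → Grows K b m hs hs′ → All Unique hs → All Unique hs′
    grows-unique stay        us = us
    grows-unique (grow g adj) us = adjacent-unique adj ∷ grows-unique g us

    grows-cost : suc K ^ K ≤ 4 * K ^ K → ∀ q {s b m} {hs hs′ : List (EdgeSet n)} → Grows K b m hs hs′ → All
        Unique hs → b ≤ 2 ^ s →
      ∀ {j} → j ≤ K * q → ∃[ us ] (run hs′ j ≡ us ++ run hs j × length us ≤ m * (1 + 2 * (2 * q + s)))
    grows-cost hK q stay _ _ _ = [] , refl , z≤n
    grows-cost hK q {s} {m = suc m} (grow {hs = hs} {hs′ = hs′} {H = H} g adj) us b≤ {j} j≤
      with grows-cost hK q g us b≤ j≤ | adjacent-cost {j = j} adj (run-for hs′ j (grows-unique g us))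
    ... | vs , eq , vs≤ | B , e , uB , sB , B≤ , e∈ , cost≤ = new ++ vs , trans (cong (new ++_) eq)
        (sym (++-assoc new vs (run hs j))) , (begin
        length (new ++ vs)           ≡⟨ length-++ new ⟩
        length new + length vs
            ≤⟨ +-mono-≤ (≤-trans cost≤ (s≤s (*-monoʳ-≤ 2 (≤-trans (greedyLoad-mono B e j≤)
                                          (greedyLoad-bound {K = K} {B} uB sB 1≤K hK q
                                              (≤-trans B≤ b≤) e∈))))) vs≤ ⟩
        suc m * (1 + 2 * (2 * q + s)) ∎)
      where
      open ≤-Reasoning
      new = updatesTo H (greedyWeight H j) (run hs′ j)

-- The trees of the given algorithm form the predicted greedy packing

module _ {n r : ℕ} (A : MSTAlgorithm n r) where

  open DecMembership (_≟_ {n}) using (_∈?_; _∉?_)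
  open MSTAlgorithm A
  open Kruskal using (lighter; ∈-lighter⁻; ∈-lighter⁺)

  length-changes : ∀ us (h : Run n) → IsRun (us ++ h) → changes A h us ≤ length us * r
  length-changes []       h _           = z≤n
  length-changes (u ∷ us) h isRun@(_ , isRun′) = +-mono-≤ (recourse u (us ++ h) isRun)
      (length-changes us h isRun′)

  runsFrom : List (EdgeSet n) → ℕ → ℕ → List (Run n)
  runsFrom hs j zero    = []
  runsFrom hs j (suc k) = run hs j ∷ runsFrom hs (suc j) k

  length-runsFrom : ∀ hs j k → length (runsFrom hs j k) ≡ k
  length-runsFrom hs j zero    = refl
  length-runsFrom hs j (suc k) = cong suc (length-runsFrom hs (suc j) k)

  runsFrom-split : ∀ hs j k before {h after} → runsFrom hs j k ≡ before ++ h ∷ after →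
                   before ≡ runsFrom hs j (length before) × h ≡ run hs (j + length before)
  runsFrom-split hs j (suc k) []       eq with ∷-injective eq
  ... | refl , _ = refl , cong (run hs) (sym (+-identityʳ j))
  runsFrom-split hs j zero    (_ ∷ _)  ()
  runsFrom-split hs j (suc k) (b ∷ bs) eq with ∷-injective eq
  ... | refl , eq′ with runsFrom-split hs (suc j) k bs eq′
  ...   | p , q = cong (run hs j ∷_) p , trans q (cong (run hs) (sym (+-suc j (length bs))))

  transition : ∀ {B} hs hs′ j k k′ → All Unique hs′ →
    (∀ i → i < j + k′ → ∃[ us ] (run hs′ i ≡ us ++ run hs i × length us ≤ B)) →
    ∃[ x ] (_⟶_[_] A (runsFrom hs j k) (runsFrom hs′ j k′) x × x ≤ k′ * (B * r))
  transition hs hs′ j zero    k′       _  _ = 0 , append , z≤n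
  transition hs hs′ j (suc k) zero     _  _ = 0 , drop , z≤n
  transition {B} hs hs′ j (suc k) (suc k′) us cost
    with transition hs hs′ (suc j) k k′ us (λ i i< → cost i (≤-trans i< (≤-reflexive (sym (+-suc j k′)))))
       | cost j (≤-trans (s≤s (m≤m+n j k′)) (≤-reflexive (sym (+-suc j k′))))
  ... | x , rest , x≤ | vs , eq , vs≤ = changes A (run hs j) vs + x
      , subst (λ h → _⟶_[_] A (runsFrom hs j (suc k)) (h ∷ runsFrom hs′ (suc j) k′)
          (changes A (run hs j) vs + x)) (sym eq) (continue vs rest)
      , +-mono-≤ (≤-trans (length-changes vs (run hs j) (subst IsRun eq (RunFor.isRun (run-for hs′ j us))))
          (*-monoˡ-≤ r vs≤)) x≤

  module _ {hs : List (EdgeSet n)} (uniques : All Unique hs) (unique : Unique (top hs))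
      (connected : Connected (top hs)) where

    H : EdgeSet n
    H = top hs

    module _ (j : ℕ) where

      open RunFor (run-for hs j uniques)

      T : EdgeSet n
      T = tree (run hs j)

      edges⊆ : edges (run hs j) ⊆ H
      edges⊆ = ∈-resp-↭ sameEdges

      ⊆edges : H ⊆ edges (run hs j)
      ⊆edges = ∈-resp-↭ (↭-sym sameEdges)

      run-mst : IsMST (edges (run hs j)) (weight (run hs j)) T
      run-mst = correct (run hs j) isRun λ u v → mapʷ ⊆edges (connected u v)

      mst-weight : IsMST H (greedyWeight H j) T
      mst-weight = record
        { spanningTree = record
          { unique = unique′ ; subgraph = edges⊆ ∘ subgraph ; connected = connected′ ; acyclic = acyclic }
        ; minimal = λ S st → subst₂ _≤ℚ_ (same (edges⊆ ∘ subgraph)) (same (IsSpanningTree.subgraph st))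
            (minimal S (lift st)) }
        where
        open IsMST run-mst
        open IsSpanningTree spanningTree renaming (unique to unique′; connected to connected′)
        lift : ∀ {S} → IsSpanningTree H S → IsSpanningTree (edges (run hs j)) S
        lift st = record { unique = IsSpanningTree.unique st ; subgraph = ⊆edges ∘ IsSpanningTree.subgraph st
                         ; connected = IsSpanningTree.connected st ; acyclic = IsSpanningTree.acyclic st }
        same : ∀ {S} → S ⊆ H → totalWeight (weight (run hs j)) S ≡ totalWeight (greedyWeight H j) S
        same {[]}    _   = refl
        same {e ∷ S} sub = cong₂ _+ℚ_ (weights (sub (here refl))) (same (sub ∘ there))

      -- The weights are injective, so Kruskal's criterion leaves `A` no choice.
      ∈-tree : ∀ {f} → f ∈ H → ⟦ f ∈? T ⟧ ≡ ⟦ greedyTree? H j f ⟧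
      ∈-tree {f} f∈ = ⟦⟧-cong (f ∈? T) (greedyTree? H j f)
        (mst-edge⇒¬Conn-lighter mst-weight L (proj₁ ∘ ∈-lighter⁻ (greedyWeight H j) {H})
            (proj₂ ∘ ∈-lighter⁻ (greedyWeight H j) {H}))
        (¬Conn-lighter⇒mst-edge mst-weight L (∈-lighter⁺ (greedyWeight H j))
            (λ _ → greedyWeight-injective H j) f∈)
        where
        L = lighter (greedyWeight H j) H f

    -- This confirms the prediction: the loads from which the runs were built are those of the trees
    -- that `A` outputs.
    count-trees : ∀ j k {f} → f ∈ H →
      greedyLoad H j f + length (filter (f ∈?_) (trees A (runsFrom hs j k))) ≡ greedyLoad H (j + k) f
    count-trees j zero    {f} f∈ = trans (+-identityʳ _) (cong (λ j → greedyLoad H j f) (sym (+-identityʳ j)))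
    count-trees j (suc k) {f} f∈ = begin
        greedyLoad H j f + length (filter (f ∈?_) (T j ∷ ts))
            ≡⟨ cong (greedyLoad H j f +_) (length-filter≡∑ (f ∈?_) (T j ∷ ts)) ⟩
        greedyLoad H j f + (⟦ f ∈? T j ⟧ + ∑ ts (λ t → ⟦ f ∈? t ⟧))
            ≡⟨ cong₂ (λ a b → greedyLoad H j f + (a + b)) (∈-tree j f∈) (sym (length-filter≡∑ (f ∈?_) ts)) ⟩
        greedyLoad H j f + (⟦ greedyTree? H j f ⟧ + length (filter (f ∈?_) ts))
            ≡⟨ +-assoc (greedyLoad H j f) _ _ ⟨
        greedyLoad H (suc j) f + length (filter (f ∈?_) ts)                  ≡⟨ count-trees (suc j) k f∈ ⟩
        greedyLoad H (suc j + k) f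
            ≡⟨ cong (λ j → greedyLoad H j f) (+-suc j k) ⟨
        greedyLoad H (j + suc k) f                                           ∎
      where
      open ≡-Reasoning
      ts = trees A (runsFrom hs (suc j) k)

    load≡ : ∀ j {f} → f ∈ H → load (trees A (runsFrom hs 0 j)) f ≡ fromℕ (greedyLoad H j f)
    load≡ j f∈ = cong fromℕ (count-trees 0 j f∈)

    maintained : ∀ k → IsMaintained A (record { graph = H ; runs = runsFrom hs 0 k })
    maintained k = record
        { graph-unique  = unique
        ; isTreePacking = spanning 0 k
        ; eachTreeByA   = λ before h after eq → case runsFrom-split hs 0 k before eq of λ { (p , q) →
            subst₂ (λ b h → RunsOn A H (load (trees A b)) h) (sym p) (sym q) (runsOn (length before)) } }
      where
      spanning : ∀ j k → All (IsSpanningTree H) (trees A (runsFrom hs j k))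
      spanning j zero    = []
      spanning j (suc k) = IsMST.spanningTree (mst-weight j) ∷ spanning (suc j) k
      runsOn : ∀ j → RunsOn A H (load (trees A (runsFrom hs 0 j))) (run hs j)
      runsOn j = record
          { isRun = isRun ; sameEdges = sameEdges
          ; refinesLoad = λ e∈ f∈ lt → subst₂ _<ℚ_ (sym (weights e∈)) (sym (weights f∈))
              (W-< _ _ (fromℕ-cancel-< (subst₂ _<ℚ_ (load≡ j e∈) (load≡ j f∈) lt))) }
        where open RunFor (run-for hs j uniques)

    -- The trees are minimum for the loads with ties added. A spanning tree has at most `n` edges,
    -- whose ties add up to less than 1, so minimality passes to the loads themselves.
    greedy : ∀ {G} → G ⊆ H → H ⊆ G → ∀ k → IsGreedy G (trees A (runsFrom hs 0 k))
    greedy {G} G⊆H H⊆G k before T₀ after eq with map-split 0 k before eq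
      where
      map-split : ∀ j k before → trees A (runsFrom hs j k) ≡ before ++ T₀ ∷ after →
                  before ≡ trees A (runsFrom hs j (length before)) × T₀ ≡ T (j + length before)
      map-split j (suc k) []       eq with ∷-injective eq
      ... | refl , _ = refl , cong T (sym (+-identityʳ j))
      map-split j zero    (_ ∷ _)  ()
      map-split j (suc k) (b ∷ bs) eq with ∷-injective eq
      ... | refl , eq′ with map-split (suc j) k bs eq′
      ...   | p , q = cong (T j ∷_) p , trans q (cong T (sym (+-suc j (length bs))))
    ... | p , q = subst₂ (λ b t → IsMST G (load b) t) (sym p) (sym q) (record
        { spanningTree = record { unique = unique′ ; subgraph = H⊆G ∘ subgraph ; connected = connected′ ;
            acyclic = acyclic }
        ; minimal = λ S st → subst₂ _≤ℚ_ (sym (same subgraph)) (sym (same (G⊆H ∘ IsSpanningTree.subgraph st)))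
            (fromℕ-mono-≤
                (totalWeight-W-reflects-≤ (greedyLoad H j) {S} {T j}
                (≤-trans (m≤n+m (length S) (κ S)) (≤-reflexive (spanningTree-size st)))
              (minimal S (lift st)))) })
      where
      j = length before
      open IsMST (mst-weight j)
      open IsSpanningTree spanningTree renaming (unique to unique′; connected to connected′)
      lift : ∀ {S} → IsSpanningTree G S → IsSpanningTree H S
      lift st = record { unique = IsSpanningTree.unique st ; subgraph = G⊆H ∘ IsSpanningTree.subgraph st
                       ; connected = IsSpanningTree.connected st ; acyclic = IsSpanningTree.acyclic st }
      same : ∀ {S} → S ⊆ H → totalWeight (load (trees A (runsFrom hs 0 j))) S ≡ fromℕ (∑ S (greedyLoad H j))
      same {[]}    _   = refl
      same {e ∷ S} sub = trans (cong₂ _+ℚ_ (load≡ j (sub (here refl))) (same (sub ∘ there)))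
          (fromℕ-homo-+ (greedyLoad H j e) _)

-- Sizes and the final estimates

packingSize : ℕ → ℕ → ℕ
packingSize i l = 2 ^ (3 * i) * l

-- The `q` of the load bound, namely `packingSize i l` divided by `strength i`; the exponent is
-- `3 * suc i - i`.
cycles : ℕ → ℕ → ℕ
cycles zero    l = l
cycles (suc i) l = 2 ^ (3 + 2 * i) * l

packingSize≡ : ∀ i l → packingSize i l ≡ strength i * cycles i l
packingSize≡ zero    l = refl
packingSize≡ (suc i) l = begin
  2 ^ (3 * suc i) * l              ≡⟨ cong (λ k → 2 ^ k * l) (exponents i) ⟩
  2 ^ (i + (3 + 2 * i)) * l        ≡⟨ cong (_* l) (^-distribˡ-+-* 2 i (3 + 2 * i)) ⟩
  2 ^ i * 2 ^ (3 + 2 * i) * l      ≡⟨ *-assoc (2 ^ i) (2 ^ (3 + 2 * i)) l ⟩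
  2 ^ i * (2 ^ (3 + 2 * i) * l)    ∎
  where
  open ≡-Reasoning
  exponents : ∀ i → 3 * suc i ≡ i + (3 + 2 * i)
  exponents = solve-∀

cycles≤ : ∀ i l → cycles i l ≤ 2 * (2 ^ (2 * i) * l)
cycles≤ zero    l = ≤-trans (≤-reflexive (sym (*-identityˡ l))) (m≤m+n (1 * l) _)
cycles≤ (suc i) l = ≤-reflexive
    (trans (*-assoc 2 (2 ^ (2 + 2 * i)) l) (cong (λ k → 2 * (2 ^ k * l)) (sym (*-suc 2 i))))

strength≤ : ∀ i → strength i ≤ 2 ^ i
strength≤ zero    = ≤-refl
strength≤ (suc i) = m≤m+n (2 ^ i) _

m<2^[1+⌊log₂m⌋] : ∀ m → m < 2 ^ suc ⌊log₂ m ⌋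
m<2^[1+⌊log₂m⌋] m with m <? 2 ^ suc ⌊log₂ m ⌋
... | yes m< = m<
... | no  m≮ = contradiction
    (≤-trans (≤-reflexive (sym (⌊log₂[2^n]⌋≡n (suc ⌊log₂ m ⌋)))) (⌊log₂⌋-mono-≤ (≮⇒≥ m≮))) 1+n≰n

2^i≤m⇒i≤⌊log₂m⌋ : ∀ i {m} → 2 ^ i ≤ m → i ≤ ⌊log₂ m ⌋
2^i≤m⇒i≤⌊log₂m⌋ i 2^i≤m = ≤-trans (≤-reflexive (sym (⌊log₂[2^n]⌋≡n i))) (⌊log₂⌋-mono-≤ 2^i≤m)

-- The left side is the size bound of `history-grows` with `n` replaced by `2 * suc m`. As
-- `X = 2 ^ (l + 1)` exceeds `m` and is at least the strength, it is at most
-- `4 * X ^ 2 = 2 ^ (2 * l + 4)`, and `1 ≤ l` absorbs the 4 into `6 * l`.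
graphSize-bound : ∀ i m → let l = ⌊log₂ m ⌋ in i ≤ l → 1 ≤ l → suc m + m + strength i *
    (2 * suc m) ≤ 2 ^ (6 * l)
graphSize-bound i m i≤l 1≤l = begin
    suc m + m + strength i * (2 * suc m)
        ≤⟨ +-mono-≤ (+-mono-≤ m<X (<⇒≤ m<X)) (*-mono-≤ K≤X (*-monoʳ-≤ 2 m<X)) ⟩
    X + X + X * (2 * X)
        ≤⟨ +-monoˡ-≤ _
        (≤-trans (≤-reflexive (sym (*-identityʳ (X + X)))) (*-monoʳ-≤ (X + X) (m^n>0 2 (suc l)))) ⟩
    (X + X) * X + X * (2 * X)              ≡⟨ square X ⟩
    2 ^ 2 * (X * X)                        ≡⟨ cong (2 ^ 2 *_) (^-distribˡ-+-* 2 (suc l) (suc l)) ⟨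
    2 ^ 2 * 2 ^ (suc l + suc l)            ≡⟨ ^-distribˡ-+-* 2 2 (suc l + suc l) ⟨
    2 ^ (2 + (suc l + suc l))              ≤⟨ ^-monoʳ-≤ 2 exponents ⟩
    2 ^ (6 * l)                            ∎
  where
  open ≤-Reasoning
  l = ⌊log₂ m ⌋
  X = 2 ^ suc l
  m<X : m < X
  m<X = m<2^[1+⌊log₂m⌋] m
  K≤X : strength i ≤ X
  K≤X = ≤-trans (strength≤ i) (^-monoʳ-≤ 2 (m≤n⇒m≤1+n i≤l))
  square : ∀ X → (X + X) * X + X * (2 * X) ≡ 4 * (X * X)
  square = solve-∀
  exponents : 2 + (suc l + suc l) ≤ 6 * l
  exponents = begin
      2 + (suc l + suc l)   ≡⟨ expand l ⟩
      4 * 1 + 2 * l         ≤⟨ +-monoˡ-≤ (2 * l) (*-monoʳ-≤ 4 1≤l) ⟩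
      4 * l + 2 * l         ≡⟨ *-distribʳ-+ l 4 2 ⟨
      6 * l                 ∎
    where
    expand : ∀ l → 2 + (suc l + suc l) ≡ 4 * 1 + 2 * l
    expand = solve-∀

-- The 126 is `6 * (1 + 2 * (2 * 2 + 6))`: six new graphs, one update for the extra edge and two per
-- changed load, where `cycles i l` is at most twice `2 ^ (2 * i) * l`. The 8 is reserved for
-- `packingSize-≍`, where `k` may be almost `2 * 2 ^ i` and is cubed.
recourse-bound : ∀ r i l →
  packingSize i l * (6 * (1 + 2 * (2 * cycles i l + 6 * l)) * r) ≤ (126 * r + 8) * (2 ^ (5 * i) * l ^ 2)
recourse-bound r i zero    = ≤-trans
    (≤-reflexive (cong (_* (6 * (1 + 2 * (2 * cycles i 0 + 0)) * r)) (*-zeroʳ (2 ^ (3 * i))))) z≤n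
recourse-bound r i l@(suc _) = begin
    P * l * (6 * (1 + 2 * (2 * cycles i l + 6 * l)) * r)
      ≤⟨ *-monoʳ-≤ (P * l)
          (*-monoˡ-≤ r (*-monoʳ-≤ 6
          (+-mono-≤ (≤-trans (s≤s z≤n) l≤Z)
          (*-monoʳ-≤ 2 (+-mono-≤ (*-monoʳ-≤ 2 (cycles≤ i l)) (*-monoʳ-≤ 6 l≤Z)))))) ⟩
    P * l * (6 * (Y * l + 2 * (2 * (2 * (Y * l)) + 6 * (Y * l))) * r)
      ≡⟨ collect r l P Y ⟩
    126 * r * (P * Y * l ^ 2)
      ≡⟨ cong (λ k → 126 * r * (k * l ^ 2))
          (trans (sym (^-distribˡ-+-* 2 (3 * i) (2 * i))) (cong (2 ^_) (sym (*-distribʳ-+ i 3 2)))) ⟩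
    126 * r * (2 ^ (5 * i) * l ^ 2)
      ≤⟨ *-monoˡ-≤ (2 ^ (5 * i) * l ^ 2) (m≤m+n (126 * r) 8) ⟩
    (126 * r + 8) * (2 ^ (5 * i) * l ^ 2) ∎
  where
  open ≤-Reasoning
  P = 2 ^ (3 * i)
  Y = 2 ^ (2 * i)
  l≤Z : l ≤ Y * l
  l≤Z = ≤-trans (≤-reflexive (sym (*-identityˡ l))) (*-monoˡ-≤ l (m^n>0 2 (2 * i)))
  collect : ∀ r l P Y → P * l * (6 * (Y * l + 2 * (2 * (2 * (Y * l)) + 6 * (Y * l))) * r) ≡ 126 * r *
      (P * Y * (l * (l * 1)))
  collect = solve-∀

^-*-comm : ∀ a i → 2 ^ (a * i) ≡ (2 ^ i) ^ a
^-*-comm a i = trans (cong (2 ^_) (*-comm a i)) (sym (^-*-assoc 2 i a))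

x≤[c+8]*x : ∀ c x → x ≤ (c + 8) * x
x≤[c+8]*x c x = ≤-trans (≤-reflexive (sym (*-identityˡ x))) (*-monoˡ-≤ x (≤-trans (s≤s z≤n) (m≤n+m 8 c)))

packingSize-≍ : ∀ c i l {k} → 2 ^ i ≤ k → k < 2 ^ suc i → packingSize i l ≍[ c + 8 ] k ^ 3 * l
packingSize-≍ c i l {k} 2^i≤k k<2^[1+i] =
    ≤-trans (*-monoˡ-≤ l (≤-trans (≤-reflexive (^-*-comm 3 i)) (^-monoˡ-≤ 3 2^i≤k))) (x≤[c+8]*x c (k ^ 3 * l))
  , (begin
      k ^ 3 * l                         ≤⟨ *-monoˡ-≤ l (^-monoˡ-≤ 3 (<⇒≤ k<2^[1+i])) ⟩
      (2 * 2 ^ i) ^ 3 * l               ≡⟨ cong (_* l) (^-distribʳ-* 2 (2 ^ i) 3) ⟩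
      8 * (2 ^ i) ^ 3 * l               ≡⟨ cong (λ x → 8 * x * l) (^-*-comm 3 i) ⟨
      8 * 2 ^ (3 * i) * l               ≡⟨ *-assoc 8 (2 ^ (3 * i)) l ⟩
      8 * (2 ^ (3 * i) * l)             ≤⟨ *-monoˡ-≤ (2 ^ (3 * i) * l) (m≤n+m 8 c) ⟩
      (c + 8) * (2 ^ (3 * i) * l)       ∎)
  where open ≤-Reasoning

history-unique : ∀ {n K} → 1 ≤ K → ∀ {G₀ : EdgeSet n} us → IsDynamic G₀ us → All Unique (history K G₀ us)
history-unique {K = K} 1≤K {G₀} []       dyn = grows-unique 1≤K
  (proj₁ (sync-reinforced K (initialGraph K (kept G₀) ∷ []) (initialGraph-unique K (kept-unique dyn))
      (kept-unique dyn)
    (initialGraph-reinforced K (kept-unique dyn)) ≤-refl)) (initialGraph-unique K (kept-unique dyn) ∷ [])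
history-unique {K = K} 1≤K u∷us@(u ∷ us) dyn@(_ , dyn′) = grows-unique 1≤K
    (history-grows K u us dyn (λ n≤ → +-monoʳ-≤ _ (*-monoʳ-≤ K n≤))) (history-unique 1≤K us dyn′)

lemma22 : ∀ (r : ℕ) →
    ∃[ C ] Σ[ size ∈ (ℕ → ℕ → ℕ) ]
    (∀ i l → size i l ≍[ C ] 2 ^ (3 * i) * l)
    ×
    (∀ (n : ℕ) (A : MSTAlgorithm n r) →
    Σ[ 𝓣 ∈ Maintainer n ]
    (∀ (G₀ : EdgeSet n) (us : List (Update n)) → IsDynamic G₀ us →
    let G = current G₀ us in
    (∀ i → i ≤ log∣ G ∣ →
    IsMaintained A (𝓣 G₀ us i)
    × length (packing A (𝓣 G₀ us i)) ≡ size i log∣ G ∣)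
    ×
    (∀ λₜ i → IsMinCut G λₜ → 2 ^ i ≤ λₜ → λₜ < 2 ^ suc i →
    i ≤ log∣ G ∣
    × IsGreedy G (packing A (𝓣 G₀ us i))
    × length (packing A (𝓣 G₀ us i)) ≍[ C ] λₜ ^ 3 * log∣ G ∣))
    ×
    (∀ (G₀ : EdgeSet n) (us : List (Update n)) (u : Update n) →
    IsDynamic G₀ (u ∷ us) →
    ∀ i → i ≤ log∣ current G₀ us ∣ → i ≤ log∣ current G₀ (u ∷ us) ∣ →
    RecourseAtMost A (C * (2 ^ (5 * i) * log∣ current G₀ (u ∷ us) ∣ ^ 2))
    (𝓣 G₀ us i) (𝓣 G₀ (u ∷ us) i)))
lemma22 r = 126 * r + 8 , packingSize , (λ i l → x≤[c+8]*x (126 * r) _ , x≤[c+8]*x (126 * r) _) , λ n A →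
  maintainer A , (λ G₀ us dyn →
      (λ i _ → maintained A (uniques us dyn i) (unique us dyn i) (connected us dyn i) _ ,
          length-packing A G₀ us i)
    , λ k i cut 2^i≤k k<2^[1+i] →
        let G = current G₀ us
            S , uS , S⊆G , _ , ∣S∣≡k = IsMinCut.attained cut
            -- A positive minimum cut makes `G` connected, so the kept graph is all of `G`.
            kept≡ = connected⇒kept≡ {G = G} (minCut⇒connected cut (≤-trans (m^n>0 2 i) 2^i≤k))
            R = subst (λ G → Reinforced (strength i) G (top (history (strength i) G₀ us))) kept≡
                (history-reinforced (strength i) us dyn)
            uG = current-unique us dyn
        -- A minimum cut consists of edges of `G`, so `G` has at least `2 ^ i` edges.
        in 2^i≤m⇒i≤⌊log₂m⌋ i (≤-trans 2^i≤k (≤-trans (≤-reflexive (sym ∣S∣≡k)) (length-⊆ uS S⊆G)))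
         , greedy A (uniques us dyn i) (unique us dyn i) (connected us dyn i) (Reinforced.covers R)
             (strong⇒reinforced-⊆ (strength i) R uG (minCut⇒strong i uG cut 2^i≤k)) _
         , subst (_≍[ 126 * r + 8 ] k ^ 3 * log∣ G ∣) (sym (length-packing A G₀ us i))
             (packingSize-≍ (126 * r) i log∣ G ∣ 2^i≤k k<2^[1+i]))
  , λ G₀ us u dyn i _ i≤l → recourse A G₀ us u dyn i i≤l
  where
  maintainer : ∀ {n} → MSTAlgorithm n r → Maintainer n
  maintainer A G₀ us i = record
    { graph = top (history (strength i) G₀ us)
    ; runs  = runsFrom A (history (strength i) G₀ us) 0 (packingSize i log∣ current G₀ us ∣) }
  length-packing : ∀ {n} (A : MSTAlgorithm n r) G₀ us i → length (packing A (maintainer A G₀ us i)) ≡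
      packingSize i log∣ current G₀ us ∣
  length-packing A G₀ us i = trans (length-map _ (runs (maintainer A G₀ us i))) (length-runsFrom A _ 0 _)
  module _ {n} {G₀ : EdgeSet n} (us : List (Update n)) (dyn : IsDynamic G₀ us) (i : ℕ) where
    uniques : All Unique (history (strength i) G₀ us)
    uniques = history-unique (1≤strength i) us dyn
    unique : Unique (top (history (strength i) G₀ us))
    unique = Reinforced.unique (history-reinforced (strength i) us dyn)
    connected : Connected (top (history (strength i) G₀ us))
    connected = strong⇒connected {H = top (history (strength i) G₀ us)} (1≤strength i)
        (Reinforced.strong (history-reinforced (strength i) us dyn))
  recourse : ∀ {n} (A : MSTAlgorithm n r) G₀ us u → IsDynamic G₀ (u ∷ us) → ∀ i → i ≤ log∣
      current G₀ (u ∷ us) ∣ →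
             RecourseAtMost A ((126 * r + 8) * (2 ^ (5 * i) * log∣ current G₀ (u ∷ us) ∣ ^ 2))
                 (maintainer A G₀ us i) (maintainer A G₀ (u ∷ us) i)
  recourse A G₀ us u dyn i i≤l with transition A hs hs′ 0 (packingSize i log∣ current G₀ us ∣) (packingSize i l)
      (uniques (u ∷ us) dyn i) cost
    where
    K   = strength i
    hs  = history K G₀ us
    hs′ = history K G₀ (u ∷ us)
    m   = length (current G₀ (u ∷ us))
    l   = log∣ current G₀ (u ∷ us) ∣
    cost : ∀ j → j < packingSize i l → ∃[ vs ]
        (run hs′ j ≡ vs ++ run hs j × length vs ≤ 6 * (1 + 2 * (2 * cycles i l + 6 * l)))
    cost j j< = grows-cost (1≤strength i) ([1+strength]^strength i) (cycles i l) {6 * l}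
        (history-grows K u us dyn (λ n≤ → +-monoʳ-≤ (suc m + m) (*-monoʳ-≤ K n≤))) (uniques us (proj₂ dyn) i)
        (graphSize-bound i m i≤l 1≤l) (≤-trans (<⇒≤ j<) (≤-reflexive (packingSize≡ i l)))
      where
      -- A tree with index `j` exists only in a nonempty packing, which excludes `l = 0`.
      1≤l : 1 ≤ l
      1≤l with 1 ≤? l
      ... | yes 1≤l = 1≤l
      ... | no  1≰l = contradiction
          (subst (j <_) (trans (cong (packingSize i) (n<1⇒n≡0 (≰⇒> 1≰l))) (*-zeroʳ (2 ^ (3 * i)))) j<) λ ()
  ... | x , continued , x≤ = x , continued , ≤-trans x≤ (recourse-bound r i log∣ current G₀ (u ∷ us) ∣)
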